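{- Let $q,\alpha_1,\alpha_2,\alpha_3\in\mathbb{Q}$ with $q\notin[0,5]$, $\alpha_1\notin[-2,0]$, $\alpha_2\in(-2,0)$ and $\alpha_3<-1$. Suppose that, for a positive value $\rho$ which is sufficiently small with respect to $q,\alpha_1,\alpha_2,\alpha_3$, the value $a$ satisfies $$A^-\le |a|\le A^+,\qquad q+\rho<f(a)\le q+2\rho,\qquad |f(a)|\ge\eta .$$ Let $c=a^2+3a+q$. Given a positive constant $\hat\rho$ which is sufficiently small with respect to $q,\alpha_1,\alpha_2,\alpha_3$, there is a planar graph $\Upsilon$ (depending on $\hat\rho$) and a weight function $\widehat w:E(\Upsilon)\to\{\alpha_1,\alpha_2,\alpha_3\}$ that implements a weight $b$ such that $$B^-\le|b|\le B^+\qquad\text{and}\qquad -\hat\rho\le b+c\le\hat\rho .$$ The size of $\Upsilon$ is at most a polynomial in $\log(\hat\rho^{ -1})$.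
   Context: Graphs are finite and may have loops and multiple edges. The number $q$ is fixed. A planar graph $\Upsilon$ with distinct distinguished vertices $s,t$ on the outer face and weights $\widehat w:E(\Upsilon)\to\mathbb{Q}$ implements the weight $w^*$ if $Z_{s|t}(\Upsilon)\ne0$ and $w^*=qZ_{st}(\Upsilon)/Z_{s|t}(\Upsilon)$. Here $Z_{st}(\Upsilon)$ (resp. $Z_{s|t}(\Upsilon)$) is the sum of $\big(\prod_{e\in A}\widehat w(e)\big)q^{\kappa(V(\Upsilon),A)}$ over all $A\subseteq E(\Upsilon)$ such that $s,t$ are in the same component (resp. different components) of $(V(\Upsilon),A)$, and $\kappa(V(\Upsilon),A)$ is the number of connected components of $(V(\Upsilon),A)$. Constants (depending only on $q$): $f(x)=x^3+3x^2$. If $q>5$: $\eta=3/4$, $A^-=1/2$, $A^+=q$, $B^-=q$, $B^+=10q^3$. If $q<0$: let $g(y)=f(-3-y)$, which satisfies $g(0)=0$ and is strictly decreasing for $y>0$; $\eta>0$ is the real solution of $g(\eta)=q/2$, $A^-=3+\eta$; $y^*>0$ is the real solution of $g(y^*)=q$, $A^+=3+y^*$; $B^-=|q|/3$ and $B^+=4|q|/3+2$. The size bound means that the polynomial may depend on $q,\alpha_1,\alpha_2,\alpha_3$ but not on $\hat\rho$ (nor on $\rho$, $a$). -}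

module Defs where

open import Algebra.Definitions.RawSemiring using () renaming (_^_ to pow)
open import Data.Bool using (Bool; true; false; not; if_then_else_)
open import Data.Fin using (Fin; zero; suc; punchIn; punchOut)
open import Data.Fin.Properties using (_≟_; punchOut-cong; punchOut-injective; punchOut-punchIn; punchInᵢ≢i)
open import Data.Fin.Subset using (Subset; inside; outside; ⊤; _∈_)
open import Data.Integer using (+_)
open import Data.List using (List; []; _∷_)
open import Data.Nat as ℕ using (ℕ; zero; suc)
import Data.Nat.Properties as ℕₚ
open import Data.Product using (Σ; _×_; _,_; proj₁; proj₂; Σ-syntax; ∃-syntax)
open import Data.Rational as ℚ using (ℚ; 0ℚ; 1ℚ; _/_)
import Data.Rational.Properties as ℚₚ
open import Data.Rational.Solver using (module +-*-Solver)
open import Data.Sum using (_⊎_; inj₁; inj₂)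
open import Data.Vec using ([]; _∷_; here; there)
open import Function using (_∘_)
open import Function.Bundles using (_↔_; _⇔_; Inverse)
open import Level using (0ℓ)
open import Relation.Binary.Construct.Closure.Equivalence as Eq using (EqClosure)
open import Relation.Binary.Core using (Rel)
open import Relation.Binary.PropositionalEquality
open import Relation.Nullary using (¬_; Dec; yes; no; does; contradiction)
open import Relation.Nullary.Decidable using (map′)

-- Reals are Cauchy sequences of rationals, with _≃_ below as their equality.
IsCauchy : (ℕ → ℚ) → Set
IsCauchy x = ∀ ε → 0ℚ ℚ.< ε →
  ∃[ N ] (∀ m n → N ℕ.≤ m → N ℕ.≤ n → ℚ.∣ x m ℚ.- x n ∣ ℚ.≤ ε)

record ℝ : Set where
  constructor mkℝ
  field
    seq    : ℕ → ℚ
    cauchy : IsCauchy seq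

open ℝ public

private
  open +-*-Solver using (solve; _:+_; _:*_; _:-_; :-_; _:=_)

  ½ε+½ε : ∀ ε → ℚ.½ ℚ.* ε ℚ.+ ℚ.½ ℚ.* ε ≡ ε
  ½ε+½ε ε = trans (sym (ℚₚ.*-distribʳ-+ ε ℚ.½ ℚ.½)) (ℚₚ.*-identityˡ ε)

  ½-pos : ∀ {ε} → 0ℚ ℚ.< ε → 0ℚ ℚ.< ℚ.½ ℚ.* ε
  ½-pos {ε} 0<ε = subst (ℚ._< ℚ.½ ℚ.* ε) (ℚₚ.*-zeroʳ ℚ.½) (ℚₚ.*-monoʳ-<-pos ℚ.½ 0<ε)

  cauchy-+ : ∀ {x y} → IsCauchy x → IsCauchy y → IsCauchy (λ n → x n ℚ.+ y n)
  cauchy-+ {x} {y} cx cy ε 0<ε with cx (ℚ.½ ℚ.* ε) (½-pos 0<ε) | cy (ℚ.½ ℚ.* ε) (½-pos 0<ε)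
  ... | N , p | M , r = N ℕ.⊔ M , λ m n hm hn → begin
    ℚ.∣ (x m ℚ.+ y m) ℚ.- (x n ℚ.+ y n) ∣
      ≡⟨ cong ℚ.∣_∣ (solve 4 (λ a b c d → (a :+ b) :- (c :+ d) := (a :- c) :+ (b :- d)) refl
           (x m) (y m) (x n) (y n)) ⟩
    ℚ.∣ (x m ℚ.- x n) ℚ.+ (y m ℚ.- y n) ∣
      ≤⟨ ℚₚ.∣p+q∣≤∣p∣+∣q∣ (x m ℚ.- x n) (y m ℚ.- y n) ⟩
    ℚ.∣ x m ℚ.- x n ∣ ℚ.+ ℚ.∣ y m ℚ.- y n ∣
      ≤⟨ ℚₚ.+-mono-≤
           (p m n (ℕₚ.≤-trans (ℕₚ.m≤m⊔n N M) hm) (ℕₚ.≤-trans (ℕₚ.m≤m⊔n N M) hn))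
           (r m n (ℕₚ.≤-trans (ℕₚ.m≤n⊔m N M) hm) (ℕₚ.≤-trans (ℕₚ.m≤n⊔m N M) hn)) ⟩
    ℚ.½ ℚ.* ε ℚ.+ ℚ.½ ℚ.* ε ≡⟨ ½ε+½ε ε ⟩
    ε ∎
    where open ℚₚ.≤-Reasoning

  cauchy-neg : ∀ {x} → IsCauchy x → IsCauchy (λ n → ℚ.- x n)
  cauchy-neg {x} cx ε 0<ε with cx ε 0<ε
  ... | N , p = N , λ m n hm hn → subst (ℚ._≤ ε)
    (trans (sym (ℚₚ.∣-p∣≡∣p∣ (x m ℚ.- x n)))
           (cong ℚ.∣_∣ (solve 2 (λ a b → :- (a :- b) := (:- a) :- (:- b)) refl (x m) (x n))))
    (p m n hm hn)

  p≤q+∣p-q∣ : ∀ p q → ℚ.∣ p ∣ ℚ.≤ ℚ.∣ q ∣ ℚ.+ ℚ.∣ p ℚ.- q ∣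
  p≤q+∣p-q∣ p q = subst (λ z → ℚ.∣ z ∣ ℚ.≤ ℚ.∣ q ∣ ℚ.+ ℚ.∣ p ℚ.- q ∣)
    (solve 2 (λ a b → b :+ (a :- b) := a) refl p q)
    (ℚₚ.∣p+q∣≤∣p∣+∣q∣ q (p ℚ.- q))

  ∣p-q∣-sym : ∀ p q → ℚ.∣ p ℚ.- q ∣ ≡ ℚ.∣ q ℚ.- p ∣
  ∣p-q∣-sym p q = trans (sym (ℚₚ.∣-p∣≡∣p∣ (p ℚ.- q)))
    (cong ℚ.∣_∣ (solve 2 (λ a b → :- (a :- b) := b :- a) refl p q))

  move : ∀ {a b d} → a ℚ.≤ b ℚ.+ d → a ℚ.- b ℚ.≤ d
  move {a} {b} {d} h = subst (a ℚ.- b ℚ.≤_)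
    (solve 2 (λ b d → b :+ d :- b := d) refl b d) (ℚₚ.+-monoˡ-≤ (ℚ.- b) h)

  ∣∣p∣-∣q∣∣≤∣p-q∣ : ∀ p q → ℚ.∣ ℚ.∣ p ∣ ℚ.- ℚ.∣ q ∣ ∣ ℚ.≤ ℚ.∣ p ℚ.- q ∣
  ∣∣p∣-∣q∣∣≤∣p-q∣ p q with ℚₚ.∣p∣≡p∨∣p∣≡-p (ℚ.∣ p ∣ ℚ.- ℚ.∣ q ∣)
  ... | inj₁ e = subst (ℚ._≤ ℚ.∣ p ℚ.- q ∣) (sym e) (move (p≤q+∣p-q∣ p q))
  ... | inj₂ e = subst₂ ℚ._≤_
    (sym (trans e (solve 2 (λ a b → :- (a :- b) := b :- a) refl ℚ.∣ p ∣ ℚ.∣ q ∣)))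
    (∣p-q∣-sym q p) (move (p≤q+∣p-q∣ q p))

  cauchy-abs : ∀ {x} → IsCauchy x → IsCauchy (λ n → ℚ.∣ x n ∣)
  cauchy-abs {x} cx ε 0<ε with cx ε 0<ε
  ... | N , p = N , λ m n hm hn →
    ℚₚ.≤-trans (∣∣p∣-∣q∣∣≤∣p-q∣ (x m) (x n)) (p m n hm hn)

  bounded : ∀ {x} → IsCauchy x →
    ∃[ B ] (0ℚ ℚ.< B × ∃[ N ] (∀ n → N ℕ.≤ n → ℚ.∣ x n ∣ ℚ.≤ B))
  bounded {x} cx with cx 1ℚ (ℚₚ.positive⁻¹ 1ℚ)
  ... | N , p = ℚ.∣ x N ∣ ℚ.+ 1ℚ
    , ℚₚ.+-mono-≤-< (ℚₚ.0≤∣p∣ (x N)) (ℚₚ.positive⁻¹ 1ℚ)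
    , N , λ n hn → ℚₚ.≤-trans (p≤q+∣p-q∣ (x n) (x N))
                     (ℚₚ.+-monoʳ-≤ ℚ.∣ x N ∣ (p n N hn ℕₚ.≤-refl))

  scale : ∀ B ε → 0ℚ ℚ.< B → 0ℚ ℚ.< ε → ∃[ δ ] (0ℚ ℚ.< δ × B ℚ.* δ ≡ ε)
  scale B ε 0<B 0<ε = ℚ.1/ B ℚ.* ε
    , subst (ℚ._< ℚ.1/ B ℚ.* ε) (ℚₚ.*-zeroʳ (ℚ.1/ B)) (ℚₚ.*-monoʳ-<-pos (ℚ.1/ B) 0<ε)
    , trans (sym (ℚₚ.*-assoc B (ℚ.1/ B) ε))
            (trans (cong (ℚ._* ε) (ℚₚ.*-inverseʳ B)) (ℚₚ.*-identityˡ ε))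
    where
    instance
      B-pos : ℚ.Positive B
      B-pos = ℚ.positive 0<B
      B-nz : ℚ.NonZero B
      B-nz = ℚₚ.pos⇒nonZero B
      1/B-pos : ℚ.Positive (ℚ.1/ B)
      1/B-pos = ℚₚ.1/pos⇒pos B

  *-mono-≤ : ∀ {p q r s} → 0ℚ ℚ.≤ p → p ℚ.≤ q → 0ℚ ℚ.≤ r → r ℚ.≤ s → p ℚ.* r ℚ.≤ q ℚ.* s
  *-mono-≤ {p} {q} {r} {s} 0≤p p≤q 0≤r r≤s = ℚₚ.≤-trans
    (ℚₚ.*-monoʳ-≤-nonNeg r {{ℚ.nonNegative 0≤r}} p≤q)
    (ℚₚ.*-monoˡ-≤-nonNeg q {{ℚ.nonNegative (ℚₚ.≤-trans 0≤p p≤q)}} r≤s)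

  split-* : ∀ a b c d → a ℚ.* b ℚ.- c ℚ.* d ≡ a ℚ.* (b ℚ.- d) ℚ.+ (a ℚ.- c) ℚ.* d
  split-* = solve 4 (λ a b c d → a :* b :- c :* d := a :* (b :- d) :+ (a :- c) :* d) refl

  collect : ∀ B C δ → B ℚ.* δ ℚ.+ δ ℚ.* C ≡ (B ℚ.+ C) ℚ.* δ
  collect = solve 3 (λ b c d → b :* d :+ d :* c := (b :+ c) :* d) refl

  *-close : ∀ {B C δ} a b c d → ℚ.∣ a ∣ ℚ.≤ B → ℚ.∣ d ∣ ℚ.≤ C →
    ℚ.∣ a ℚ.- c ∣ ℚ.≤ δ → ℚ.∣ b ℚ.- d ∣ ℚ.≤ δ →
    ℚ.∣ a ℚ.* b ℚ.- c ℚ.* d ∣ ℚ.≤ (B ℚ.+ C) ℚ.* δ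
  *-close {B} {C} {δ} a b c d a≤B d≤C a-c≤δ b-d≤δ = begin
    ℚ.∣ a ℚ.* b ℚ.- c ℚ.* d ∣
      ≡⟨ cong ℚ.∣_∣ (split-* a b c d) ⟩
    ℚ.∣ a ℚ.* (b ℚ.- d) ℚ.+ (a ℚ.- c) ℚ.* d ∣
      ≤⟨ ℚₚ.∣p+q∣≤∣p∣+∣q∣ (a ℚ.* (b ℚ.- d)) ((a ℚ.- c) ℚ.* d) ⟩
    ℚ.∣ a ℚ.* (b ℚ.- d) ∣ ℚ.+ ℚ.∣ (a ℚ.- c) ℚ.* d ∣
      ≡⟨ cong₂ ℚ._+_ (ℚₚ.∣p*q∣≡∣p∣*∣q∣ a (b ℚ.- d)) (ℚₚ.∣p*q∣≡∣p∣*∣q∣ (a ℚ.- c) d) ⟩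
    ℚ.∣ a ∣ ℚ.* ℚ.∣ b ℚ.- d ∣ ℚ.+ ℚ.∣ a ℚ.- c ∣ ℚ.* ℚ.∣ d ∣
      ≤⟨ ℚₚ.+-mono-≤ (*-mono-≤ {ℚ.∣ a ∣} {B} {ℚ.∣ b ℚ.- d ∣} {δ} (ℚₚ.0≤∣p∣ a) a≤B (ℚₚ.0≤∣p∣ (b ℚ.- d)) b-d≤δ)
                     (*-mono-≤ {ℚ.∣ a ℚ.- c ∣} {δ} {ℚ.∣ d ∣} {C} (ℚₚ.0≤∣p∣ (a ℚ.- c)) a-c≤δ (ℚₚ.0≤∣p∣ d) d≤C) ⟩
    B ℚ.* δ ℚ.+ δ ℚ.* C ≡⟨ collect B C δ ⟩
    (B ℚ.+ C) ℚ.* δ ∎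
    where open ℚₚ.≤-Reasoning

  cauchy-* : ∀ {x y} → IsCauchy x → IsCauchy y → IsCauchy (λ n → x n ℚ.* y n)
  cauchy-* {x} {y} cx cy ε 0<ε = let
      B , 0<B , N₁ , bx = bounded {x} cx
      C , 0<C , N₂ , by = bounded {y} cy
      δ , 0<δ , eq      = scale (B ℚ.+ C) ε (ℚₚ.+-mono-< 0<B 0<C) 0<ε
      N₃ , p            = cx δ 0<δ
      N₄ , r            = cy δ 0<δ
    in finish B C δ eq N₁ N₂ N₃ N₄ bx by p r
    where
    finish : ∀ B C δ → (B ℚ.+ C) ℚ.* δ ≡ ε → ∀ N₁ N₂ N₃ N₄ →
      (∀ n → N₁ ℕ.≤ n → ℚ.∣ x n ∣ ℚ.≤ B) →
      (∀ n → N₂ ℕ.≤ n → ℚ.∣ y n ∣ ℚ.≤ C) →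
      (∀ m n → N₃ ℕ.≤ m → N₃ ℕ.≤ n → ℚ.∣ x m ℚ.- x n ∣ ℚ.≤ δ) →
      (∀ m n → N₄ ℕ.≤ m → N₄ ℕ.≤ n → ℚ.∣ y m ℚ.- y n ∣ ℚ.≤ δ) →
      ∃[ N ] (∀ m n → N ℕ.≤ m → N ℕ.≤ n → ℚ.∣ x m ℚ.* y m ℚ.- x n ℚ.* y n ∣ ℚ.≤ ε)
    finish B C δ refl N₁ N₂ N₃ N₄ bx by p r = N , λ m n hm hn →
      *-close {B} {C} {δ} (x m) (y m) (x n) (y n) (bx m (≤₁ hm)) (by n (≤₂ hn))
        (p m n (≤₃ hm) (≤₃ hn)) (r m n (≤₄ hm) (≤₄ hn))
      where
      N = (N₁ ℕ.⊔ N₂) ℕ.⊔ (N₃ ℕ.⊔ N₄)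
      ≤₁ : ∀ {k} → N ℕ.≤ k → N₁ ℕ.≤ k
      ≤₁ = ℕₚ.m⊔n≤o⇒m≤o N₁ N₂ ∘ ℕₚ.m⊔n≤o⇒m≤o (N₁ ℕ.⊔ N₂) (N₃ ℕ.⊔ N₄)
      ≤₂ : ∀ {k} → N ℕ.≤ k → N₂ ℕ.≤ k
      ≤₂ = ℕₚ.m⊔n≤o⇒n≤o N₁ N₂ ∘ ℕₚ.m⊔n≤o⇒m≤o (N₁ ℕ.⊔ N₂) (N₃ ℕ.⊔ N₄)
      ≤₃ : ∀ {k} → N ℕ.≤ k → N₃ ℕ.≤ k
      ≤₃ = ℕₚ.m⊔n≤o⇒m≤o N₃ N₄ ∘ ℕₚ.m⊔n≤o⇒n≤o (N₁ ℕ.⊔ N₂) (N₃ ℕ.⊔ N₄)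
      ≤₄ : ∀ {k} → N ℕ.≤ k → N₄ ℕ.≤ k
      ≤₄ = ℕₚ.m⊔n≤o⇒n≤o N₃ N₄ ∘ ℕₚ.m⊔n≤o⇒n≤o (N₁ ℕ.⊔ N₂) (N₃ ℕ.⊔ N₄)

infix  8 -_
infixr 8 _^_
infixl 7 _*_
infixl 6 _+_ _-_
infix  4 _≤_ _<_ _≃_

⟦_⟧ : ℚ → ℝ
⟦ p ⟧ = mkℝ (λ _ → p) λ ε 0<ε → 0 , λ _ _ _ _ →
  subst (ℚ._≤ ε) (sym (cong ℚ.∣_∣ (ℚₚ.+-inverseʳ p))) (ℚₚ.<⇒≤ 0<ε)

nat : ℕ → ℝ
nat n = ⟦ + n / 1 ⟧

_+_ : ℝ → ℝ → ℝ
x + y = mkℝ (λ n → seq x n ℚ.+ seq y n) (cauchy-+ {seq x} {seq y} (cauchy x) (cauchy y))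

-_ : ℝ → ℝ
- x = mkℝ (λ n → ℚ.- seq x n) (cauchy-neg {seq x} (cauchy x))

_-_ : ℝ → ℝ → ℝ
x - y = x + (- y)

_*_ : ℝ → ℝ → ℝ
x * y = mkℝ (λ n → seq x n ℚ.* seq y n) (cauchy-* {seq x} {seq y} (cauchy x) (cauchy y))

∣_∣ : ℝ → ℝ
∣ x ∣ = mkℝ (λ n → ℚ.∣ seq x n ∣) (cauchy-abs {seq x} (cauchy x))

_^_ : ℝ → ℕ → ℝ
x ^ zero  = nat 1
x ^ suc n = x * x ^ n

_≤_ : ℝ → ℝ → Set
x ≤ y = ∀ ε → 0ℚ ℚ.< ε → ∃[ N ] (∀ n → N ℕ.≤ n → seq x n ℚ.≤ seq y n ℚ.+ ε)

_<_ : ℝ → ℝ → Set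
x < y = ∃[ ε ] (0ℚ ℚ.< ε × ∃[ N ] (∀ n → N ℕ.≤ n → seq x n ℚ.+ ε ℚ.≤ seq y n))

_≃_ : ℝ → ℝ → Set
x ≃ y = x ≤ y × y ≤ x

-- Coefficients in order of increasing degree.
evalPoly : List ℝ → ℝ → ℝ
evalPoly []       x = nat 0
evalPoly (a ∷ as) x = a + x * evalPoly as x

-- L = log₂ (y⁻¹) for y > 0, through the cut of L in ℚ:
-- (k - l) / n ≤ L exactly when 2 ^ ((k - l) / n) ≤ y⁻¹.
IsLog₂Recip : ℝ → ℝ → Set
IsLog₂Recip y L = ∀ k l n → (nat 2 ^ k * y ^ n ≤ nat 2 ^ l) ⇔ (nat k - nat l ≤ nat n * L)

record Classes {A : Set} (_~_ : Rel A 0ℓ) : Set where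
  field
    count      : ℕ
    class      : A → Fin count
    surjective : ∀ k → ∃[ x ] class x ≡ k
    sound      : ∀ {x y} → x ~ y → class x ≡ class y
    complete   : ∀ {x y} → class x ≡ class y → x ~ y

record Graph : Set where
  field
    #V   : ℕ
    #E   : ℕ
    ends : Fin #E → Fin #V × Fin #V

size : Graph → ℕ
size G = Graph.#V G ℕ.+ Graph.#E G

Joins : ∀ {n m} → (Fin m → Fin n × Fin n) → Subset m → Rel (Fin n) 0ℓ
Joins ends A u v = ∃[ e ] (e ∈ A × ends e ≡ (u , v))

Linked : ∀ {n m} → (Fin m → Fin n × Fin n) → Subset m → Rel (Fin n) 0ℓ
Linked ends A = EqClosure (Joins ends A)

private
  module _ {n m} (ends : Fin (suc m) → Fin n × Fin n) (A : Subset m) where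

    weaken : ∀ {b u v} → Linked (ends ∘ suc) A u v → Linked ends (b ∷ A) u v
    weaken = Eq.map λ (e , e∈A , p) → suc e , there e∈A , p

    skip : Classes (Linked (ends ∘ suc) A) → Classes (Linked ends (outside ∷ A))
    skip C = record
      { count = count ; class = class ; surjective = surjective
      ; sound = sound ∘ Eq.map λ { (suc e , there e∈A , p) → e , e∈A , p }
      ; complete = weaken ∘ complete }
      where open Classes C

    module _ (C : Classes (Linked (ends ∘ suc) A)) where
      open Classes C

      u₀ v₀ : Fin n
      u₀ = proj₁ (ends zero)
      v₀ = proj₂ (ends zero)

      edge₀ : Linked ends (inside ∷ A) u₀ v₀
      edge₀ = Eq.return (zero , here , refl)

      via : ∀ {k} (f : Fin n → Fin k) → f u₀ ≡ f v₀ →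
        (∀ {x y} → class x ≡ class y → f x ≡ f y) →
        ∀ {x y} → Linked ends (inside ∷ A) x y → f x ≡ f y
      via f e₀ h = Eq.gfold isEquivalence f λ
        { (zero  , _         , p) → subst (λ uv → f (proj₁ uv) ≡ f (proj₂ uv)) p e₀
        ; (suc e , there e∈A , p) → h (sound (Eq.return (e , e∈A , p))) }

      keep : class u₀ ≡ class v₀ → Classes (Linked ends (inside ∷ A))
      keep e₀ = record
        { count = count ; class = class ; surjective = surjective
        ; sound = via class e₀ (λ e → e) ; complete = weaken ∘ complete }

    merge : (C : Classes (Linked (ends ∘ suc) A)) →
      Classes.class C (u₀ C) ≢ Classes.class C (v₀ C) → Classes (Linked ends (inside ∷ A))
    merge C@record { count = suc k ; class = class ; surjective = surjective ; complete = complete } u≢v =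
      record
        { count = k ; class = cl ; surjective = surj
        ; sound = via C cl cl-uv cl-cong ; complete = compl }
      where
      u = u₀ C
      v = v₀ C

      redirect : ∀ i → Dec (class u ≡ i) → Fin k
      redirect i (yes _)  = punchOut u≢v
      redirect i (no u≢i) = punchOut u≢i

      cl : Fin n → Fin k
      cl x = redirect (class x) (class u ≟ class x)

      cl-cong : ∀ {x y} → class x ≡ class y → cl x ≡ cl y
      cl-cong = cong λ i → redirect i (class u ≟ i)

      redirect-no : ∀ {i} (d : Dec (class u ≡ i)) (u≢i : class u ≢ i) → redirect i d ≡ punchOut u≢i
      redirect-no (yes e) u≢i = contradiction e u≢i
      redirect-no (no _)  u≢i = punchOut-cong (class u) refl

      redirect-yes : ∀ {i} (d : Dec (class u ≡ i)) → class u ≡ i → redirect i d ≡ punchOut u≢v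
      redirect-yes (yes _) e = refl
      redirect-yes (no ¬e) e = contradiction e ¬e

      cl-uv : cl u ≡ cl v
      cl-uv = trans (redirect-yes (class u ≟ class u) refl)
                    (sym (redirect-no (class u ≟ class v) u≢v))

      surj : ∀ j → ∃[ x ] cl x ≡ j
      surj j with surjective (punchIn (class u) j)
      ... | x , e = x , trans (cong (λ i → redirect i (class u ≟ i)) e)
        (trans (redirect-no (class u ≟ punchIn (class u) j) (punchInᵢ≢i (class u) j ∘ sym))
               (punchOut-punchIn (class u)))

      old : ∀ {x y} → class x ≡ class y → Linked ends (inside ∷ A) x y
      old = weaken ∘ complete

      _⟫_ : ∀ {x y z} → Linked ends (inside ∷ A) x y → Linked ends (inside ∷ A) y z →
        Linked ends (inside ∷ A) x z
      _⟫_ = Eq.transitive _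

      compl′ : ∀ {x y} (d : Dec (class u ≡ class x)) (d′ : Dec (class u ≡ class y)) →
        redirect (class x) d ≡ redirect (class y) d′ → Linked ends (inside ∷ A) x y
      compl′ (yes p) (yes r) _ = old (trans (sym p) r)
      compl′ (yes p) (no ¬r) e =
        old (sym p) ⟫ (edge₀ C ⟫ old (punchOut-injective u≢v ¬r e))
      compl′ (no ¬p) (yes r) e =
        old (punchOut-injective ¬p u≢v e) ⟫ (Eq.symmetric _ (edge₀ C) ⟫ old r)
      compl′ (no ¬p) (no ¬r) e = old (punchOut-injective ¬p ¬r e)

      compl : ∀ {x y} → cl x ≡ cl y → Linked ends (inside ∷ A) x y
      compl {x} {y} = compl′ (class u ≟ class x) (class u ≟ class y)
    merge C@record { count = zero ; class = class } u≢v with class (u₀ C)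
    ... | ()

components : ∀ {n m} (ends : Fin m → Fin n × Fin n) (A : Subset m) → Classes (Linked ends A)
components {n} ends [] = record
  { count = n ; class = λ v → v ; surjective = λ v → v , refl
  ; sound = Eq.fold isEquivalence λ { (() , _) } ; complete = λ { refl → Eq.reflexive _ } }
components ends (outside ∷ A) = skip ends A (components (ends ∘ suc) A)
components ends (inside ∷ A) = add (components (ends ∘ suc) A)
  where
  add : Classes (Linked (ends ∘ suc) A) → Classes (Linked ends (inside ∷ A))
  add C with Classes.class C (u₀ ends A C) ≟ Classes.class C (v₀ ends A C)
  ... | yes e = keep ends A C e
  ... | no ¬e = merge ends A C ¬e

module _ (G : Graph) where
  open Graph G

  Connected : Subset #E → Rel (Fin #V) 0ℓ
  Connected A = Linked ends A

  connected? : ∀ A u v → Dec (Connected A u v)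
  connected? A u v = map′ complete sound (class u ≟ class v)
    where open Classes (components ends A)

  κ : Subset #E → ℕ
  κ A = Classes.count (components ends A)

module _ (G : Graph) where
  open Graph G

  -- Each edge (u , v) has two darts, one leaving u and one leaving v.
  Dart : Set
  Dart = Fin #E × Bool

  tail : Dart → Fin #V
  tail (e , false) = proj₁ (ends e)
  tail (e , true)  = proj₂ (ends e)

  rev : Dart → Dart
  rev (e , b) = e , not b

  Orbit : (Dart → Dart) → Rel Dart 0ℓ
  Orbit π = EqClosure λ d d′ → π d ≡ d′

  Isolated : Fin #V → Set
  Isolated v = ∀ d → tail d ≢ v

  -- A visit of a boundary walk to a vertex.  The boundary walk of an
  -- isolated vertex has no darts and consists of a single visit.
  Visit : Set
  Visit = Dart ⊎ Σ (Fin #V) Isolated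

  at : Visit → Fin #V
  at (inj₁ d)       = tail d
  at (inj₂ (v , _)) = v

  data SameWalk (φ : Dart → Dart) : Rel Visit 0ℓ where
    along    : ∀ {d d′} → Orbit φ d d′ → SameWalk φ (inj₁ d) (inj₁ d′)
    isolated : ∀ {v i i′} → SameWalk φ (inj₂ (v , i)) (inj₂ (v , i′))

  -- The rotation sends a dart to the next one in the cyclic order around its
  -- tail.  The number V - E + F of a component, with F its number of
  -- boundary walks, is at most 2, and is 2 exactly if the component is drawn
  -- in the sphere; so the summed equation makes every component plane.
  record PlaneEmbedding : Set where
    field
      rotation  : Dart ↔ Dart
      at-vertex : ∀ d d′ → Orbit (Inverse.to rotation) d d′ ⇔ tail d ≡ tail d′

    nextOnFace : Dart → Dart
    nextOnFace = Inverse.to rotation ∘ rev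

    field
      walks : Classes (SameWalk nextOnFace)
      euler : #V ℕ.+ Classes.count walks ≡ #E ℕ.+ 2 ℕ.* κ G ⊤

  -- Whether the drawing can have both s and t on its outer face: any boundary
  -- walk of a component can be made its outer one, and the components can be
  -- drawn side by side.
  OnOuterFace : PlaneEmbedding → Rel (Fin #V) 0ℓ
  OnOuterFace P s t = ¬ Connected G ⊤ s t
    ⊎ ∃[ x ] ∃[ y ] (at x ≡ s × at y ≡ t × SameWalk (PlaneEmbedding.nextOnFace P) x y)

record PlanarNetwork : Set where
  field
    graph     : Graph
  open Graph graph public
  field
    s t       : Fin #V
    s≢t       : s ≢ t
    embedding : PlaneEmbedding graph
    outer     : OnOuterFace graph embedding s t

sumSubsets : ∀ {m} → (Subset m → ℚ) → ℚ
sumSubsets {zero}  h = h []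
sumSubsets {suc m} h = sumSubsets (h ∘ (outside ∷_)) ℚ.+ sumSubsets (h ∘ (inside ∷_))

prodOver : ∀ {m} → (Fin m → ℚ) → Subset m → ℚ
prodOver w []            = 1ℚ
prodOver w (outside ∷ A) = prodOver (w ∘ suc) A
prodOver w (inside ∷ A)  = w zero ℚ.* prodOver (w ∘ suc) A

module _ (q : ℚ) (Υ : PlanarNetwork) (w : Fin (PlanarNetwork.#E Υ) → ℚ) where
  open PlanarNetwork Υ

  term : Subset #E → ℚ
  term A = prodOver w A ℚ.* pow ℚ.+-*-rawSemiring q (κ graph A)

  Z-st : ℚ
  Z-st = sumSubsets λ A → if does (connected? graph A s t) then term A else 0ℚ

  Z-s∣t : ℚ
  Z-s∣t = sumSubsets λ A → if does (connected? graph A s t) then 0ℚ else term A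

  Implements : ℚ → Set
  Implements w* = Σ[ nz ∈ Z-s∣t ≢ 0ℚ ] w* ≡ ℚ._÷_ (q ℚ.* Z-st) Z-s∣t {{ℚ.≢-nonZero nz}}

f : ℝ → ℝ
f x = x ^ 3 + nat 3 * x ^ 2

g : ℝ → ℝ
g y = f (- nat 3 - y)

-- For q < 0, η and y* are the unique positive reals satisfying their equations.
data Constants (q : ℚ) : Set where
  above5 : + 5 / 1 ℚ.< q → Constants q
  below0 : q ℚ.< 0ℚ →
           (η : ℝ)  → nat 0 < η  → g η  ≃ ⟦ q ℚ.* ℚ.½ ⟧ →
           (y* : ℝ) → nat 0 < y* → g y* ≃ ⟦ q ⟧ → Constants q

module _ {q : ℚ} where

  η A⁻ A⁺ B⁻ B⁺ : Constants q → ℝ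

  η (above5 _)             = ⟦ + 3 / 4 ⟧
  η (below0 _ η _ _ _ _ _) = η

  A⁻ (above5 _)             = ⟦ ℚ.½ ⟧
  A⁻ (below0 _ η _ _ _ _ _) = nat 3 + η

  A⁺ (above5 _)              = ⟦ q ⟧
  A⁺ (below0 _ _ _ _ y* _ _) = nat 3 + y*

  B⁻ (above5 _)             = ⟦ q ⟧
  B⁻ (below0 _ _ _ _ _ _ _) = ⟦ + 1 / 3 ⟧ * ∣ ⟦ q ⟧ ∣

  B⁺ (above5 _)             = nat 10 * ⟦ q ⟧ ^ 3
  B⁺ (below0 _ _ _ _ _ _ _) = ⟦ + 4 / 3 ⟧ * ∣ ⟦ q ⟧ ∣ + nat 2

{-# OPTIONS --safe #-}
module Submission where

-- In the coordinates y = 1 + w and x = 1 + q / w, joining networks in parallel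
-- multiplies y and joining them in series multiplies x.  Since x = 1 + q / α₂
-- satisfies |x| > 1, paths with an odd number of edges of weight α₂ have
-- y = 1 - d with d > 0 decreasing geometrically in the number of edges.
-- Parallel edges of weight α₁, where |1 + α₁| > 1, with one edge of weight α₃
-- if a negative value is wanted (q > 5), produce a y beyond the target 1 - c;
-- multiplying greedily by 1 - d for smaller and smaller d then approaches the
-- target geometrically, and each d is used a bounded number of times.  The
-- resulting graphs consist of parallel paths from s to t and are planar.

open import Algebra.Definitions.RawSemiring using () renaming (_^_ to pow)
open import Data.Bool using (Bool; true; false; not; if_then_else_)
open import Data.Fin using (Fin; zero; suc)
import Data.Fin.Properties as Finₚ
open import Data.Fin.Subset using (Subset; inside; outside; ⊤; _∈_)
open import Data.Fin.Subset.Properties using (∈⊤)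
open import Data.Integer as ℤ using (+_; -[1+_])
import Data.Integer.Properties as ℤₚ
open import Data.List using (List; []; _∷_)
open import Data.Nat as ℕ using (ℕ; zero; suc)
import Data.Nat.Coprimality as Coprimality
import Data.Nat.Properties as ℕₚ
open import Data.Nat.Tactic.RingSolver using (solve-∀)
open import Data.Product as Product using (Σ; _×_; _,_; proj₁; proj₂; ∃-syntax; Σ-syntax)
open import Data.Rational as ℚ using (ℚ; 0ℚ; 1ℚ; ½; _/_)
import Data.Rational.Properties as ℚₚ
open import Data.Rational.Solver using (module +-*-Solver)
open import Data.Sum using (_⊎_; inj₁; inj₂)
open import Data.Sum.Function.Propositional using (_⊎-↔_)
open import Data.Vec using ([]; _∷_; here; there)
import Data.Vec.Functional as F
open import Function using (_∘_; id)
open import Function.Bundles using (_⇔_; mk⇔; Equivalence; _↔_; mk↔ₛ′; Inverse)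
open import Function.Construct.Composition using (_↔-∘_)
open import Function.Construct.Identity using (↔-id)
open import Function.Construct.Symmetry using (↔-sym)
open import Level using (0ℓ)
open import Relation.Binary.Construct.Closure.Equivalence as Eq using (EqClosure)
open import Relation.Binary.Core using (Rel)
open import Relation.Binary.PropositionalEquality
open import Relation.Nullary using (¬_; Dec; yes; no; does; contradiction)
open import Relation.Nullary.Decidable using (does-⇔; dec-true)
open import Defs using (Classes; Graph; Joins; Linked; components; Connected; connected?; κ; sumSubsets; prodOver)
open import Defs using (Dart; tail; rev; SameWalk; along; isolated; Visit; Isolated; PlaneEmbedding; OnOuterFace; PlanarNetwork; Implements; size)

open +-*-Solver using (solve; _:+_; _:*_; _:-_; :-_; _:=_; con)

-- A factor 1 - d can only shrink a positive quantity, so the sign is fixed beforehand: with s = 1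
-- for q < 0 and s = -1 for q > 5, the greedy search runs on P = s(1 + b) > 0, whose target s(1 - c)
-- is at least 1. The same s gives s x > 1. This is why path lengths k are odd: then s x^k is
-- positive and large for either sign of x. Polynomial size comes from the lengths of the paths: the
-- j-th kind has length linear in j, each kind is used at most a fixed number of times, and J stages
-- leave a relative error of at most 2^-J. Hence n binary digits cost O(n²) vertices and edges. The
-- order on Cauchy reals is not decidable, so the search never meets a real number: its target is
-- computed from a single term of the sequence of c, taken far enough out, and ρ̂ enters only
-- through powers of two that enclose it.

-- Partition functions under parallel and series composition.

module PartitionFunctions where
  open import Data.Rational using (_+_; _*_)

  Ends : ℕ → ℕ → Set
  Ends n m = Fin m → Fin n × Fin n

  graph : ∀ {n m} → Ends n m → Graph
  graph {n} {m} E = record { #V = n ; #E = m ; ends = E }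

  module _ {A : Set} {_~_ : Rel A 0ℓ} where
    open Classes

    private
      to : (C C′ : Classes _~_) → Fin (count C) → Fin (count C′)
      to C C′ k = class C′ (proj₁ (surjective C k))

      to-injective : ∀ C C′ {k l} → to C C′ k ≡ to C C′ l → k ≡ l
      to-injective C C′ {k} {l} e = trans (sym (proj₂ (surjective C k)))
        (trans (sound C (complete C′ e)) (proj₂ (surjective C l)))

    -- Choosing representatives gives injections between the index sets both ways. `κ` is computed
    -- by adding edges one at a time; through this lemma it can be read off from any explicit
    -- description of the components.
    count-unique : (C C′ : Classes _~_) → count C ≡ count C′
    count-unique C C′ = ℕₚ.≤-antisym
      (Finₚ.injective⇒≤ (to-injective C C′)) (Finₚ.injective⇒≤ (to-injective C′ C))

  κ-unique : ∀ {n m} (E : Ends n m) A (C : Classes (Linked E A)) → κ (graph E) A ≡ Classes.count C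
  κ-unique E A C = count-unique (components E A) C

  module _ {n m} (E : Ends n (suc m)) (A : Subset m) where
    private
      u = proj₁ (E zero)
      v = proj₂ (E zero)

    κ-joined : Linked (E ∘ suc) A u v → κ (graph E) (inside ∷ A) ≡ κ (graph (E ∘ suc)) A
    κ-joined l with components (E ∘ suc) A
    ... | C with Classes.class C u Finₚ.≟ Classes.class C v
    ...   | yes _ = refl
    ...   | no ¬e = contradiction (Classes.sound C l) ¬e

    κ-joining : ¬ Linked (E ∘ suc) A u v → suc (κ (graph E) (inside ∷ A)) ≡ κ (graph (E ∘ suc)) A
    κ-joining ¬l with components (E ∘ suc) A
    ... | C with Classes.class C u Finₚ.≟ Classes.class C v
    ...   | yes e = contradiction (Classes.complete C e) ¬l
    κ-joining ¬l | record { count = suc k } | no ¬e = refl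
    κ-joining ¬l | record { count = zero ; class = class } | no ¬e with class u
    ... | ()

  linked-trans : ∀ {n m} {E : Ends n m} {A x y z} → Linked E A x y → Linked E A y z → Linked E A x z
  linked-trans = Eq.transitive _

  linked-sym : ∀ {n m} {E : Ends n m} {A x y} → Linked E A x y → Linked E A y x
  linked-sym = Eq.symmetric _

  edge : ∀ {n m} {E : Ends n m} {A} e → e ∈ A → Linked E A (proj₁ (E e)) (proj₂ (E e))
  edge e e∈A = Eq.return (e , e∈A , refl)

  -- Vertex `zero` is going to be the midpoint of a subdivided edge. If at least one half of that
  -- edge is selected, the midpoint hangs on an old vertex and `κ` stays the same (`Attached`);
  -- otherwise it is a component by itself (`Isolated`).
  module Fresh {n m m′} (E : Ends n m) (A : Subset m) (E′ : Ends (suc n) m′) (A′ : Subset m′)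
    (lift : ∀ {x y} → Joins E A x y → Linked E′ A′ (suc x) (suc y)) where
    private
      C = components E A
      open Classes C

      lift* : ∀ {x y} → Linked E A x y → Linked E′ A′ (suc x) (suc y)
      lift* = Eq.gfold (Eq.isEquivalence _) suc lift

    module Attached (u : Fin n) (zero~u : Linked E′ A′ zero (suc u))
      (step : ∀ {x y} → Joins E′ A′ x y → Linked E A ((u F.∷ id) x) ((u F.∷ id) y)) where
      private
        r : Fin (suc n) → Fin n
        r = u F.∷ id

        back : ∀ {x y} → Linked E′ A′ x y → Linked E A (r x) (r y)
        back = Eq.gfold (Eq.isEquivalence _) r step

        fill : ∀ x → Linked E′ A′ x (suc (r x))
        fill zero    = zero~u
        fill (suc x) = Eq.reflexive _

      κ-attached : κ (graph E′) A′ ≡ κ (graph E) A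
      κ-attached = κ-unique E′ A′ (record
        { count = count ; class = class ∘ r
        ; surjective = λ k → suc (proj₁ (surjective k)) , proj₂ (surjective k)
        ; sound = sound ∘ back
        ; complete = λ {x} {y} e → linked-trans (fill x)
            (linked-trans (lift* (complete e)) (linked-sym (fill y))) })

      linked-attached : ∀ {x y} → Linked E′ A′ (suc x) (suc y) ⇔ Linked E A x y
      linked-attached = mk⇔ back lift*

    module Isolated (step : ∀ {x y} → Joins E′ A′ x y →
        ∃[ x′ ] ∃[ y′ ] (x ≡ suc x′ × y ≡ suc y′ × Joins E A x′ y′)) where
      private
        cl : Fin (suc n) → Fin (suc count)
        cl zero    = zero
        cl (suc x) = suc (class x)

        cl-sound : ∀ {x y} → Linked E′ A′ x y → cl x ≡ cl y
        cl-sound = Eq.gfold isEquivalence cl λ j → one (step j)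
          where
          one : ∀ {x y} → ∃[ x′ ] ∃[ y′ ] (x ≡ suc x′ × y ≡ suc y′ × Joins E A x′ y′) → cl x ≡ cl y
          one (_ , _ , refl , refl , j) = cong suc (sound (Eq.return j))

        cl-surjective : ∀ k → ∃[ x ] cl x ≡ k
        cl-surjective zero    = zero , refl
        cl-surjective (suc k) = suc (proj₁ (surjective k)) , cong suc (proj₂ (surjective k))

        cl-complete : ∀ x y → cl x ≡ cl y → Linked E′ A′ x y
        cl-complete zero    zero    _ = Eq.reflexive _
        cl-complete (suc x) (suc y) e = lift* (complete (Finₚ.suc-injective e))

      κ-isolated : κ (graph E′) A′ ≡ suc (κ (graph E) A)
      κ-isolated = κ-unique E′ A′ (record
        { count = suc count ; class = cl ; surjective = cl-surjective
        ; sound = cl-sound ; complete = λ {x} {y} → cl-complete x y })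

      linked-isolated : ∀ {x y} → Linked E′ A′ (suc x) (suc y) ⇔ Linked E A x y
      linked-isolated = mk⇔ (complete ∘ Finₚ.suc-injective ∘ cl-sound) lift*

  sumSubsets-cong : ∀ {m} {h k : Subset m → ℚ} → (∀ A → h A ≡ k A) → sumSubsets h ≡ sumSubsets k
  sumSubsets-cong {zero}  e = e []
  sumSubsets-cong {suc m} e =
    cong₂ _+_ (sumSubsets-cong (e ∘ (outside ∷_))) (sumSubsets-cong (e ∘ (inside ∷_)))

  sumSubsets-+ : ∀ {m} (h k : Subset m → ℚ) →
    sumSubsets (λ A → h A + k A) ≡ sumSubsets h + sumSubsets k
  sumSubsets-+ {zero}  h k = refl
  sumSubsets-+ {suc m} h k = trans
    (cong₂ _+_ (sumSubsets-+ (h ∘ (outside ∷_)) (k ∘ (outside ∷_)))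
               (sumSubsets-+ (h ∘ (inside ∷_)) (k ∘ (inside ∷_))))
    (solve 4 (λ a b c d → (a :+ b) :+ (c :+ d) := (a :+ c) :+ (b :+ d)) refl
      (sumSubsets (h ∘ (outside ∷_))) (sumSubsets (k ∘ (outside ∷_)))
      (sumSubsets (h ∘ (inside ∷_))) (sumSubsets (k ∘ (inside ∷_))))

  sumSubsets-* : ∀ {m} c (h : Subset m → ℚ) → sumSubsets (λ A → c * h A) ≡ c * sumSubsets h
  sumSubsets-* {zero}  c h = refl
  sumSubsets-* {suc m} c h = trans
    (cong₂ _+_ (sumSubsets-* c (h ∘ (outside ∷_))) (sumSubsets-* c (h ∘ (inside ∷_))))
    (sym (ℚₚ.*-distribˡ-+ c (sumSubsets (h ∘ (outside ∷_))) (sumSubsets (h ∘ (inside ∷_)))))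

  select : Bool → Bool → ℚ → ℚ
  select true  c x = if c then x else 0ℚ
  select false c x = if c then 0ℚ else x

  sumSubsets-scale : ∀ {m} c {h k : Subset m → ℚ} → (∀ A → h A ≡ c * k A) →
    sumSubsets h ≡ c * sumSubsets k
  sumSubsets-scale c {k = k} e = trans (sumSubsets-cong e) (sumSubsets-* c k)

  select-* : ∀ β c x y → select β c (x * y) ≡ x * select β c y
  select-* true  true  x y = refl
  select-* true  false x y = sym (ℚₚ.*-zeroʳ x)
  select-* false true  x y = sym (ℚₚ.*-zeroʳ x)
  select-* false false x y = refl

  select-scale : ∀ β {P Q : Set} → P ⇔ Q → (p : Dec P) (r : Dec Q) → ∀ a y {x} → x ≡ a * y →
    select β (does p) x ≡ a * select β (does r) y
  select-scale β P⇔Q p r a y x≡ay =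
    trans (cong₂ (select β) (does-⇔ P⇔Q p r) x≡ay) (select-* β (does r) a y)

  subdivide : ∀ {n m} → Ends n (suc m) → Ends (suc n) (suc (suc m))
  subdivide E = (suc (proj₁ (E zero)) , zero) F.∷ (zero , suc (proj₂ (E zero)))
    F.∷ (Product.map suc suc ∘ E ∘ suc)

  module Partition (q : ℚ) where

    infixr 8 q^_
    q^_ : ℕ → ℚ
    q^_ = pow ℚ.+-*-rawSemiring q

    -- Z true is Z-st and Z false is Z-s∣t.
    Z : Bool → ∀ {n m} → Ends n m → Fin n → Fin n → (Fin m → ℚ) → ℚ
    Z β E s t w = sumSubsets λ A →
      select β (does (connected? (graph E) A s t)) (prodOver w A * q^ κ (graph E) A)

    -- The coefficient of the weight of edge `zero` in `Z β`, which is affine in that weight.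
    Z₁ : Bool → ∀ {n m} → Ends n (suc m) → Fin n → Fin n → (Fin m → ℚ) → ℚ
    Z₁ β E s t w = sumSubsets λ A →
      select β (does (connected? (graph E) (inside ∷ A) s t)) (prodOver w A * q^ κ (graph E) (inside ∷ A))

    Z-edge : ∀ β {n m} (E : Ends n (suc m)) s t z w →
      Z β E s t (z F.∷ w) ≡ Z β (E ∘ suc) s t w + z * Z₁ β E s t w
    Z-edge β E s t z w = cong (λ x → Z β (E ∘ suc) s t w + x)
      (sumSubsets-scale z λ A → select-scale β id⇔ (conn A) (conn A) z (prodOver w A * q^ κ (graph E) (inside ∷ A))
        (ℚₚ.*-assoc z (prodOver w A) (q^ κ (graph E) (inside ∷ A))))
      where
      id⇔ : ∀ {P : Set} → P ⇔ P
      id⇔ = mk⇔ id id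
      conn : ∀ A → Dec (Connected (graph E) (inside ∷ A) s t)
      conn A = connected? (graph E) (inside ∷ A) s t

    module _ {n m} (E : Ends n (suc m)) (s t : Fin n) where
      private
        E₀ = E ∘ suc
        E′ = subdivide E
        u = proj₁ (E zero)
        v = proj₂ (E zero)

      module _ (A : Subset m) where
        private
          up : ∀ {b b′ x y} → Joins E₀ A x y → Linked E′ (b ∷ b′ ∷ A) (suc x) (suc y)
          up (e , e∈A , refl) = edge (suc (suc e)) (there (there e∈A))

          up-inside : ∀ {x y} → Joins E (inside ∷ A) x y → Linked E′ (inside ∷ inside ∷ A) (suc x) (suc y)
          up-inside (zero , here , refl) = linked-trans (edge zero here) (edge (suc zero) (there here))
          up-inside (suc e , there e∈A , refl) = edge (suc (suc e)) (there (there e∈A))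

          down-oo : ∀ {x y} → Joins E′ (outside ∷ outside ∷ A) x y →
            ∃[ x′ ] ∃[ y′ ] (x ≡ suc x′ × y ≡ suc y′ × Joins E₀ A x′ y′)
          down-oo (suc (suc e) , there (there e∈A) , refl) = _ , _ , refl , refl , (e , e∈A , refl)

          down-io : ∀ {x y} → Joins E′ (inside ∷ outside ∷ A) x y →
            Linked E₀ A ((u F.∷ id) x) ((u F.∷ id) y)
          down-io (zero , here , refl) = Eq.reflexive _
          down-io (suc (suc e) , there (there e∈A) , refl) = edge e e∈A

          down-oi : ∀ {x y} → Joins E′ (outside ∷ inside ∷ A) x y →
            Linked E₀ A ((v F.∷ id) x) ((v F.∷ id) y)
          down-oi (suc zero , there here , refl) = Eq.reflexive _
          down-oi (suc (suc e) , there (there e∈A) , refl) = edge e e∈A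

          down-ii : ∀ {x y} → Joins E′ (inside ∷ inside ∷ A) x y →
            Linked E (inside ∷ A) ((u F.∷ id) x) ((u F.∷ id) y)
          down-ii (zero , here , refl) = Eq.reflexive _
          down-ii (suc zero , there here , refl) = edge zero here
          down-ii (suc (suc e) , there (there e∈A) , refl) = edge (suc e) (there e∈A)

          module OO = Fresh.Isolated E₀ A E′ (outside ∷ outside ∷ A) up down-oo
          module IO = Fresh.Attached E₀ A E′ (inside ∷ outside ∷ A) up u (linked-sym (edge zero here)) down-io
          module OI = Fresh.Attached E₀ A E′ (outside ∷ inside ∷ A) up v (edge (suc zero) (there here)) down-oi
          module II = Fresh.Attached E (inside ∷ A) E′ (inside ∷ inside ∷ A) up-inside
            u (linked-sym (edge zero here)) down-ii

        module _ (β : Bool) (w : Fin m → ℚ) where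
          private
            P = prodOver w A
            k₀ = κ (graph E₀) A
            k₁ = κ (graph E) (inside ∷ A)

            c₀ : Dec (Connected (graph E₀) A s t)
            c₀ = connected? (graph E₀) A s t
            c₁ : Dec (Connected (graph E) (inside ∷ A) s t)
            c₁ = connected? (graph E) (inside ∷ A) s t
            c′ : ∀ B → Dec (Connected (graph E′) B (suc s) (suc t))
            c′ B = connected? (graph E′) B (suc s) (suc t)

            term′ : (Fin (2 ℕ.+ m) → ℚ) → Subset (2 ℕ.+ m) → ℚ
            term′ w′ B = select β (does (c′ B)) (prodOver w′ B * q^ κ (graph E′) B)

            T₀ T₁ : ℚ
            T₀ = select β (does c₀) (P * q^ k₀)
            T₁ = select β (does c₁) (P * q^ k₁)

          term-oo : ∀ z α → term′ (z F.∷ α F.∷ w) (outside ∷ outside ∷ A) ≡ q * T₀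
          term-oo z α = select-scale β OO.linked-isolated (c′ _) c₀ q (P * q^ k₀)
            (trans (cong (λ k → P * q^ k) OO.κ-isolated)
              (solve 3 (λ p a x → p :* (a :* x) := a :* (p :* x)) refl P q (q^ k₀)))

          term-oi : ∀ z α → term′ (z F.∷ α F.∷ w) (outside ∷ inside ∷ A) ≡ α * T₀
          term-oi z α = select-scale β OI.linked-attached (c′ _) c₀ α (P * q^ k₀)
            (trans (cong (λ k → α * P * q^ k) OI.κ-attached) (ℚₚ.*-assoc α P (q^ k₀)))

          term-io : ∀ z α → term′ (z F.∷ α F.∷ w) (inside ∷ outside ∷ A) ≡ z * T₀
          term-io z α = select-scale β IO.linked-attached (c′ _) c₀ z (P * q^ k₀)
            (trans (cong (λ k → z * P * q^ k) IO.κ-attached) (ℚₚ.*-assoc z P (q^ k₀)))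

          term-ii : ∀ z α → term′ (z F.∷ α F.∷ w) (inside ∷ inside ∷ A) ≡ z * α * T₁
          term-ii z α = select-scale β II.linked-attached (c′ _) c₁ (z * α) (P * q^ k₁)
            (trans (cong (λ k → z * (α * P) * q^ k) II.κ-attached)
              (solve 4 (λ z a p x → z :* (a :* p) :* x := z :* a :* (p :* x)) refl z α P (q^ k₁)))

      -- The series law. With neither half selected the midpoint contributes a component, hence `q`;
      -- one half contributes `z` or `α` and links nothing old; both halves act like the original
      -- edge with weight `z * α`. So both partition functions acquire the same factor `q + z + α`,
      -- which cancels in their quotient. The value of `ω` is given by a product so that no division
      -- occurs here.
      Z-subdivide : ∀ β z α ω w → (q + z + α) * ω ≡ z * α →
        Z β E′ (suc s) (suc t) (z F.∷ α F.∷ w) ≡ (q + z + α) * Z β E s t (ω F.∷ w)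
      Z-subdivide β z α ω w e = begin
        Z β E′ (suc s) (suc t) (z F.∷ α F.∷ w)
          ≡⟨ cong₂ _+_
               (cong₂ _+_ (sumSubsets-scale q λ A → term-oo A β w z α)
                          (sumSubsets-scale α λ A → term-oi A β w z α))
               (cong₂ _+_ (sumSubsets-scale z λ A → term-io A β w z α)
                          (sumSubsets-scale (z * α) λ A → term-ii A β w z α)) ⟩
        (q * S₀ + α * S₀) + (z * S₀ + z * α * S₁)
          ≡⟨ cong (λ x → (q * S₀ + α * S₀) + (z * S₀ + x * S₁)) (sym e) ⟩
        (q * S₀ + α * S₀) + (z * S₀ + (q + z + α) * ω * S₁)
          ≡⟨ solve 6 (λ q z α ω a b → (q :* a :+ α :* a) :+ (z :* a :+ (q :+ z :+ α) :* ω :* b)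
                       := (q :+ z :+ α) :* (a :+ ω :* b)) refl q z α ω S₀ S₁ ⟩
        (q + z + α) * (S₀ + ω * S₁)
          ≡⟨ cong ((q + z + α) *_) (sym (Z-edge β E s t ω w)) ⟩
        (q + z + α) * Z β E s t (ω F.∷ w) ∎
        where
        open ≡-Reasoning
        S₀ = Z β E₀ s t w
        S₁ = Z₁ β E s t w

    module _ {n m} (E₀ : Ends n m) (s t : Fin n) where
      private
        E = (s , t) F.∷ E₀

        joined : ∀ A → Connected (graph E) (inside ∷ A) s t
        joined A = edge zero here

      Z₁-false : ∀ w → Z₁ false E s t w ≡ 0ℚ
      Z₁-false w = trans (sumSubsets-scale 0ℚ {k = λ _ → 0ℚ} λ A →
          cong (λ c → select false c (prodOver w A * q^ κ (graph E) (inside ∷ A)))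
            (dec-true (connected? (graph E) (inside ∷ A) s t) (joined A)))
        (ℚₚ.*-zeroˡ (sumSubsets {m} λ _ → 0ℚ))

      -- The extra edge always links `s` and `t`. Where they were linked already, `κ` is unchanged
      -- and the factor `q` remains; where they were not, `κ` drops by one and `q` makes up for it.
      q*Z₁-true : ∀ w → q * Z₁ true E s t w ≡ q * Z true E₀ s t w + Z false E₀ s t w
      q*Z₁-true w = begin
        q * Z₁ true E s t w
          ≡⟨ sumSubsets-* q T₁ ⟨
        sumSubsets (λ A → q * T₁ A)
          ≡⟨ sumSubsets-cong (λ A → one A (connected? (graph E₀) A s t)) ⟩
        sumSubsets (λ A → q * T true A + T false A)
          ≡⟨ sumSubsets-+ (λ A → q * T true A) (T false) ⟩
        sumSubsets (λ A → q * T true A) + sumSubsets (T false)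
          ≡⟨ cong (_+ sumSubsets (T false)) (sumSubsets-* q (T true)) ⟩
        q * Z true E₀ s t w + Z false E₀ s t w ∎
        where
        open ≡-Reasoning
        T₁ : Subset m → ℚ
        T₁ A = select true (does (connected? (graph E) (inside ∷ A) s t))
          (prodOver w A * q^ κ (graph E) (inside ∷ A))
        T : Bool → Subset m → ℚ
        T β A = select β (does (connected? (graph E₀) A s t)) (prodOver w A * q^ κ (graph E₀) A)

        one : ∀ A (d : Dec (Connected (graph E₀) A s t)) →
          q * T₁ A ≡ q * select true (does d) (prodOver w A * q^ κ (graph E₀) A)
                   + select false (does d) (prodOver w A * q^ κ (graph E₀) A)
        one A d = trans
          (cong (λ c → q * select true c (P * q^ κ (graph E) (inside ∷ A)))
            (dec-true (connected? (graph E) (inside ∷ A) s t) (joined A)))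
          (both d)
          where
          P = prodOver w A
          k₀ = κ (graph E₀) A
          k₁ = κ (graph E) (inside ∷ A)
          both : (d : Dec (Connected (graph E₀) A s t)) →
            q * (P * q^ k₁) ≡ q * select true (does d) (P * q^ k₀) + select false (does d) (P * q^ k₀)
          both (yes l) = trans (cong (λ k → q * (P * q^ k)) (κ-joined E A l))
            (sym (ℚₚ.+-identityʳ (q * (P * q^ k₀))))
          both (no ¬l) = begin
            q * (P * q^ k₁)
              ≡⟨ solve 3 (λ a p x → a :* (p :* x) := a :* con 0ℚ :+ p :* (a :* x)) refl q P (q^ k₁) ⟩
            q * 0ℚ + P * q^ suc k₁
              ≡⟨ cong (λ k → q * 0ℚ + P * q^ k) (κ-joining E A ¬l) ⟩
            q * 0ℚ + P * q^ k₀ ∎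

    -- (E , w) implements the weight y - 1 between s and t.
    Yields : ∀ {n m} → Ends n m → Fin n → Fin n → (Fin m → ℚ) → ℚ → Set
    Yields E s t w y = Z false E s t w ≢ 0ℚ × q * Z true E s t w ≡ (y ℚ.- 1ℚ) * Z false E s t w

    -- `Z false` does not change, since the new edge links `s` and `t`, while `q * Z true` becomes
    -- `(y - 1) + z * y` times `Z false`; and `(y - 1) + z * y` is `y * (1 + z) - 1`.
    yields-parallel : ∀ {n m} (E₀ : Ends n m) s t w z y →
      Yields E₀ s t w y → Yields ((s , t) F.∷ E₀) s t (z F.∷ w) (y * (1ℚ + z))
    yields-parallel E₀ s t w z y (Zf≢0 , e) = (λ Zf′≡0 → Zf≢0 (trans (sym Zf′≡Zf) Zf′≡0)) , (begin
      q * Z true E s t (z F.∷ w)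
        ≡⟨ cong (q *_) (Z-edge true E s t z w) ⟩
      q * (Zt + z * Z₁ true E s t w)
        ≡⟨ solve 4 (λ a x z y → a :* (x :+ z :* y) := a :* x :+ z :* (a :* y)) refl q Zt z (Z₁ true E s t w) ⟩
      q * Zt + z * (q * Z₁ true E s t w)
        ≡⟨ cong (λ x → q * Zt + z * x) (q*Z₁-true E₀ s t w) ⟩
      q * Zt + z * (q * Zt + Zf)
        ≡⟨ cong (λ x → x + z * (x + Zf)) e ⟩
      (y ℚ.- 1ℚ) * Zf + z * ((y ℚ.- 1ℚ) * Zf + Zf)
        ≡⟨ solve 3 (λ y z f → (y :- con 1ℚ) :* f :+ z :* ((y :- con 1ℚ) :* f :+ f)
                     := (y :* (con 1ℚ :+ z) :- con 1ℚ) :* f) refl y z Zf ⟩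
      (y * (1ℚ + z) ℚ.- 1ℚ) * Zf
        ≡⟨ cong ((y * (1ℚ + z) ℚ.- 1ℚ) *_) (sym Zf′≡Zf) ⟩
      (y * (1ℚ + z) ℚ.- 1ℚ) * Z false E s t (z F.∷ w) ∎)
      where
      open ≡-Reasoning
      E = (s , t) F.∷ E₀
      Zt = Z true E₀ s t w
      Zf = Z false E₀ s t w
      Zf′≡Zf : Z false E s t (z F.∷ w) ≡ Zf
      Zf′≡Zf = begin
        Z false E s t (z F.∷ w)       ≡⟨ Z-edge false E s t z w ⟩
        Zf + z * Z₁ false E s t w     ≡⟨ cong (λ x → Zf + z * x) (Z₁-false E₀ s t w) ⟩
        Zf + z * 0ℚ                   ≡⟨ solve 2 (λ f z → f :+ z :* con 0ℚ := f) refl Zf z ⟩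
        Zf ∎

    *-nonzero : ∀ {x y} → x ≢ 0ℚ → y ≢ 0ℚ → x * y ≢ 0ℚ
    *-nonzero {x} {y} x≢0 y≢0 xy≡0 = y≢0 (begin
      y                   ≡⟨ ℚₚ.*-identityˡ y ⟨
      1ℚ * y              ≡⟨ cong (_* y) (ℚₚ.*-inverseˡ x) ⟨
      ℚ.1/ x * x * y      ≡⟨ ℚₚ.*-assoc (ℚ.1/ x) x y ⟩
      ℚ.1/ x * (x * y)    ≡⟨ cong (ℚ.1/ x *_) xy≡0 ⟩
      ℚ.1/ x * 0ℚ         ≡⟨ ℚₚ.*-zeroʳ (ℚ.1/ x) ⟩
      0ℚ ∎)
      where
      open ≡-Reasoning
      instance _ = ℚ.≢-nonZero x≢0

    yields-subdivide : ∀ {n m} (E : Ends n (suc m)) s t z α ω w y →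
      q + z + α ≢ 0ℚ → (q + z + α) * ω ≡ z * α →
      Yields E s t (ω F.∷ w) y → Yields (subdivide E) (suc s) (suc t) (z F.∷ α F.∷ w) y
    yields-subdivide E s t z α ω w y D≢0 Dω≡zα (Zf≢0 , e) =
      (λ Zf′≡0 → *-nonzero D≢0 Zf≢0 (trans (sym (Z-subdivide E s t false z α ω w Dω≡zα)) Zf′≡0)) ,
      (begin
        q * Z true (subdivide E) (suc s) (suc t) (z F.∷ α F.∷ w)
          ≡⟨ cong (q *_) (Z-subdivide E s t true z α ω w Dω≡zα) ⟩
        q * (D * Zt)
          ≡⟨ solve 3 (λ a d x → a :* (d :* x) := d :* (a :* x)) refl q D Zt ⟩
        D * (q * Zt)
          ≡⟨ cong (D *_) e ⟩
        D * ((y ℚ.- 1ℚ) * Zf)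
          ≡⟨ solve 3 (λ d b f → d :* (b :* f) := b :* (d :* f)) refl D (y ℚ.- 1ℚ) Zf ⟩
        (y ℚ.- 1ℚ) * (D * Zf)
          ≡⟨ cong ((y ℚ.- 1ℚ) *_) (sym (Z-subdivide E s t false z α ω w Dω≡zα)) ⟩
        (y ℚ.- 1ℚ) * Z false (subdivide E) (suc s) (suc t) (z F.∷ α F.∷ w) ∎)
      where
      open ≡-Reasoning
      D = q + z + α
      Zt = Z true E s t (ω F.∷ w)
      Zf = Z false E s t (ω F.∷ w)

-- Plane graphs as rotation systems; doubling and subdividing an edge.

module PlaneGraphs where
  open PartitionFunctions

  Orb : ∀ {D : Set} → (D → D) → Rel D 0ℓ
  Orb φ = EqClosure λ d d′ → φ d ≡ d′

  Labels : ∀ {D C : Set} → (D → D) → (D → C) → Set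
  Labels φ c = ∀ d d′ → Orb φ d d′ ⇔ c d ≡ c d′

  step : ∀ {D : Set} {φ : D → D} d → Orb φ d (φ d)
  step d = Eq.return refl

  orb-trans : ∀ {D : Set} {φ : D → D} {x y z} → Orb φ x y → Orb φ y z → Orb φ x z
  orb-trans = Eq.transitive _

  orb-sym : ∀ {D : Set} {φ : D → D} {x y} → Orb φ x y → Orb φ y x
  orb-sym = Eq.symmetric _

  -- The orbits of φ′ are those of φ, enlarged, and at most one new one, that of n.
  labels-extend : ∀ {D D′ C C′ : Set} {φ : D → D} {φ′ : D′ → D′} {c : D → C} {c′ : D′ → C′}
    (ι : D → D′) (j : C → C′) (n : D′) → (∀ {x y} → j x ≡ j y → x ≡ y) →
    (∀ d → c′ (ι d) ≡ j (c d)) →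
    (∀ d → Orb φ′ (ι d) (ι (φ d))) →
    (∀ d′ → c′ (φ′ d′) ≡ c′ d′) →
    (∀ d′ → (∃[ d ] Orb φ′ d′ (ι d)) ⊎ (Orb φ′ d′ n × (∀ x → c′ n ≢ j x))) →
    Labels φ c → Labels φ′ c′
  labels-extend {φ′ = φ′} {c} {c′} ι j n j-inj c′ι ιφ c′φ′ reach L x y = mk⇔ sound (complete (reach x) (reach y))
    where
    sound : ∀ {x y} → Orb φ′ x y → c′ x ≡ c′ y
    sound = Eq.gfold isEquivalence c′ λ { {x} refl → sym (c′φ′ x) }

    ι* : ∀ {d e} → Orb _ d e → Orb φ′ (ι d) (ι e)
    ι* = Eq.gfold (Eq.isEquivalence _) ι λ { {d} refl → ιφ d }

    complete : ∀ {x y} → (∃[ d ] Orb φ′ x (ι d)) ⊎ (Orb φ′ x n × (∀ x → c′ n ≢ j x)) →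
      (∃[ d ] Orb φ′ y (ι d)) ⊎ (Orb φ′ y n × (∀ x → c′ n ≢ j x)) → c′ x ≡ c′ y → Orb φ′ x y
    complete (inj₁ (d , p)) (inj₁ (e , r)) eq = orb-trans p (orb-trans (ι* (Equivalence.from (L d e) cd≡ce)) (orb-sym r))
      where
      cd≡ce : c d ≡ c e
      cd≡ce = j-inj (trans (sym (c′ι d)) (trans (sym (sound p)) (trans eq (trans (sound r) (c′ι e)))))
    complete (inj₂ (p , _)) (inj₂ (r , _)) eq = orb-trans p (orb-sym r)
    complete (inj₁ (d , p)) (inj₂ (r , n∉)) eq =
      contradiction (trans (sym (sound r)) (trans (sym eq) (trans (sound p) (c′ι d)))) (n∉ (c d))
    complete (inj₂ (p , n∉)) (inj₁ (e , r)) eq =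
      contradiction (trans (sym (sound p)) (trans eq (trans (sound r) (c′ι e)))) (n∉ (c e))

  -- The special case of `PlaneEmbedding` that is preserved by the constructions below: `κ` is 1,
  -- and as every vertex has a dart there are no isolated visits, so that faces are just labels of
  -- darts.
  record Plane {n m} (E : Ends n m) : Set where
    field
      rot         : Dart (graph E) ↔ Dart (graph E)
      rot-labels  : Labels (Inverse.to rot) (tail (graph E))
      #F          : ℕ
      face        : Dart (graph E) → Fin #F
      face-onto   : ∀ k → ∃[ d ] face d ≡ k
      face-labels : Labels (Inverse.to rot ∘ rev (graph E)) face
      euler       : n ℕ.+ #F ≡ m ℕ.+ 2
      connected   : ∀ x y → Linked E ⊤ x y
      dart-at     : ∀ v → ∃[ d ] tail (graph E) d ≡ v

  κ-connected : ∀ {n m} (E : Ends n m) A → Fin n → (∀ x y → Linked E A x y) → κ (graph E) A ≡ 1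
  κ-connected E A v l = κ-unique E A record
    { count = 1 ; class = λ _ → zero ; surjective = λ { zero → v , refl }
    ; sound = λ _ → refl ; complete = λ {x} {y} _ → l x y }

  module _ {n m} {E : Ends n m} (v₀ : Fin n) (P : Plane E) where
    open Plane P

    visited : ∀ v → ¬ Isolated (graph E) v
    visited v i = i (proj₁ (dart-at v)) (proj₂ (dart-at v))

    planeEmbedding : PlaneEmbedding (graph E)
    planeEmbedding = record
      { rotation  = rot
      ; at-vertex = rot-labels
      ; walks     = record
        { count = #F ; class = cl
        ; surjective = λ k → inj₁ (proj₁ (face-onto k)) , proj₂ (face-onto k)
        ; sound = λ { (along o) → Equivalence.to (face-labels _ _) o
                    ; (isolated {v} {i} {i′}) → contradiction i (visited v) }
        ; complete = λ {x} {y} → cl-complete x y }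
      ; euler     = trans euler (cong (λ k → m ℕ.+ 2 ℕ.* k) (sym (κ-connected E ⊤ v₀ connected))) }
      where
      cl : Visit (graph E) → Fin #F
      cl (inj₁ d)       = face d
      cl (inj₂ (v , i)) = contradiction i (visited v)

      cl-complete : ∀ x y → cl x ≡ cl y → SameWalk (graph E) (Inverse.to rot ∘ rev (graph E)) x y
      cl-complete (inj₁ d) (inj₁ d′) e = along (Equivalence.from (face-labels d d′) e)
      cl-complete (inj₂ (v , i)) _ _ = contradiction i (visited v)
      cl-complete (inj₁ _) (inj₂ (v , i)) _ = contradiction i (visited v)

  -- The walk along an edge leads from one of its ends to the other.
  edge-on-face : ∀ {n m} {E : Ends n m} v₀ (P : Plane E) e →
    OnOuterFace (graph E) (planeEmbedding v₀ P) (proj₁ (E e)) (proj₂ (E e))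
  edge-on-face v₀ P e = inj₂ (inj₁ (e , false) , inj₁ (Inverse.to rot (e , true)) , refl ,
    sym (Equivalence.to (rot-labels _ _) (step (e , true))) , along (step (e , false)))
    where open Plane P

  singleEdge : Ends 2 1
  singleEdge = (zero , suc zero) F.∷ F.[]

  plane-singleEdge : Plane singleEdge
  plane-singleEdge = record
    { rot = ↔-id _
    ; rot-labels = λ d d′ → mk⇔ (Eq.gfold isEquivalence (tail G) λ { refl → refl }) (lab d d′)
    ; #F = 1
    ; face = λ _ → zero
    ; face-onto = λ { zero → (zero , false) , refl }
    ; face-labels = λ d d′ → mk⇔ (λ _ → refl) (λ _ → all d d′)
    ; euler = refl
    ; connected = conn
    ; dart-at = λ { zero → (zero , false) , refl ; (suc zero) → (zero , true) , refl } }
    where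
    G = graph singleEdge

    lab : ∀ d d′ → tail G d ≡ tail G d′ → Orb id d d′
    lab (zero , false) (zero , false) _ = Eq.reflexive _
    lab (zero , true)  (zero , true)  _ = Eq.reflexive _

    all : ∀ d d′ → Orb (rev G) d d′
    all (zero , false) (zero , false) = Eq.reflexive _
    all (zero , false) (zero , true)  = step (zero , false)
    all (zero , true)  (zero , false) = step (zero , true)
    all (zero , true)  (zero , true)  = Eq.reflexive _

    conn : ∀ x y → Linked singleEdge ⊤ x y
    conn zero       zero       = Eq.reflexive _
    conn zero       (suc zero) = edge zero ∈⊤
    conn (suc zero) zero       = linked-sym (edge zero ∈⊤)
    conn (suc zero) (suc zero) = Eq.reflexive _

  duplicate : ∀ {n m} → Ends n (suc m) → Ends n (suc (suc m))
  duplicate E = E zero F.∷ E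

  module Duplicate {n m} {E : Ends n (suc m)} (P : Plane E) where
    open Plane P
    private
      G  = graph E
      E′ = duplicate E
      G′ = graph E′
      D  = Fin (suc m) × Bool
      D′ = Fin (suc (suc m)) × Bool

      -- The two darts of the old edge go to different copies, each to the side facing its old face.
      -- Thus the new face permutation commutes with `ι`, and the two darts left over are exactly
      -- the new digon.
      ι : D → D′
      ι (zero  , false) = zero , false
      ι (zero  , true)  = suc zero , true
      ι (suc e , b)     = suc (suc e) , b

      split : D′ ↔ (D ⊎ Bool)
      split = mk↔ₛ′ to from
        (λ { (inj₁ (zero , false)) → refl ; (inj₁ (zero , true)) → refl ; (inj₁ (suc e , b)) → refl
           ; (inj₂ false) → refl ; (inj₂ true) → refl })
        (λ { (zero , false) → refl ; (zero , true) → refl ; (suc zero , false) → refl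
           ; (suc zero , true) → refl ; (suc (suc e) , b) → refl })
        where
        to : D′ → D ⊎ Bool
        to (zero        , false) = inj₁ (zero , false)
        to (zero        , true)  = inj₂ true
        to (suc zero    , false) = inj₂ false
        to (suc zero    , true)  = inj₁ (zero , true)
        to (suc (suc e) , b)     = inj₁ (suc e , b)
        from : D ⊎ Bool → D′
        from (inj₁ d)     = ι d
        from (inj₂ false) = suc zero , false
        from (inj₂ true)  = zero , true

      exchange : D′ ↔ D′
      exchange = mk↔ₛ′ τ τ ττ ττ
        where
        τ : D′ → D′
        τ (zero        , b) = suc zero , b
        τ (suc zero    , b) = zero , b
        τ (suc (suc e) , b) = suc (suc e) , b
        ττ : ∀ d → τ (τ d) ≡ d
        ττ (zero        , b) = refl
        ττ (suc zero    , b) = refl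
        ττ (suc (suc e) , b) = refl

      -- The new dart of each copy comes right after the old one, so that the
      -- two copies bound a digon.
      rot′ : D′ ↔ D′
      rot′ = ↔-sym split ↔-∘ ((rot ⊎-↔ ↔-id Bool) ↔-∘ (split ↔-∘ exchange))

      φ : D → D
      φ = Inverse.to rot ∘ rev G

      ρ′ φ′ : D′ → D′
      ρ′ = Inverse.to rot′
      φ′ = ρ′ ∘ rev G′

      tail-ι : ∀ d → tail G′ (ι d) ≡ tail G d
      tail-ι (zero  , false) = refl
      tail-ι (zero  , true)  = refl
      tail-ι (suc e , false) = refl
      tail-ι (suc e , true)  = refl

      tail-rot : ∀ d → tail G (Inverse.to rot d) ≡ tail G d
      tail-rot d = sym (Equivalence.to (rot-labels _ _) (step d))

      tail-ι-rot : ∀ d → tail G′ (ι (Inverse.to rot d)) ≡ tail G d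
      tail-ι-rot d = trans (tail-ι (Inverse.to rot d)) (tail-rot d)

      rot′-ι : ∀ d → Orb ρ′ (ι d) (ι (Inverse.to rot d))
      rot′-ι (zero  , false) = orb-trans (step (zero , false)) (step (suc zero , false))
      rot′-ι (zero  , true)  = orb-trans (step (suc zero , true)) (step (zero , true))
      rot′-ι (suc e , b)     = step (suc (suc e) , b)

      tail-rot′ : ∀ d → tail G′ (ρ′ d) ≡ tail G′ d
      tail-rot′ (zero        , false) = refl
      tail-rot′ (zero        , true)  = tail-ι-rot (zero , true)
      tail-rot′ (suc zero    , false) = tail-ι-rot (zero , false)
      tail-rot′ (suc zero    , true)  = refl
      tail-rot′ (suc (suc e) , false) = tail-ι-rot (suc e , false)
      tail-rot′ (suc (suc e) , true)  = tail-ι-rot (suc e , true)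

      rot′-reach : ∀ d → ∃[ d₀ ] Orb ρ′ d (ι d₀)
      rot′-reach (zero        , false) = (zero , false) , Eq.reflexive _
      rot′-reach (zero        , true)  = (zero , true) , orb-sym (step (suc zero , true))
      rot′-reach (suc zero    , false) = (zero , false) , orb-sym (step (zero , false))
      rot′-reach (suc zero    , true)  = (zero , true) , Eq.reflexive _
      rot′-reach (suc (suc e) , b)     = (suc e , b) , Eq.reflexive _

      face′ : D′ → Fin (suc #F)
      face′ (zero        , false) = suc (face (zero , false))
      face′ (zero        , true)  = zero
      face′ (suc zero    , false) = zero
      face′ (suc zero    , true)  = suc (face (zero , true))
      face′ (suc (suc e) , b)     = suc (face (suc e , b))

      face-ι : ∀ d → face′ (ι d) ≡ suc (face d)
      face-ι (zero  , false) = refl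
      face-ι (zero  , true)  = refl
      face-ι (suc e , b)     = refl

      φ′-ι : ∀ d → φ′ (ι d) ≡ ι (φ d)
      φ′-ι (zero  , false) = refl
      φ′-ι (zero  , true)  = refl
      φ′-ι (suc e , b)     = refl

      face-φ : ∀ d → face (φ d) ≡ face d
      face-φ d = sym (Equivalence.to (face-labels _ _) (step d))

      face-φ′-ι : ∀ d → face′ (φ′ (ι d)) ≡ face′ (ι d)
      face-φ′-ι d = begin
        face′ (φ′ (ι d)) ≡⟨ cong face′ (φ′-ι d) ⟩
        face′ (ι (φ d))  ≡⟨ face-ι (φ d) ⟩
        suc (face (φ d)) ≡⟨ cong suc (face-φ d) ⟩
        suc (face d)     ≡⟨ face-ι d ⟨
        face′ (ι d) ∎
        where open ≡-Reasoning

      face-φ′ : ∀ d → face′ (φ′ d) ≡ face′ d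
      face-φ′ (zero        , false) = face-φ′-ι (zero , false)
      face-φ′ (zero        , true)  = refl
      face-φ′ (suc zero    , false) = refl
      face-φ′ (suc zero    , true)  = face-φ′-ι (zero , true)
      face-φ′ (suc (suc e) , b)     = face-φ′-ι (suc e , b)

      φ′-reach : ∀ d → (∃[ d₀ ] Orb φ′ d (ι d₀)) ⊎ (Orb φ′ d (zero , true) × (∀ (k : Fin #F) → zero ≢ suc k))
      φ′-reach (zero        , false) = inj₁ ((zero , false) , Eq.reflexive _)
      φ′-reach (zero        , true)  = inj₂ (Eq.reflexive _ , λ _ ())
      φ′-reach (suc zero    , false) = inj₂ (step (suc zero , false) , λ _ ())
      φ′-reach (suc zero    , true)  = inj₁ ((zero , true) , Eq.reflexive _)
      φ′-reach (suc (suc e) , b)     = inj₁ ((suc e , b) , Eq.reflexive _)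

      face′-onto : ∀ k → ∃[ d ] face′ d ≡ k
      face′-onto zero    = (zero , true) , refl
      face′-onto (suc k) = ι (proj₁ (face-onto k)) ,
        trans (face-ι (proj₁ (face-onto k))) (cong suc (proj₂ (face-onto k)))

    plane-duplicate : Plane E′
    plane-duplicate = record
      { rot         = rot′
      ; rot-labels  = labels-extend ι id (zero , true) id tail-ι rot′-ι tail-rot′ (inj₁ ∘ rot′-reach) rot-labels
      ; #F          = suc #F
      ; face        = face′
      ; face-onto   = face′-onto
      ; face-labels = labels-extend ι suc (zero , true) Finₚ.suc-injective face-ι
                        (λ d → subst (Orb φ′ (ι d)) (φ′-ι d) (step (ι d))) face-φ′ φ′-reach face-labels
      ; euler       = trans (ℕₚ.+-suc n #F) (cong suc euler)
      ; connected   = λ x y → Eq.map (λ { (e , _ , p) → suc e , ∈⊤ , p }) (connected x y)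
      ; dart-at     = λ v → ι (proj₁ (dart-at v)) , trans (tail-ι (proj₁ (dart-at v))) (proj₂ (dart-at v)) }

  -- Edge `zero` is held in reserve as the edge from `s` to `t`, so the subdivision takes place at
  -- the edge after it.
  subdivideNext : ∀ {n m} → Ends n (suc (suc m)) → Ends (suc n) (suc (suc (suc m)))
  subdivideNext E = Product.map suc suc (E zero) F.∷ subdivide (E ∘ suc)

  module SubdivideNext {n m} {E : Ends n (suc (suc m))} (P : Plane E) where
    open Plane P
    private
      G  = graph E
      E′ = subdivideNext E
      G′ = graph E′
      D  = Fin (suc (suc m)) × Bool
      D′ = Fin (suc (suc (suc m))) × Bool

      ι : D → D′
      ι (zero        , b)     = zero , b
      ι (suc zero    , false) = suc zero , false
      ι (suc zero    , true)  = suc (suc zero) , true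
      ι (suc (suc e) , b)     = suc (suc (suc e)) , b

      split : D′ ↔ (D ⊎ Bool)
      split = mk↔ₛ′ to from
        (λ { (inj₁ (zero , b)) → refl ; (inj₁ (suc zero , false)) → refl
           ; (inj₁ (suc zero , true)) → refl ; (inj₁ (suc (suc e) , b)) → refl
           ; (inj₂ false) → refl ; (inj₂ true) → refl })
        (λ { (zero , b) → refl ; (suc zero , false) → refl ; (suc zero , true) → refl
           ; (suc (suc zero) , false) → refl ; (suc (suc zero) , true) → refl
           ; (suc (suc (suc e)) , b) → refl })
        where
        to : D′ → D ⊎ Bool
        to (zero              , b)     = inj₁ (zero , b)
        to (suc zero          , false) = inj₁ (suc zero , false)
        to (suc zero          , true)  = inj₂ true
        to (suc (suc zero)    , false) = inj₂ false
        to (suc (suc zero)    , true)  = inj₁ (suc zero , true)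
        to (suc (suc (suc e)) , b)     = inj₁ (suc (suc e) , b)
        from : D ⊎ Bool → D′
        from (inj₁ d)     = ι d
        from (inj₂ false) = suc (suc zero) , false
        from (inj₂ true)  = suc zero , true

      flip : Bool ↔ Bool
      flip = mk↔ₛ′ not not (λ { false → refl ; true → refl }) (λ { false → refl ; true → refl })

      -- The midpoint has just two darts, which `flip` interchanges; elsewhere the rotation is the
      -- old one. No face is created: the additional edge is balanced by the additional vertex in
      -- Euler's formula.
      rot′ : D′ ↔ D′
      rot′ = ↔-sym split ↔-∘ ((rot ⊎-↔ flip) ↔-∘ split)

      φ : D → D
      φ = Inverse.to rot ∘ rev G

      ρ′ φ′ : D′ → D′
      ρ′ = Inverse.to rot′
      φ′ = ρ′ ∘ rev G′

      tail-ι : ∀ d → tail G′ (ι d) ≡ suc (tail G d)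
      tail-ι (zero        , false) = refl
      tail-ι (zero        , true)  = refl
      tail-ι (suc zero    , false) = refl
      tail-ι (suc zero    , true)  = refl
      tail-ι (suc (suc e) , false) = refl
      tail-ι (suc (suc e) , true)  = refl

      rot′-ι : ∀ d → ρ′ (ι d) ≡ ι (Inverse.to rot d)
      rot′-ι (zero        , b)     = refl
      rot′-ι (suc zero    , false) = refl
      rot′-ι (suc zero    , true)  = refl
      rot′-ι (suc (suc e) , b)     = refl

      tail-rot′-ι : ∀ d → tail G′ (ρ′ (ι d)) ≡ tail G′ (ι d)
      tail-rot′-ι d = begin
        tail G′ (ρ′ (ι d))                ≡⟨ cong (tail G′) (rot′-ι d) ⟩
        tail G′ (ι (Inverse.to rot d))    ≡⟨ tail-ι (Inverse.to rot d) ⟩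
        suc (tail G (Inverse.to rot d))   ≡⟨ cong suc (Equivalence.to (rot-labels _ _) (step d)) ⟨
        suc (tail G d)                    ≡⟨ tail-ι d ⟨
        tail G′ (ι d) ∎
        where open ≡-Reasoning

      tail-rot′ : ∀ d → tail G′ (ρ′ d) ≡ tail G′ d
      tail-rot′ (zero              , b)     = tail-rot′-ι (zero , b)
      tail-rot′ (suc zero          , false) = tail-rot′-ι (suc zero , false)
      tail-rot′ (suc zero          , true)  = refl
      tail-rot′ (suc (suc zero)    , false) = refl
      tail-rot′ (suc (suc zero)    , true)  = tail-rot′-ι (suc zero , true)
      tail-rot′ (suc (suc (suc e)) , b)     = tail-rot′-ι (suc (suc e) , b)

      rot′-reach : ∀ d → (∃[ d₀ ] Orb ρ′ d (ι d₀)) ⊎ (Orb ρ′ d (suc zero , true) × (∀ (v : Fin n) → zero ≢ suc v))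
      rot′-reach (zero              , b)     = inj₁ ((zero , b) , Eq.reflexive _)
      rot′-reach (suc zero          , false) = inj₁ ((suc zero , false) , Eq.reflexive _)
      rot′-reach (suc zero          , true)  = inj₂ (Eq.reflexive _ , λ _ ())
      rot′-reach (suc (suc zero)    , false) = inj₂ (step (suc (suc zero) , false) , λ _ ())
      rot′-reach (suc (suc zero)    , true)  = inj₁ ((suc zero , true) , Eq.reflexive _)
      rot′-reach (suc (suc (suc e)) , b)     = inj₁ ((suc (suc e) , b) , Eq.reflexive _)

      face′ : D′ → Fin #F
      face′ (zero              , b)     = face (zero , b)
      face′ (suc zero          , b)     = face (suc zero , b)
      face′ (suc (suc e)       , b)     = face (suc e , b)

      face-ι : ∀ d → face′ (ι d) ≡ face d
      face-ι (zero        , b)     = refl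
      face-ι (suc zero    , false) = refl
      face-ι (suc zero    , true)  = refl
      face-ι (suc (suc e) , b)     = refl

      φ′-ι : ∀ d → Orb φ′ (ι d) (ι (φ d))
      φ′-ι (zero        , b)     = step (zero , b)
      φ′-ι (suc zero    , false) = orb-trans (step (suc zero , false)) (step (suc (suc zero) , false))
      φ′-ι (suc zero    , true)  = orb-trans (step (suc (suc zero) , true)) (step (suc zero , true))
      φ′-ι (suc (suc e) , b)     = step (suc (suc (suc e)) , b)

      face-ι-φ : ∀ d → face′ (ι (φ d)) ≡ face d
      face-ι-φ d = trans (face-ι (φ d)) (sym (Equivalence.to (face-labels _ _) (step d)))

      face-φ′ : ∀ d → face′ (φ′ d) ≡ face′ d
      face-φ′ (zero              , b)     = face-ι-φ (zero , b)
      face-φ′ (suc zero          , false) = refl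
      face-φ′ (suc zero          , true)  = face-ι-φ (suc zero , true)
      face-φ′ (suc (suc zero)    , false) = face-ι-φ (suc zero , false)
      face-φ′ (suc (suc zero)    , true)  = refl
      face-φ′ (suc (suc (suc e)) , b)     = face-ι-φ (suc (suc e) , b)

      φ′-reach : ∀ d → ∃[ d₀ ] Orb φ′ d (ι d₀)
      φ′-reach (zero              , b)     = (zero , b) , Eq.reflexive _
      φ′-reach (suc zero          , false) = (suc zero , false) , Eq.reflexive _
      φ′-reach (suc zero          , true)  = (suc zero , true) , orb-sym (step (suc (suc zero) , true))
      φ′-reach (suc (suc zero)    , false) = (suc zero , false) , orb-sym (step (suc zero , false))
      φ′-reach (suc (suc zero)    , true)  = (suc zero , true) , Eq.reflexive _
      φ′-reach (suc (suc (suc e)) , b)     = (suc (suc e) , b) , Eq.reflexive _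

      lift : ∀ {x y} → Linked E ⊤ x y → Linked E′ ⊤ (suc x) (suc y)
      lift = Eq.gfold (Eq.isEquivalence _) suc λ
        { (zero , _ , refl)        → edge zero ∈⊤
        ; (suc zero , _ , refl)    → linked-trans (edge (suc zero) ∈⊤) (edge (suc (suc zero)) ∈⊤)
        ; (suc (suc e) , _ , refl) → edge (suc (suc (suc e))) ∈⊤ }

      to-old : ∀ x → ∃[ y ] Linked E′ ⊤ x (suc y)
      to-old zero    = _ , edge (suc (suc zero)) ∈⊤
      to-old (suc x) = x , Eq.reflexive _

    plane-subdivideNext : Plane E′
    plane-subdivideNext = record
      { rot         = rot′
      ; rot-labels  = labels-extend ι suc (suc zero , true) Finₚ.suc-injective tail-ι
                        (λ d → subst (Orb ρ′ (ι d)) (rot′-ι d) (step (ι d))) tail-rot′ rot′-reach rot-labels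
      ; #F          = #F
      ; face        = face′
      ; face-onto   = λ k → ι (proj₁ (face-onto k)) , trans (face-ι (proj₁ (face-onto k))) (proj₂ (face-onto k))
      ; face-labels = labels-extend ι id (zero , true) id face-ι φ′-ι face-φ′ (inj₁ ∘ φ′-reach) face-labels
      ; euler       = cong suc euler
      ; connected   = λ x y → linked-trans (proj₂ (to-old x))
                        (linked-trans (lift (connected _ _)) (linked-sym (proj₂ (to-old y))))
      ; dart-at     = λ { zero → (suc zero , true) , refl
                        ; (suc v) → ι (proj₁ (dart-at v)) , trans (tail-ι (proj₁ (dart-at v))) (cong suc (proj₂ (dart-at v))) } }

-- Networks that grow by parallel paths.

module Networks where
  open import Data.Rational using (_+_; _*_)
  open PartitionFunctions
  open PlaneGraphs

  subdivisions : ∀ k {n m} → Ends n (suc m) → Ends (k ℕ.+ n) (suc (k ℕ.+ m))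
  subdivisions zero    E = E
  subdivisions (suc k) E = subdivide (subdivisions k E)

  raise : ∀ k {n} → Fin n → Fin (k ℕ.+ n)
  raise zero    v = v
  raise (suc k) v = suc (raise k v)

  pad : ∀ k {m} → ℚ → (Fin m → ℚ) → Fin (k ℕ.+ m) → ℚ
  pad zero    α w = w
  pad (suc k) α w = α F.∷ pad k α w

  -- k counts the subdivisions: the new path has k + 1 edges.
  addPath : ∀ k {n m} → Ends n m → Fin n → Fin n → Ends (k ℕ.+ n) (suc (k ℕ.+ m))
  addPath k E s t = subdivisions k ((s , t) F.∷ E)

  -- The reserve edge from `s` to `t` is doubled, and the copy next to it is subdivided `k` times.
  -- The reserve edge survives, ready for the next path.
  plane-addPath : ∀ k {n m} (E : Ends n m) s t → Plane ((s , t) F.∷ E) →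
    Plane ((raise k s , raise k t) F.∷ addPath k E s t)
  plane-addPath zero    E s t P = Duplicate.plane-duplicate P
  plane-addPath (suc k) E s t P = SubdivideNext.plane-subdivideNext (plane-addPath k E s t P)

  module _ (q : ℚ) where
    open Partition q

    -- A path of one edge of weight z and k edges of weight α acts as an edge of weight ω.
    Series : ℚ → ℕ → ℚ → ℚ → Set
    Series α zero    z ω = z ≡ ω
    Series α (suc k) z ω =
      ∃[ z′ ] (q + z + α ≢ 0ℚ × (q + z + α) * z′ ≡ z * α × Series α k z′ ω)

    yields-subdivisions : ∀ k {n m} (E : Ends n (suc m)) s t α z ω w y → Series α k z ω →
      Yields E s t (ω F.∷ w) y →
      Yields (subdivisions k E) (raise k s) (raise k t) (z F.∷ pad k α w) y
    yields-subdivisions zero    E s t α z ω w y refl Y = Y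
    yields-subdivisions (suc k) E s t α z ω w y (z′ , D≢0 , Dz′≡zα , S) Y =
      yields-subdivide (subdivisions k E) (raise k s) (raise k t) z α z′ (pad k α w) y D≢0 Dz′≡zα
        (yields-subdivisions k E s t α z′ ω w y S Y)

    -- `plane` speaks of one edge more than `yields`: a reserve edge from `s` to `t` without a
    -- weight. It marks where the next path is drawn and keeps `s` and `t` on a common face; in
    -- `net-implements` it receives a weight at last, which accounts for the factor `1 + β` and for
    -- `suc N`.
    record Net (W : ℚ → Set) (#VE : ℕ) (y : ℚ) : Set where
      field
        {n m}  : ℕ
        E      : Ends n m
        s t    : Fin n
        s≢t    : s ≢ t
        w      : Fin m → ℚ
        plane  : Plane ((s , t) F.∷ E)
        w∈W    : ∀ e → W (w e)
        yields : Yields E s t w y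
        size≡  : n ℕ.+ m ≡ #VE

    module _ {W : ℚ → Set} where

      net-empty : q ≢ 0ℚ → Net W 2 1ℚ
      net-empty q≢0 = record
        { E = F.[] ; s = zero ; t = suc zero ; s≢t = λ () ; w = F.[] ; plane = plane-singleEdge
        ; w∈W = λ ()
        ; yields = (λ e → *-nonzero q≢0 (*-nonzero q≢0 ℚₚ.1≢0) (trans (sym (ℚₚ.*-identityˡ (q * (q * 1ℚ)))) e))
                 , trans (ℚₚ.*-zeroʳ q) (sym (ℚₚ.*-zeroˡ (1ℚ * (q * (q * 1ℚ)))))
        ; size≡ = refl }

      net-path : ∀ {N y α ω} k → W α → Series α k α ω → Net W N y →
        Net W (suc (2 ℕ.* k) ℕ.+ N) (y * (1ℚ + ω))
      net-path {y = y} {α} {ω} k α∈W S net = record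
        { E = addPath k E s t ; s = raise k s ; t = raise k t
        ; s≢t = s≢t ∘ raise-injective k
        ; w = α F.∷ pad k α w
        ; plane = plane-addPath k E s t plane
        ; w∈W = λ { zero → α∈W ; (suc e) → pad∈W k e }
        ; yields = yields-subdivisions k ((s , t) F.∷ E) s t α α ω w (y * (1ℚ + ω)) S
            (yields-parallel E s t w ω y yields)
        ; size≡ = trans (arith k n m) (cong (suc (2 ℕ.* k) ℕ.+_) size≡) }
        where
        open Net net
        raise-injective : ∀ k {n} {u v : Fin n} → raise k u ≡ raise k v → u ≡ v
        raise-injective zero    e = e
        raise-injective (suc k) e = raise-injective k (Finₚ.suc-injective e)

        pad∈W : ∀ k e → W (pad k α w e)
        pad∈W zero    e       = w∈W e
        pad∈W (suc k) zero    = α∈W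
        pad∈W (suc k) (suc e) = pad∈W k e

        arith : ∀ k n m → (k ℕ.+ n) ℕ.+ suc (k ℕ.+ m) ≡ suc (2 ℕ.* k) ℕ.+ (n ℕ.+ m)
        arith = solve-∀

      net-implements : ∀ {N y} β → W β → Net W N y →
        Σ PlanarNetwork λ Υ → Σ (Fin (PlanarNetwork.#E Υ) → ℚ) λ ŵ →
          (∀ e → W (ŵ e)) × Implements q Υ ŵ (y * (1ℚ + β) ℚ.- 1ℚ) ×
          size (PlanarNetwork.graph Υ) ≡ suc N
      net-implements {N} {y} β β∈W net =
        record { graph = graph ((s , t) F.∷ E) ; s = s ; t = t ; s≢t = s≢t
               ; embedding = planeEmbedding s plane ; outer = edge-on-face s plane zero } ,
        β F.∷ w , (λ { zero → β∈W ; (suc e) → w∈W e }) ,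
        (proj₁ Y , (begin
          b                          ≡⟨ ℚₚ.*-identityʳ b ⟨
          b * 1ℚ                     ≡⟨ cong (b *_) (ℚₚ.*-inverseʳ Zf) ⟨
          b * (Zf * ℚ.1/ Zf)         ≡⟨ ℚₚ.*-assoc b Zf (ℚ.1/ Zf) ⟨
          b * Zf * ℚ.1/ Zf           ≡⟨ cong (_* ℚ.1/ Zf) (proj₂ Y) ⟨
          (q * Zt) ℚ.÷ Zf ∎)) ,
        trans (ℕₚ.+-suc n m) (cong suc size≡)
        where
        open Net net
        open ≡-Reasoning
        b = y * (1ℚ + β) ℚ.- 1ℚ
        Y = yields-parallel E s t w β y yields
        Zt = Z true ((s , t) F.∷ E) s t (β F.∷ w)
        Zf = Z false ((s , t) F.∷ E) s t (β F.∷ w)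
        instance
          _ : ℚ.NonZero Zf
          _ = ℚ.≢-nonZero (proj₁ Y)

-- Rational estimates and the greedy product.

module Rationals where
  open import Data.Rational

  2ℚ : ℚ
  2ℚ = + 2 / 1

  -- The workhorse for polynomial inequalities: the difference `r` is given in a visibly nonnegative
  -- form, and the ring solver checks the identity.
  ≤-of : ∀ {p q} r → 0ℚ ≤ r → q ≡ p + r → p ≤ q
  ≤-of {p} r 0≤r refl = subst (_≤ p + r) (ℚₚ.+-identityʳ p) (ℚₚ.+-monoʳ-≤ p 0≤r)

  <-of : ∀ {p q} r → 0ℚ < r → q ≡ p + r → p < q
  <-of {p} r 0<r refl = subst (_< p + r) (ℚₚ.+-identityʳ p) (ℚₚ.+-monoʳ-< p 0<r)

  0≤- : ∀ {p q} → p ≤ q → 0ℚ ≤ q - p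
  0≤- {p} {q} p≤q = subst (_≤ q - p) (ℚₚ.+-inverseʳ p) (ℚₚ.+-monoˡ-≤ (- p) p≤q)

  0<- : ∀ {p q} → p < q → 0ℚ < q - p
  0<- {p} {q} p<q = subst (_< q - p) (ℚₚ.+-inverseʳ p) (ℚₚ.+-monoˡ-< (- p) p<q)

  0≤+ : ∀ {p q} → 0ℚ ≤ p → 0ℚ ≤ q → 0ℚ ≤ p + q
  0≤+ = ℚₚ.+-mono-≤

  0<+ : ∀ {p q} → 0ℚ < p → 0ℚ ≤ q → 0ℚ < p + q
  0<+ = ℚₚ.+-mono-<-≤

  0≤* : ∀ {p q} → 0ℚ ≤ p → 0ℚ ≤ q → 0ℚ ≤ p * q
  0≤* {p} {q} 0≤p 0≤q = ℚₚ.nonNegative⁻¹ (p * q) {{ℚₚ.nonNeg*nonNeg⇒nonNeg p {{nonNegative 0≤p}} q {{nonNegative 0≤q}}}}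

  0<* : ∀ {p q} → 0ℚ < p → 0ℚ < q → 0ℚ < p * q
  0<* {p} {q} 0<p 0<q = ℚₚ.positive⁻¹ (p * q) {{ℚₚ.pos*pos⇒pos p {{positive 0<p}} q {{positive 0<q}}}}

  *-monoʳ : ∀ {p q} r → 0ℚ ≤ r → p ≤ q → p * r ≤ q * r
  *-monoʳ r 0≤r = ℚₚ.*-monoʳ-≤-nonNeg r {{nonNegative 0≤r}}

  *-monoˡ : ∀ {p q} r → 0ℚ ≤ r → p ≤ q → r * p ≤ r * q
  *-monoˡ r 0≤r = ℚₚ.*-monoˡ-≤-nonNeg r {{nonNegative 0≤r}}

  *-mono : ∀ {p q r s} → 0ℚ ≤ p → p ≤ q → 0ℚ ≤ r → r ≤ s → p * r ≤ q * s
  *-mono {p} {q} {r} {s} 0≤p p≤q 0≤r r≤s =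
    ℚₚ.≤-trans (*-monoʳ r 0≤r p≤q) (*-monoˡ q (ℚₚ.≤-trans 0≤p p≤q) r≤s)

  cancelʳ : ∀ {p q} r → 0ℚ < r → p * r ≤ q * r → p ≤ q
  cancelʳ r 0<r = ℚₚ.*-cancelʳ-≤-pos r {{positive 0<r}}

  0<1 : 0ℚ < 1ℚ
  0<1 = ℚₚ.positive⁻¹ 1ℚ

  ι : ℕ → ℚ
  ι zero    = 0ℚ
  ι (suc n) = 1ℚ + ι n

  0≤ι : ∀ n → 0ℚ ≤ ι n
  0≤ι zero    = ℚₚ.≤-refl
  0≤ι (suc n) = 0≤+ (ℚₚ.<⇒≤ 0<1) (0≤ι n)

  ι-+ : ∀ m n → ι (m ℕ.+ n) ≡ ι m + ι n
  ι-+ zero    n = sym (ℚₚ.+-identityˡ (ι n))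
  ι-+ (suc m) n = trans (cong (λ x → 1ℚ + x) (ι-+ m n)) (sym (ℚₚ.+-assoc 1ℚ (ι m) (ι n)))

  ι-* : ∀ m n → ι (m ℕ.* n) ≡ ι m * ι n
  ι-* zero    n = sym (ℚₚ.*-zeroˡ (ι n))
  ι-* (suc m) n = trans (ι-+ n (m ℕ.* n)) (trans (cong (λ x → ι n + x) (ι-* m n))
    (solve 2 (λ m n → n :+ m :* n := (con 1ℚ :+ m) :* n) refl (ι m) (ι n)))

  ι-mono : ∀ {m n} → m ℕ.≤ n → ι m ≤ ι n
  ι-mono {n = n} ℕ.z≤n = 0≤ι n
  ι-mono (ℕ.s≤s m≤n)   = ℚₚ.+-monoʳ-≤ 1ℚ (ι-mono m≤n)

  private
    whole : ℕ → ℚ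
    whole n = mkℚ (+ n) 0 (Coprimality.sym (Coprimality.1-coprimeTo n))

    /1≡whole : ∀ n → + n / 1 ≡ whole n
    /1≡whole n = ℚₚ.↥p/↧p≡p (whole n)

  ι≡/1 : ∀ n → ι n ≡ + n / 1
  ι≡/1 zero    = refl
  ι≡/1 (suc n) = begin
    1ℚ + ι n               ≡⟨ cong (λ x → 1ℚ + x) (trans (ι≡/1 n) (/1≡whole n)) ⟩
    1ℚ + whole n           ≡⟨⟩
    (+ 1 ℤ.+ + n ℤ.* + 1) / 1   ≡⟨ cong (λ i → (+ 1 ℤ.+ i) / 1) (ℤₚ.*-identityʳ (+ n)) ⟩
    + suc n / 1 ∎
    where open ≡-Reasoning

  archimedean : ∀ x → ∃[ N ] x ≤ ι N
  archimedean x@(mkℚ (+ n) d c) = n , subst (x ≤_) (sym (trans (ι≡/1 n) (/1≡whole n)))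
    (*≤* (ℤₚ.*-monoˡ-≤-nonNeg (+ n) (ℤ.+≤+ (ℕ.s≤s ℕ.z≤n))))
  archimedean x@(mkℚ -[1+ n ] d c) = 0 , ℚₚ.<⇒≤ (ℚₚ.negative⁻¹ x)

  infixr 8 _↑_
  _↑_ : ℚ → ℕ → ℚ
  x ↑ zero  = 1ℚ
  x ↑ suc n = x * x ↑ n

  ^-+ : ∀ x m n → x ↑ (m ℕ.+ n) ≡ x ↑ m * x ↑ n
  ^-+ x zero    n = sym (ℚₚ.*-identityˡ (x ↑ n))
  ^-+ x (suc m) n = trans (cong (x *_) (^-+ x m n)) (sym (ℚₚ.*-assoc x (x ↑ m) (x ↑ n)))

  bernoulli : ∀ e n → 0ℚ ≤ e → 1ℚ + ι n * e ≤ (1ℚ + e) ↑ n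
  bernoulli e zero    0≤e = ℚₚ.≤-reflexive (solve 1 (λ e → con 1ℚ :+ con 0ℚ :* e := con 1ℚ) refl e)
  bernoulli e (suc n) 0≤e = ℚₚ.≤-trans
    (≤-of (ι n * (e * e)) (0≤* (0≤ι n) (0≤* 0≤e 0≤e))
      (solve 2 (λ e n → (con 1ℚ :+ e) :* (con 1ℚ :+ n :* e)
         := con 1ℚ :+ (con 1ℚ :+ n) :* e :+ n :* (e :* e)) refl e (ι n)))
    (*-monoˡ (1ℚ + e) (0≤+ (ℚₚ.<⇒≤ 0<1) 0≤e) (bernoulli e n 0≤e))

  divide : ∀ {r} x → r ≢ 0ℚ → ∃[ y ] y * r ≡ x
  divide {r} x r≢0 = x * 1/ r , trans (ℚₚ.*-assoc x (1/ r) r)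
    (trans (cong (x *_) (ℚₚ.*-inverseˡ r)) (ℚₚ.*-identityʳ x))
    where instance _ = ≢-nonZero r≢0

  >⇒≢ : ∀ {r} → 0ℚ < r → r ≢ 0ℚ
  >⇒≢ 0<r r≡0 = ℚₚ.<-irrefl (sym r≡0) 0<r

  archimedean-* : ∀ {r} x → 0ℚ < r → ∃[ N ] x ≤ ι N * r
  archimedean-* {r} x 0<r with divide x (>⇒≢ 0<r)
  ... | y , yr≡x with archimedean y
  ...   | N , y≤N = N , subst (_≤ ι N * r) yr≡x (*-monoʳ r (ℚₚ.<⇒≤ 0<r) y≤N)

  power-unbounded : ∀ {r c} x → 1ℚ < r → 0ℚ < c → ∃[ N ] x ≤ c * r ↑ N
  power-unbounded {r} {c} x 1<r 0<c with archimedean-* x (0<* (0<- 1<r) 0<c)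
  ... | N , x≤ = N , (begin
    x                                 ≤⟨ x≤ ⟩
    ι N * ((r - 1ℚ) * c)              ≤⟨ ≤-of c (ℚₚ.<⇒≤ 0<c) (solve 3 (λ n e c →
                                           c :* (con 1ℚ :+ n :* e) := n :* (e :* c) :+ c) refl (ι N) (r - 1ℚ) c) ⟩
    c * (1ℚ + ι N * (r - 1ℚ))         ≤⟨ *-monoˡ c (ℚₚ.<⇒≤ 0<c) (bernoulli (r - 1ℚ) N (ℚₚ.<⇒≤ (0<- 1<r))) ⟩
    c * (1ℚ + (r - 1ℚ)) ↑ N           ≡⟨ cong (λ r → c * r ↑ N)
                                           (solve 1 (λ r → con 1ℚ :+ (r :- con 1ℚ) := r) refl r) ⟩
    c * r ↑ N ∎)
    where open ℚₚ.≤-Reasoning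

  -- `M N P` is to be read as "the value P is reached with size N", and `c j` is the price of one
  -- factor `1 - d j`. `halving` gives the geometric convergence; `d≤Kd` says that `d` does not fall
  -- too fast, which bounds the number of uses of each factor.
  module Greedy (M : ℕ → ℚ → Set) (d : ℕ → ℚ) (c : ℕ → ℕ)
    (multiply : ∀ j {N P} → M N P → M (c j ℕ.+ N) (P * (1ℚ - d j)))
    (0<d : ∀ j → 0ℚ < d j) (d₀≤½ : d 0 ≤ ½)
    (halving : ∀ j → 2ℚ * d (suc j) ≤ d j)
    (K : ℕ) (d≤Kd : ∀ j → d j ≤ ι K * d (suc j)) where

    d≤½↑ : ∀ j → d j ≤ ½ ↑ suc j
    d≤½↑ zero    = d₀≤½
    d≤½↑ (suc j) = ℚₚ.≤-trans
      (subst (_≤ ½ * d j) (solve 1 (λ x → con ½ :* (con 2ℚ :* x) := x) refl (d (suc j)))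
        (*-monoˡ ½ (ℚₚ.nonNegative⁻¹ ½) (halving j)))
      (*-monoˡ ½ (ℚₚ.nonNegative⁻¹ ½) (d≤½↑ j))

    d≤½ : ∀ j → d j ≤ ½
    d≤½ zero    = d₀≤½
    d≤½ (suc j) = ℚₚ.≤-trans
      (≤-of (d (suc j)) (ℚₚ.<⇒≤ (0<d (suc j))) (solve 1 (λ x → con 2ℚ :* x := x :+ x) refl (d (suc j))))
      (ℚₚ.≤-trans (halving j) (d≤½ j))

    0≤1-d : ∀ j → 0ℚ ≤ 1ℚ - d j
    0≤1-d j = 0≤- (ℚₚ.≤-trans (d≤½ j) (≤-of ½ (ℚₚ.nonNegative⁻¹ ½) refl))

    -- P has been multiplied by 1 - d j as long as it stayed above τ.
    Stopped : ℕ → ℕ → ℚ → Set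
    Stopped bound j τ = ∃[ N ] ∃[ P ] (M N P × N ℕ.≤ bound × τ ≤ P × P * (1ℚ - d j) < τ)

    widen : ∀ {b b′ j τ} → b ℕ.≤ b′ → Stopped b j τ → Stopped b′ j τ
    widen b≤b′ (N , P , net , N≤b , rest) = N , P , net , ℕₚ.≤-trans N≤b b≤b′ , rest

    -- The excess of `P` over `τ`, in units of `τ * d j`, is at most `B`, and a multiplication by
    -- `1 - d j` lowers this bound by one: (1 + (B + 1)d)(1 - d) ≤ 1 + B d. Hence at most `B`
    -- multiplications take place.
    stage : ∀ B j {N P τ} → 0ℚ < τ → M N P → τ ≤ P → P ≤ τ * (1ℚ + ι B * d j) →
      Stopped (B ℕ.* c j ℕ.+ N) j τ
    stage B j {N} {P} {τ} 0<τ net τ≤P P≤ with P * (1ℚ - d j) ℚₚ.<? τ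
    ... | yes P[1-d]<τ = N , P , net , ℕₚ.m≤n+m N (B ℕ.* c j) , τ≤P , P[1-d]<τ
    stage zero j {N} {P} {τ} 0<τ net τ≤P P≤ | no P[1-d]≮τ =
      contradiction (ℚₚ.<-≤-trans τ[1-d]<τ (ℚₚ.≤-trans (ℚₚ.≮⇒≥ P[1-d]≮τ) P[1-d]≤)) (ℚₚ.<-irrefl refl)
      where
      τ[1-d]<τ : τ * (1ℚ - d j) < τ
      τ[1-d]<τ = <-of (τ * d j) (0<* 0<τ (0<d j))
        (solve 2 (λ t d → t := t :* (con 1ℚ :- d) :+ t :* d) refl τ (d j))
      P[1-d]≤ : P * (1ℚ - d j) ≤ τ * (1ℚ - d j)
      P[1-d]≤ = *-monoʳ (1ℚ - d j) (0≤1-d j) (subst (P ≤_)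
        (solve 2 (λ t d → t :* (con 1ℚ :+ con 0ℚ :* d) := t) refl τ (d j)) P≤)
    stage (suc B) j {N} {P} {τ} 0<τ net τ≤P P≤ | no P[1-d]≮τ =
      widen (ℕₚ.≤-reflexive eq) (stage B j 0<τ (multiply j net) (ℚₚ.≮⇒≥ P[1-d]≮τ) P[1-d]≤)
      where
      P[1-d]≤ : P * (1ℚ - d j) ≤ τ * (1ℚ + ι B * d j)
      P[1-d]≤ = ℚₚ.≤-trans
        (*-monoʳ (1ℚ - d j) (0≤1-d j) P≤)
        (≤-of (τ * (ι (suc B) * (d j * d j)))
          (0≤* (ℚₚ.<⇒≤ 0<τ) (0≤* (0≤ι (suc B)) (0≤* (ℚₚ.<⇒≤ (0<d j)) (ℚₚ.<⇒≤ (0<d j)))))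
          (solve 3 (λ t b d → t :* (con 1ℚ :+ b :* d)
             := t :* (con 1ℚ :+ (con 1ℚ :+ b) :* d) :* (con 1ℚ :- d) :+ t :* ((con 1ℚ :+ b) :* (d :* d)))
            refl τ (ι B) (d j)))
      eq : B ℕ.* c j ℕ.+ (c j ℕ.+ N) ≡ suc B ℕ.* c j ℕ.+ N
      eq = trans (sym (ℕₚ.+-assoc (B ℕ.* c j) (c j) N)) (cong (ℕ._+ N) (ℕₚ.+-comm (B ℕ.* c j) (c j)))

    -- For d ≤ 1/2 one has (1 - d)(1 + 2d) ≥ 1, so stopping with `d j` leaves an excess of at most
    -- `2 * d j` relative to `τ`. This is at most `2 * K` units of `d (suc j)`, within the allowance
    -- `B` of the next stage.
    stopped⇒≤ : ∀ B j {P τ} → 2 ℕ.* K ℕ.≤ B → 0ℚ < τ → τ ≤ P → P * (1ℚ - d j) < τ →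
      P ≤ τ * (1ℚ + ι B * d (suc j))
    stopped⇒≤ B j {P} {τ} 2K≤B 0<τ τ≤P P[1-d]<τ = begin
      P
        ≤⟨ ≤-of (2ℚ * (P * (d j * (½ - d j))))
             (0≤* (ℚₚ.nonNegative⁻¹ 2ℚ) (0≤* (ℚₚ.≤-trans (ℚₚ.<⇒≤ 0<τ) τ≤P) (0≤* (ℚₚ.<⇒≤ (0<d j)) (0≤- (d≤½ j)))))
             (solve 2 (λ P d → P :* (con 1ℚ :- d) :* (con 1ℚ :+ con 2ℚ :* d)
                := P :+ con 2ℚ :* (P :* (d :* (con ½ :- d)))) refl P (d j)) ⟩
      P * (1ℚ - d j) * (1ℚ + 2ℚ * d j)
        ≤⟨ *-monoʳ (1ℚ + 2ℚ * d j) (0≤+ (ℚₚ.<⇒≤ 0<1) (0≤* (ℚₚ.nonNegative⁻¹ 2ℚ) (ℚₚ.<⇒≤ (0<d j)))) (ℚₚ.<⇒≤ P[1-d]<τ) ⟩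
      τ * (1ℚ + 2ℚ * d j)
        ≤⟨ *-monoˡ τ (ℚₚ.<⇒≤ 0<τ) (ℚₚ.+-monoʳ-≤ 1ℚ (begin
             2ℚ * d j                       ≤⟨ *-monoˡ 2ℚ (ℚₚ.nonNegative⁻¹ 2ℚ) (d≤Kd j) ⟩
             2ℚ * (ι K * d (suc j))         ≡⟨ ℚₚ.*-assoc 2ℚ (ι K) (d (suc j)) ⟨
             2ℚ * ι K * d (suc j)           ≡⟨ cong (_* d (suc j)) (ι-* 2 K) ⟨
             ι (2 ℕ.* K) * d (suc j)        ≤⟨ *-monoʳ (d (suc j)) (ℚₚ.<⇒≤ (0<d (suc j))) (ι-mono 2K≤B) ⟩
             ι B * d (suc j) ∎)) ⟩
      τ * (1ℚ + ι B * d (suc j)) ∎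
      where open ℚₚ.≤-Reasoning

    bound : ℕ → ℕ → ℕ → ℕ
    bound B N zero    = B ℕ.* c 0 ℕ.+ N
    bound B N (suc J) = B ℕ.* c (suc J) ℕ.+ bound B N J

    stages : ∀ B {N P τ} → 2 ℕ.* K ℕ.≤ B → 0ℚ < τ → M N P → τ ≤ P → P ≤ τ * (1ℚ + ι B * d 0) →
      ∀ J → Stopped (bound B N J) J τ
    stages B 2K≤B 0<τ net τ≤P P≤ zero = stage B 0 0<τ net τ≤P P≤
    stages B {N} {τ = τ} 2K≤B 0<τ net τ≤P P≤ (suc J) = next (stages B 2K≤B 0<τ net τ≤P P≤ J)
      where
      next : Stopped (bound B N J) J τ → Stopped (bound B N (suc J)) (suc J) τ
      next (N′ , P′ , net′ , N′≤ , τ≤P′ , P′[1-d]<τ) =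
        widen (ℕₚ.+-monoʳ-≤ (B ℕ.* c (suc J)) N′≤)
          (stage B (suc J) 0<τ net′ τ≤P′ (stopped⇒≤ B J 2K≤B 0<τ τ≤P′ P′[1-d]<τ))

    -- The gap `P - τ` is less than `P * d J`, and `P ≤ 2 * τ` because `1 - d J` is at least 1/2;
    -- the factor 2 is absorbed by `d J ≤ ½ ↑ suc J`.
    stopped⇒close : ∀ J {P τ} → 0ℚ < τ → τ ≤ P → P * (1ℚ - d J) < τ → P ≤ τ + τ * ½ ↑ J
    stopped⇒close J {P} {τ} 0<τ τ≤P P[1-d]<τ = begin
      P                               ≡⟨ solve 2 (λ P d → P := P :* (con 1ℚ :- d) :+ P :* d) refl P (d J) ⟩
      P * (1ℚ - d J) + P * d J        ≤⟨ ℚₚ.+-mono-≤ (ℚₚ.<⇒≤ P[1-d]<τ) (*-mono 0≤P P≤2τ (ℚₚ.<⇒≤ (0<d J)) (d≤½↑ J)) ⟩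
      τ + 2ℚ * τ * (½ * ½ ↑ J)        ≡⟨ cong (λ x → τ + x)
                                           (solve 2 (λ t x → con 2ℚ :* t :* (con ½ :* x) := t :* x) refl τ (½ ↑ J)) ⟩
      τ + τ * ½ ↑ J ∎
      where
      open ℚₚ.≤-Reasoning
      0≤P : 0ℚ ≤ P
      0≤P = ℚₚ.≤-trans (ℚₚ.<⇒≤ 0<τ) τ≤P
      P≤2τ : P ≤ 2ℚ * τ
      P≤2τ = begin
        P                           ≤⟨ ≤-of (2ℚ * (P * (½ - d J))) (0≤* (ℚₚ.nonNegative⁻¹ 2ℚ) (0≤* 0≤P (0≤- (d≤½ J))))
                                         (solve 2 (λ P d → con 2ℚ :* (P :* (con 1ℚ :- d))
                                            := P :+ con 2ℚ :* (P :* (con ½ :- d))) refl P (d J)) ⟩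
        2ℚ * (P * (1ℚ - d J))       ≤⟨ *-monoˡ 2ℚ (ℚₚ.nonNegative⁻¹ 2ℚ) (ℚₚ.<⇒≤ P[1-d]<τ) ⟩
        2ℚ * τ ∎

-- Weights of paths and their geometric decay.

module PathWeights where
  open import Data.Rational
  open Rationals
  open Networks using (Series)
  open PartitionFunctions using (module Partition)

  -- U j + e stands for ∣ x ^ k - 1 ∣ and Q for ∣ q ∣, where the j-th path has k edges.
  module Decay (Q e Y : ℚ) (U d : ℕ → ℚ) (0<Q : 0ℚ < Q) (-1≤e : - 1ℚ ≤ e) (e≤1 : e ≤ 1ℚ)
    (2Q+4≤Y : 2ℚ * Q + + 4 / 1 ≤ Y) (Y≤U₀ : Y ≤ U 0) (U-suc : ∀ j → U (suc j) ≡ Y * U j)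
    (d[U+e]≡Q : ∀ j → d j * (U j + e) ≡ Q) where

    private
      4ℚ = + 4 / 1
      0≤Q = ℚₚ.<⇒≤ 0<Q

      4≤Y : 4ℚ ≤ Y
      4≤Y = ℚₚ.≤-trans (≤-of (2ℚ * Q) (0≤* (ℚₚ.nonNegative⁻¹ 2ℚ) 0≤Q) (ℚₚ.+-comm (2ℚ * Q) 4ℚ)) 2Q+4≤Y

      0≤Y : 0ℚ ≤ Y
      0≤Y = ℚₚ.≤-trans (ℚₚ.nonNegative⁻¹ 4ℚ) 4≤Y

      Y≤U : ∀ j → Y ≤ U j
      Y≤U zero    = Y≤U₀
      Y≤U (suc j) = subst (Y ≤_) (sym (U-suc j)) (subst (_≤ Y * U j) (ℚₚ.*-identityʳ Y)
        (*-monoˡ Y 0≤Y (ℚₚ.≤-trans (≤-of {q = 4ℚ} (+ 3 / 1) (ℚₚ.nonNegative⁻¹ (+ 3 / 1)) refl) (ℚₚ.≤-trans 4≤Y (Y≤U j)))))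

      V : ℕ → ℚ
      V j = U j + e

      2Q+3≤V : ∀ j → 2ℚ * Q + + 3 / 1 ≤ V j
      2Q+3≤V j = subst (_≤ V j) (ℚₚ.+-assoc (2ℚ * Q) 4ℚ (- 1ℚ)) (ℚₚ.+-mono-≤ (ℚₚ.≤-trans 2Q+4≤Y (Y≤U j)) -1≤e)

      0<V : ∀ j → 0ℚ < V j
      0<V j = ℚₚ.<-≤-trans
        (ℚₚ.+-mono-≤-< (0≤* (ℚₚ.nonNegative⁻¹ 2ℚ) 0≤Q) (ℚₚ.positive⁻¹ (+ 3 / 1))) (2Q+3≤V j)

      dVV : ∀ j → d j * (V j * V (suc j)) ≡ Q * V (suc j)
      dVV j = trans (sym (ℚₚ.*-assoc (d j) (V j) (V (suc j)))) (cong (_* V (suc j)) (d[U+e]≡Q j))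

      d′VV : ∀ j → d (suc j) * (V j * V (suc j)) ≡ Q * V j
      d′VV j = trans (solve 3 (λ d v v′ → d :* (v :* v′) := d :* v′ :* v) refl (d (suc j)) (V j) (V (suc j)))
        (cong (_* V j) (d[U+e]≡Q (suc j)))

      V-suc : ∀ j → V (suc j) ≡ Y * U j + e
      V-suc j = cong (_+ e) (U-suc j)

    0<d : ∀ j → 0ℚ < d j
    0<d j = ℚₚ.*-cancelʳ-<-nonNeg (V j) {{nonNegative (ℚₚ.<⇒≤ (0<V j))}}
      (subst₂ _<_ (sym (ℚₚ.*-zeroˡ (V j))) (sym (d[U+e]≡Q j)) 0<Q)

    -- Here the term `2 * Q` in the lower bound for `Y` is used: `V 0` is at least 2Q + 3, and `d 0`
    -- is Q divided by `V 0`.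
    d₀≤½ : d 0 ≤ ½
    d₀≤½ = cancelʳ (V 0) (0<V 0) (subst (_≤ ½ * V 0) (sym (d[U+e]≡Q 0)) (ℚₚ.≤-trans
      (≤-of (½ * (+ 3 / 1)) (ℚₚ.nonNegative⁻¹ (½ * (+ 3 / 1)))
        (solve 1 (λ Q → con ½ :* (con 2ℚ :* Q :+ con (+ 3 / 1)) := Q :+ con (½ * (+ 3 / 1))) refl Q))
      (*-monoˡ ½ (ℚₚ.nonNegative⁻¹ ½) (2Q+3≤V 0))))

    -- After multiplication by `V j * V (suc j)` the claim is `2 * V j ≤ V (suc j)`. It holds since
    -- `V` differs from `U` by at most 1, both `Y` and `U j` are at least 4, and `U` grows by the
    -- factor `Y`.
    halving : ∀ j → 2ℚ * d (suc j) ≤ d j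
    halving j = cancelʳ (V j * V (suc j)) (0<* (0<V j) (0<V (suc j))) (begin
      2ℚ * d (suc j) * (V j * V (suc j))     ≡⟨ ℚₚ.*-assoc 2ℚ (d (suc j)) (V j * V (suc j)) ⟩
      2ℚ * (d (suc j) * (V j * V (suc j)))   ≡⟨ cong (2ℚ *_) (d′VV j) ⟩
      2ℚ * (Q * V j)                         ≤⟨ ≤-of (Q * ((Y - 4ℚ) * U j + (2ℚ * (U j - 4ℚ) + (1ℚ - e) + + 7 / 1)))
                                                  (0≤* 0≤Q (0≤+ (0≤* (0≤- 4≤Y) (ℚₚ.≤-trans 0≤Y (Y≤U j)))
                                                    (0≤+ (0≤+ (0≤* (ℚₚ.nonNegative⁻¹ 2ℚ) (0≤- (ℚₚ.≤-trans 4≤Y (Y≤U j)))) (0≤- e≤1))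
                                                      (ℚₚ.nonNegative⁻¹ (+ 7 / 1)))))
                                                  (solve 4 (λ Q Y U e → Q :* (Y :* U :+ e) := con 2ℚ :* (Q :* (U :+ e))
                                                     :+ Q :* ((Y :- con 4ℚ) :* U :+ (con 2ℚ :* (U :- con 4ℚ) :+ (con 1ℚ :- e) :+ con (+ 7 / 1))))
                                                    refl Q Y (U j) e) ⟩
      Q * (Y * U j + e)                      ≡⟨ cong (Q *_) (V-suc j) ⟨
      Q * V (suc j)                          ≡⟨ dVV j ⟨
      d j * (V j * V (suc j)) ∎)
      where open ℚₚ.≤-Reasoning

    -- The difference `(Y + 1) * V j - V (suc j)` equals `U j + Y * e`. With `e` possibly equal to
    -- -1, it is nonnegative because `U j` is at least `Y`.
    d≤Kd : ∀ {K} → Y + 1ℚ ≤ K → ∀ j → d j ≤ K * d (suc j)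
    d≤Kd {K} Y+1≤K j = ℚₚ.≤-trans (cancelʳ (V j * V (suc j)) (0<* (0<V j) (0<V (suc j))) (begin
      d j * (V j * V (suc j))                        ≡⟨ dVV j ⟩
      Q * V (suc j)                                  ≡⟨ cong (Q *_) (V-suc j) ⟩
      Q * (Y * U j + e)                              ≤⟨ ≤-of (Q * ((U j - Y) + Y * (e - - 1ℚ)))
                                                          (0≤* 0≤Q (0≤+ (0≤- (Y≤U j)) (0≤* 0≤Y (0≤- -1≤e))))
                                                          (solve 4 (λ Q Y U e → (Y :+ con 1ℚ) :* (Q :* (U :+ e)) :=
                                                             Q :* (Y :* U :+ e) :+ Q :* ((U :- Y) :+ Y :* (e :- con (- 1ℚ)))) refl Q Y (U j) e) ⟩
      (Y + 1ℚ) * (Q * V j)                           ≡⟨ cong ((Y + 1ℚ) *_) (d′VV j) ⟨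
      (Y + 1ℚ) * (d (suc j) * (V j * V (suc j)))     ≡⟨ ℚₚ.*-assoc (Y + 1ℚ) (d (suc j)) (V j * V (suc j)) ⟨
      (Y + 1ℚ) * d (suc j) * (V j * V (suc j)) ∎))
      (*-monoʳ (d (suc j)) (ℚₚ.<⇒≤ (0<d (suc j))) Y+1≤K)
      where open ℚₚ.≤-Reasoning

  ^-square : ∀ x n → (x * x) ↑ n ≡ x ↑ n * x ↑ n
  ^-square x zero    = refl
  ^-square x (suc n) = trans (cong (x * x *_) (^-square x n))
    (solve 2 (λ x y → x :* x :* (y :* y) := x :* y :* (x :* y)) refl x (x ↑ n))

  -- Passing to squares treats both signs of `x` at once: by Bernoulli's inequality the powers of
  -- `x * x` exceed 1.
  x^k≢1 : ∀ {x} → 1ℚ < x * x → ∀ k → x ↑ suc k ≢ 1ℚ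
  x^k≢1 {x} 1<xx k e = ℚₚ.<-irrefl (sym (trans (^-square x (suc k)) (cong₂ _*_ e e))) (begin-strict
    1ℚ                                  <⟨ <-of (ι (suc k) * (x * x - 1ℚ)) (0<* (0<+ 0<1 (0≤ι k)) (0<- 1<xx)) refl ⟩
    1ℚ + ι (suc k) * (x * x - 1ℚ)       ≤⟨ bernoulli (x * x - 1ℚ) (suc k) (ℚₚ.<⇒≤ (0<- 1<xx)) ⟩
    (1ℚ + (x * x - 1ℚ)) ↑ suc k         ≡⟨ cong (_↑ suc k) (solve 1 (λ r → con 1ℚ :+ (r :- con 1ℚ) := r) refl (x * x)) ⟩
    (x * x) ↑ suc k ∎)
    where open ℚₚ.≤-Reasoning

  -≢0 : ∀ {x y} → x ≢ y → x - y ≢ 0ℚ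
  -≢0 {x} {y} x≢y e = x≢y (trans (solve 2 (λ x y → x := (x :- y) :+ y) refl x y) (trans (cong (_+ y) e) (ℚₚ.+-identityˡ y)))

  *-cancel : ∀ {x y} r → r ≢ 0ℚ → x * r ≡ y * r → x ≡ y
  *-cancel {x} {y} r r≢0 e = begin
    x                  ≡⟨ ℚₚ.*-identityʳ x ⟨
    x * 1ℚ             ≡⟨ cong (x *_) (ℚₚ.*-inverseʳ r) ⟨
    x * (r * 1/ r)     ≡⟨ ℚₚ.*-assoc x r (1/ r) ⟨
    x * r * 1/ r       ≡⟨ cong (_* 1/ r) e ⟩
    y * r * 1/ r       ≡⟨ ℚₚ.*-assoc y r (1/ r) ⟩
    y * (r * 1/ r)     ≡⟨ cong (y *_) (ℚₚ.*-inverseʳ r) ⟩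
    y * 1ℚ             ≡⟨ ℚₚ.*-identityʳ y ⟩
    y ∎
    where
    open ≡-Reasoning
    instance _ = ≢-nonZero r≢0

  -- x is the dual coordinate 1 + q / α of α; it is multiplicative in series.
  module Paths {q α x : ℚ} (q≢0 : q ≢ 0ℚ) (α[x-1]≡q : α * (x - 1ℚ) ≡ q) (1<xx : 1ℚ < x * x) where
    open Partition q using (*-nonzero)

    x^-1≢0 : ∀ k → x ↑ suc k - 1ℚ ≢ 0ℚ
    x^-1≢0 k = -≢0 (x^k≢1 {x} 1<xx k)

    -- The weight of a path of k + 1 edges of weight α.
    ω : ℕ → ℚ
    ω k = proj₁ (divide q (x^-1≢0 k))

    ω-spec : ∀ k → ω k * (x ↑ suc k - 1ℚ) ≡ q
    ω-spec k = proj₂ (divide q (x^-1≢0 k))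

    ω₀≡α : ω 0 ≡ α
    ω₀≡α = *-cancel (x ↑ 1 - 1ℚ) (x^-1≢0 0) (trans (ω-spec 0)
      (trans (sym α[x-1]≡q) (cong (λ y → α * (y - 1ℚ)) (sym (ℚₚ.*-identityʳ x)))))

    -- The dual coordinate 1 + q / ω of a path is the power `x ↑ suc k`, and one more edge
    -- multiplies it by `x`. The proof is this computation with denominators cleared.
    ω-step : ∀ k → (q + ω k + α) * ω (suc k) ≡ ω k * α
    ω-step k = *-cancel ((X - 1ℚ) * (x * X - 1ℚ)) (*-nonzero (x^-1≢0 k) (x^-1≢0 (suc k))) (begin
      (q + ω k + α) * ω (suc k) * ((X - 1ℚ) * (x * X - 1ℚ))
        ≡⟨ solve 6 (λ q w a w′ X x → (q :+ w :+ a) :* w′ :* ((X :- con 1ℚ) :* (x :* X :- con 1ℚ))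
             := ((q :+ a) :* (X :- con 1ℚ) :+ w :* (X :- con 1ℚ)) :* (w′ :* (x :* X :- con 1ℚ)))
             refl q (ω k) α (ω (suc k)) X x ⟩
      ((q + α) * (X - 1ℚ) + ω k * (X - 1ℚ)) * (ω (suc k) * (x * X - 1ℚ))
        ≡⟨ cong₂ (λ a b → ((q + α) * (X - 1ℚ) + a) * b) (ω-spec k) (ω-spec (suc k)) ⟩
      ((q + α) * (X - 1ℚ) + q) * q
        ≡⟨ cong (λ p → ((p + α) * (X - 1ℚ) + p) * q) (sym α[x-1]≡q) ⟩
      ((α * (x - 1ℚ) + α) * (X - 1ℚ) + α * (x - 1ℚ)) * q
        ≡⟨ solve 4 (λ a x X q → ((a :* (x :- con 1ℚ) :+ a) :* (X :- con 1ℚ) :+ a :* (x :- con 1ℚ)) :* q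
             := q :* a :* (x :* X :- con 1ℚ)) refl α x X q ⟩
      q * α * (x * X - 1ℚ)
        ≡⟨ cong (λ p → p * α * (x * X - 1ℚ)) (sym (ω-spec k)) ⟩
      ω k * (X - 1ℚ) * α * (x * X - 1ℚ)
        ≡⟨ solve 4 (λ w X a x → w :* (X :- con 1ℚ) :* a :* (x :* X :- con 1ℚ)
             := w :* a :* ((X :- con 1ℚ) :* (x :* X :- con 1ℚ))) refl (ω k) X α x ⟩
      ω k * α * ((X - 1ℚ) * (x * X - 1ℚ)) ∎)
      where
      open ≡-Reasoning
      X = x ↑ suc k

    ω≢0 : ∀ k → ω k ≢ 0ℚ
    ω≢0 k e = q≢0 (trans (sym (ω-spec k)) (trans (cong (_* (x ↑ suc k - 1ℚ)) e) (ℚₚ.*-zeroˡ (x ↑ suc k - 1ℚ))))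

    series : ∀ k j → Series q α k (ω j) (ω (k ℕ.+ j))
    series zero    j = refl
    series (suc k) j = ω (suc j)
      -- If the denominator `q + ω j + α` vanished, then by `ω-step` so would `ω j * α`, a product
      -- of nonzero factors.
      , (λ D≡0 → *-nonzero (ω≢0 j) (subst (_≢ 0ℚ) ω₀≡α (ω≢0 0)) (trans (sym (ω-step j))
          (trans (cong (_* ω (suc j)) D≡0) (ℚₚ.*-zeroˡ (ω (suc j))))))
      , ω-step j
      , subst (λ i → Series q α k (ω (suc j)) (ω i)) (ℕₚ.+-suc k j) (series k (suc j))

    path-series : ∀ k → Series q α k α (ω k)
    path-series k = subst₂ (λ z i → Series q α k z (ω i)) ω₀≡α (ℕₚ.+-identityʳ k) (series k 0)

-- Approximating a rational target by networks of quadratic size.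

module Approximations where
  open import Data.Rational
  open Rationals
  open Networks
  open PathWeights

  2↑*½↑ : ∀ n → 2ℚ ↑ n * ½ ↑ n ≡ 1ℚ
  2↑*½↑ zero    = refl
  2↑*½↑ (suc n) = trans
    (solve 2 (λ a b → con 2ℚ :* a :* (con ½ :* b) := a :* b) refl (2ℚ ↑ n) (½ ↑ n)) (2↑*½↑ n)

  0<½↑ : ∀ n → 0ℚ < ½ ↑ n
  0<½↑ zero    = 0<1
  0<½↑ (suc n) = 0<* (ℚₚ.positive⁻¹ ½) (0<½↑ n)

  ^-* : ∀ x m n → x ↑ (m ℕ.* n) ≡ (x ↑ n) ↑ m
  ^-* x zero    n = refl
  ^-* x (suc m) n = trans (^-+ x n (m ℕ.* n)) (cong (x ↑ n *_) (^-* x m n))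

  -- `C` is a parameter, so that it can be fixed before `n` and `τ`. This uniformity is what makes
  -- the final polynomial independent of ρ̂ and a.
  Approximates : (q : ℚ) (W : ℚ → Set) (s : ℚ) → ℕ → ℕ → ℚ → Set
  Approximates q W s C n τ = Σ PlanarNetwork λ Υ → Σ (Fin (PlanarNetwork.#E Υ) → ℚ) λ ŵ → Σ ℚ λ P →
    (∀ e → W (ŵ e)) × Implements q Υ ŵ (s * P - 1ℚ) × τ ≤ P × P ≤ τ + ½ ↑ n ×
    size (PlanarNetwork.graph Υ) ℕ.≤ C ℕ.* (suc n ℕ.* suc n)

  -- s is 1 or -1: the sign of the values 1 + b to be reached, which is opposite to that of q.
  module Approximation {q α α₁ β s x : ℚ} {W : ℚ → Set}
    (α∈W : W α) (α₁∈W : W α₁) (β∈W : W β)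
    (ss≡1 : s * s ≡ 1ℚ) (-1≤s : - 1ℚ ≤ s) (s≤1 : s ≤ 1ℚ) (0<-sq : 0ℚ < - (s * q))
    (α[x-1]≡q : α * (x - 1ℚ) ≡ q) (1<sx : 1ℚ < s * x) (1<yy : 1ℚ < (1ℚ + α₁) * (1ℚ + α₁)) where

    -- The weight `β` of the reserve edge is counted in advance, since it may be needed to give the
    -- value its sign `s`.
    M : ℕ → ℚ → Set
    M N P = ∃[ y ] (Net q W N y × y * (1ℚ + β) ≡ s * P)

    scale-M : ∀ {y P} z → y * (1ℚ + β) ≡ s * P → y * z * (1ℚ + β) ≡ s * (P * z)
    scale-M {y} {P} z e = trans (solve 3 (λ y z b → y :* z :* b := y :* b :* z) refl y z (1ℚ + β))
      (trans (cong (_* z) e) (ℚₚ.*-assoc s P z))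

    edge-M : ∀ {N P} → M N P → M (suc N) (P * (1ℚ + α₁))
    edge-M {P = P} (y , net , e) = y * (1ℚ + α₁) , net-path q 0 α₁∈W refl net , scale-M {y} {P} (1ℚ + α₁) e

    edges-M : ∀ i {N P} → M N P → M (2 ℕ.* i ℕ.+ N) (P * ((1ℚ + α₁) * (1ℚ + α₁)) ↑ i)
    edges-M zero    {N} {P} net = subst (M N) (sym (ℚₚ.*-identityʳ P)) net
    edges-M (suc i) {N} {P} net = subst₂ M
      (arith i N)
      (solve 3 (λ p y z → p :* z :* y :* y := p :* (y :* y :* z)) refl P (1ℚ + α₁) (((1ℚ + α₁) * (1ℚ + α₁)) ↑ i))
      (edge-M (edge-M (edges-M i net)))
      where
      arith : ∀ i N → suc (suc (2 ℕ.* i ℕ.+ N)) ≡ 2 ℕ.* suc i ℕ.+ N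
      arith = solve-∀

    q≢0 : q ≢ 0ℚ
    q≢0 refl = ℚₚ.<-irrefl (sym (cong -_ (ℚₚ.*-zeroʳ s))) 0<-sq

    1<xx : 1ℚ < x * x
    1<xx = subst (1ℚ <_)
      (trans (solve 2 (λ s x → s :* x :* (s :* x) := s :* s :* (x :* x)) refl s x)
        (trans (cong (_* (x * x)) ss≡1) (ℚₚ.*-identityˡ (x * x))))
      (ℚₚ.<-≤-trans 1<sx (subst (_≤ s * x * (s * x)) (ℚₚ.*-identityˡ (s * x))
        (*-monoʳ (s * x) (ℚₚ.≤-trans (ℚₚ.<⇒≤ 0<1) (ℚₚ.<⇒≤ 1<sx)) (ℚₚ.<⇒≤ 1<sx))))

    open Paths {q} {α} {x} q≢0 α[x-1]≡q 1<xx

    Q : ℚ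
    Q = - (s * q)

    h : ℕ
    h = proj₁ (power-unbounded (2ℚ * Q + + 4 / 1) 1<xx 0<1)

    Y : ℚ
    Y = (x * x) ↑ h

    -- Paths with an odd number of edges, so that the weight - d j is negative.
    k : ℕ → ℕ
    k j = suc j ℕ.* (2 ℕ.* h)

    d U : ℕ → ℚ
    d j = - ω (k j)
    U j = s * x * Y ↑ suc j

    x^2h≡Y : x ↑ (2 ℕ.* h) ≡ Y
    x^2h≡Y = trans (^-+ x h (h ℕ.+ 0)) (trans (cong (λ i → x ↑ h * x ↑ i) (ℕₚ.+-identityʳ h)) (sym (^-square x h)))

    x^≡ : ∀ j → x ↑ suc (k j) ≡ x * Y ↑ suc j
    x^≡ j = cong (x *_) (trans (^-* x (suc j) (2 ℕ.* h)) (cong (_↑ suc j) x^2h≡Y))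

    -- This is the equation ω (x^k - 1) = q for the path with k = `suc (k j)` edges, multiplied by
    -- `- s`. As that k is odd, s x^k is the positive number `U j`, and the deviation `e` is `- s`.
    d[U+e]≡Q : ∀ j → d j * (U j + - s) ≡ Q
    d[U+e]≡Q j = begin
      - ω (k j) * (s * x * Y ↑ suc j + - s)
        ≡⟨ solve 4 (λ w s x Y → (:- w) :* (s :* x :* Y :+ (:- s)) := :- (s :* (w :* (x :* Y :- con 1ℚ))))
             refl (ω (k j)) s x (Y ↑ suc j) ⟩
      - (s * (ω (k j) * (x * Y ↑ suc j - 1ℚ)))
        ≡⟨ cong (λ X → - (s * (ω (k j) * (X - 1ℚ)))) (sym (x^≡ j)) ⟩
      - (s * (ω (k j) * (x ↑ suc (k j) - 1ℚ)))
        ≡⟨ cong (λ p → - (s * p)) (ω-spec (k j)) ⟩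
      Q ∎
      where open ≡-Reasoning

    2Q+4≤Y : 2ℚ * Q + + 4 / 1 ≤ Y
    2Q+4≤Y = subst (2ℚ * Q + + 4 / 1 ≤_) (ℚₚ.*-identityˡ Y) (proj₂ (power-unbounded (2ℚ * Q + + 4 / 1) 1<xx 0<1))

    0≤Y : 0ℚ ≤ Y
    0≤Y = ℚₚ.≤-trans (0≤+ (0≤* (ℚₚ.nonNegative⁻¹ 2ℚ) (ℚₚ.<⇒≤ 0<-sq)) (ℚₚ.nonNegative⁻¹ (+ 4 / 1))) 2Q+4≤Y

    Y≤U₀ : Y ≤ U 0
    Y≤U₀ = subst₂ _≤_ (ℚₚ.*-identityˡ Y) (cong (s * x *_) (sym (ℚₚ.*-identityʳ Y))) (*-monoʳ Y 0≤Y (ℚₚ.<⇒≤ 1<sx))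

    open Decay Q (- s) Y U d 0<-sq (ℚₚ.neg-antimono-≤ s≤1) (ℚₚ.neg-antimono-≤ -1≤s) 2Q+4≤Y Y≤U₀
      (λ j → solve 3 (λ v Y Z → v :* (Y :* Z) := Y :* (v :* Z)) refl (s * x) Y (Y ↑ suc j)) d[U+e]≡Q

    K : ℕ
    K = proj₁ (archimedean (Y + 1ℚ))

    cost : ℕ → ℕ
    cost j = suc (2 ℕ.* k j)

    multiply : ∀ j {N P} → M N P → M (cost j ℕ.+ N) (P * (1ℚ - d j))
    multiply j {P = P} (y , net , e) = y * (1ℚ + ω (k j)) , net-path q (k j) α∈W (path-series (k j)) net ,
      subst (λ z → y * (1ℚ + ω (k j)) * (1ℚ + β) ≡ s * (P * z))
        (solve 1 (λ w → con 1ℚ :+ w := con 1ℚ :- (:- w)) refl (ω (k j)))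
        (scale-M {y} {P} (1ℚ + ω (k j)) e)

    open Greedy M d cost multiply 0<d d₀≤½ halving K (d≤Kd (proj₂ (archimedean (Y + 1ℚ))))

    H : ℕ
    H = suc (4 ℕ.* h)

    -- The price of the j-th factor is 1 + 4h(j + 1), at most `H` times j + 1, so the sum over J + 1
    -- stages is quadratic.
    bound≤ : ∀ B N J → bound B N J ℕ.≤ B ℕ.* H ℕ.* (suc J ℕ.* suc J) ℕ.+ N
    bound≤ B N zero = ℕₚ.+-monoˡ-≤ N (ℕₚ.≤-reflexive (eq B h))
      where
      eq : ∀ B h → B ℕ.* suc (2 ℕ.* (1 ℕ.* (2 ℕ.* h))) ≡ B ℕ.* suc (4 ℕ.* h) ℕ.* 1
      eq = solve-∀
    bound≤ B N (suc J) = ℕₚ.≤-trans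
      (ℕₚ.+-monoʳ-≤ (B ℕ.* cost (suc J)) (bound≤ B N J))
      (ℕₚ.≤-trans (ℕₚ.m≤m+n _ (B ℕ.* suc J ℕ.+ B ℕ.* H ℕ.* suc J)) (ℕₚ.≤-reflexive (eq B h J N)))
      where
      eq : ∀ B h J N → B ℕ.* suc (2 ℕ.* (suc (suc J) ℕ.* (2 ℕ.* h))) ℕ.+ (B ℕ.* suc (4 ℕ.* h) ℕ.* (suc J ℕ.* suc J) ℕ.+ N)
        ℕ.+ (B ℕ.* suc J ℕ.+ B ℕ.* suc (4 ℕ.* h) ℕ.* suc J)
        ≡ B ℕ.* suc (4 ℕ.* h) ℕ.* (suc (suc J) ℕ.* suc (suc J)) ℕ.+ N
      eq = solve-∀

    approximate : ∀ {N₀ P₀} → 0ℚ < P₀ → M N₀ P₀ → ∀ T → ∃[ C ] (∀ n τ → 1ℚ ≤ τ → τ ≤ T → Approximates q W s C n τ)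
    approximate {N₀} {P₀} 0<P₀ net₀ T = C , build
      where
      -- Pairs of edges of weight `α₁` multiply by a square greater than 1: they keep the sign and
      -- lift the starting value above every admissible target.
      i = proj₁ (power-unbounded T 1<yy 0<P₀)
      P₁ = P₀ * ((1ℚ + α₁) * (1ℚ + α₁)) ↑ i
      N₁ = 2 ℕ.* i ℕ.+ N₀
      T≤P₁ : T ≤ P₁
      T≤P₁ = proj₂ (power-unbounded T 1<yy 0<P₀)
      -- `B₀` covers the excess of `P₁` at the first stage, where `1 ≤ τ` is used, and `2 * K`
      -- covers that of every later stage.
      B₀ = proj₁ (archimedean-* P₁ (0<d 0))
      B = B₀ ℕ.+ 2 ℕ.* K
      -- `m` further stages turn the relative error into an absolute one: `τ * ½ ↑ (n + m)` is at
      -- most `½ ↑ n` for `τ ≤ T`.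
      m = proj₁ (power-unbounded {2ℚ} T (<-of 1ℚ 0<1 refl) 0<1)
      C = suc (B ℕ.* H ℕ.* (suc m ℕ.* suc m) ℕ.+ N₁)

      T½^m≤1 : T * ½ ↑ m ≤ 1ℚ
      T½^m≤1 = subst (T * ½ ↑ m ≤_) (trans (cong (_* ½ ↑ m) (ℚₚ.*-identityˡ (2ℚ ↑ m))) (2↑*½↑ m))
        (*-monoʳ (½ ↑ m) (ℚₚ.<⇒≤ (0<½↑ m)) (proj₂ (power-unbounded {2ℚ} T (<-of 1ℚ 0<1 refl) 0<1)))

      sizes : ∀ n → suc (bound B N₁ (n ℕ.+ m)) ℕ.≤ C ℕ.* (suc n ℕ.* suc n)
      sizes n = ℕₚ.≤-trans (ℕ.s≤s (bound≤ B N₁ (n ℕ.+ m)))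
        (ℕₚ.≤-trans (ℕₚ.m≤m+n _ extra) (ℕₚ.≤-reflexive (eq (B ℕ.* H) N₁ n m)))
        where
        -- The slack in (n + m + 1)² ≤ (n + 1)²(m + 1)², together with that of the constant part
        -- `N₁ + 1`.
        extra = B ℕ.* H ℕ.* (n ℕ.* n ℕ.* m ℕ.* m ℕ.+ 2 ℕ.* (n ℕ.* n ℕ.* m) ℕ.+ 2 ℕ.* (n ℕ.* m ℕ.* m) ℕ.+ 2 ℕ.* (n ℕ.* m))
          ℕ.+ (N₁ ℕ.+ 1) ℕ.* (n ℕ.* n ℕ.+ 2 ℕ.* n)
        eq : ∀ b N n m → suc (b ℕ.* (suc (n ℕ.+ m) ℕ.* suc (n ℕ.+ m)) ℕ.+ N)
          ℕ.+ (b ℕ.* (n ℕ.* n ℕ.* m ℕ.* m ℕ.+ 2 ℕ.* (n ℕ.* n ℕ.* m) ℕ.+ 2 ℕ.* (n ℕ.* m ℕ.* m) ℕ.+ 2 ℕ.* (n ℕ.* m))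
          ℕ.+ (N ℕ.+ 1) ℕ.* (n ℕ.* n ℕ.+ 2 ℕ.* n))
          ≡ suc (b ℕ.* (suc m ℕ.* suc m) ℕ.+ N) ℕ.* (suc n ℕ.* suc n)
        eq = solve-∀

      build : ∀ n τ → 1ℚ ≤ τ → τ ≤ T → Approximates q W s C n τ
      build n τ 1≤τ τ≤T =
        finish (stages B (ℕₚ.m≤n+m (2 ℕ.* K) B₀) 0<τ (edges-M i net₀) (ℚₚ.≤-trans τ≤T T≤P₁) P₁≤ (n ℕ.+ m))
        where
        open ℚₚ.≤-Reasoning
        0<τ : 0ℚ < τ
        0<τ = ℚₚ.<-≤-trans 0<1 1≤τ

        P₁≤ : P₁ ≤ τ * (1ℚ + ι B * d 0)
        P₁≤ = begin
          P₁                        ≤⟨ proj₂ (archimedean-* P₁ (0<d 0)) ⟩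
          ι B₀ * d 0                ≤⟨ *-monoʳ (d 0) (ℚₚ.<⇒≤ (0<d 0)) (ι-mono (ℕₚ.m≤m+n B₀ (2 ℕ.* K))) ⟩
          ι B * d 0                 ≤⟨ ≤-of 1ℚ (ℚₚ.<⇒≤ 0<1) (ℚₚ.+-comm 1ℚ (ι B * d 0)) ⟩
          1ℚ + ι B * d 0            ≡⟨ ℚₚ.*-identityˡ (1ℚ + ι B * d 0) ⟨
          1ℚ * (1ℚ + ι B * d 0)     ≤⟨ *-monoʳ (1ℚ + ι B * d 0)
                                         (0≤+ (ℚₚ.<⇒≤ 0<1) (0≤* (0≤ι B) (ℚₚ.<⇒≤ (0<d 0)))) 1≤τ ⟩
          τ * (1ℚ + ι B * d 0) ∎

        τ½^≤ : τ * ½ ↑ (n ℕ.+ m) ≤ ½ ↑ n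
        τ½^≤ = begin
          τ * ½ ↑ (n ℕ.+ m)         ≡⟨ cong (τ *_) (^-+ ½ n m) ⟩
          τ * (½ ↑ n * ½ ↑ m)       ≤⟨ *-monoʳ (½ ↑ n * ½ ↑ m) (ℚₚ.<⇒≤ (0<* (0<½↑ n) (0<½↑ m))) τ≤T ⟩
          T * (½ ↑ n * ½ ↑ m)       ≡⟨ solve 3 (λ T a b → T :* (a :* b) := a :* (T :* b)) refl T (½ ↑ n) (½ ↑ m) ⟩
          ½ ↑ n * (T * ½ ↑ m)       ≤⟨ *-monoˡ (½ ↑ n) (ℚₚ.<⇒≤ (0<½↑ n)) T½^m≤1 ⟩
          ½ ↑ n * 1ℚ                ≡⟨ ℚₚ.*-identityʳ (½ ↑ n) ⟩
          ½ ↑ n ∎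

        finish : Stopped (bound B N₁ (n ℕ.+ m)) (n ℕ.+ m) τ → Approximates q W s C n τ
        finish (N , P , (y , net , e) , N≤ , τ≤P , P[1-d]<τ) = assemble (net-implements q β β∈W net)
          where
          assemble : (Σ PlanarNetwork λ Υ → Σ (Fin (PlanarNetwork.#E Υ) → ℚ) λ ŵ →
              (∀ e → W (ŵ e)) × Implements q Υ ŵ (y * (1ℚ + β) - 1ℚ) × size (PlanarNetwork.graph Υ) ≡ suc N) →
            Approximates q W s C n τ
          assemble (Υ , ŵ , ŵ∈W , imp , size≡) = Υ , ŵ , P , ŵ∈W
            , subst (λ v → Implements q Υ ŵ (v - 1ℚ)) e imp
            , τ≤P
            , ℚₚ.≤-trans (stopped⇒close (n ℕ.+ m) 0<τ τ≤P P[1-d]<τ) (ℚₚ.+-monoʳ-≤ τ τ½^≤)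
            , ℕₚ.≤-trans (ℕₚ.≤-reflexive size≡) (ℕₚ.≤-trans (ℕ.s≤s N≤) (sizes n))

-- The two signs of q, and bounds for a² + 3a.

module Cases where
  open import Data.Rational
  open Rationals
  open Networks
  open Approximations

  Weights : ℚ → ℚ → ℚ → ℚ → Set
  Weights α₁ α₂ α₃ w = w ≡ α₁ ⊎ w ≡ α₂ ⊎ w ≡ α₃

  1<[1+α]² : ∀ α → ¬ (-[1+ 1 ] / 1 ≤ α × α ≤ 0ℚ) → 1ℚ < (1ℚ + α) * (1ℚ + α)
  1<[1+α]² α α∉ with α ℚₚ.≤? 0ℚ
  ... | no α≰0 = <-of (2ℚ * α + α * α) (0<+ (0<* (ℚₚ.positive⁻¹ 2ℚ) 0<α) (ℚₚ.<⇒≤ (0<* 0<α 0<α)))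
    (solve 1 (λ a → (con 1ℚ :+ a) :* (con 1ℚ :+ a) := con 1ℚ :+ (con 2ℚ :* a :+ a :* a)) refl α)
    where
    0<α = ℚₚ.≰⇒> α≰0
  ... | yes α≤0 = <-of ((-[1+ 1 ] / 1 - α) * (0ℚ - α)) (0<* (0<- α<-2) (0<- α<0))
    (solve 1 (λ a → (con 1ℚ :+ a) :* (con 1ℚ :+ a) := con 1ℚ :+ (con (-[1+ 1 ] / 1) :- a) :* (con 0ℚ :- a)) refl α)
    where
    α<-2 : α < -[1+ 1 ] / 1
    α<-2 = ℚₚ.≰⇒> λ -2≤α → α∉ (-2≤α , α≤0)
    α<0 : α < 0ℚ
    α<0 = ℚₚ.<-trans α<-2 (ℚₚ.negative⁻¹ (-[1+ 1 ] / 1))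

  dual : ∀ {q α} → α < 0ℚ → ∃[ z ] (z * α ≡ q × α * (1ℚ + z - 1ℚ) ≡ q)
  dual {q} {α} α<0 with divide q (λ α≡0 → ℚₚ.<-irrefl α≡0 α<0)
  ... | z , zα≡q = z , zα≡q , trans (solve 2 (λ a z → a :* (con 1ℚ :+ z :- con 1ℚ) := z :* a) refl α z) zα≡q

  module _ {q α₁ α₂ α₃ : ℚ} (α₁∉ : ¬ (-[1+ 1 ] / 1 ≤ α₁ × α₁ ≤ 0ℚ)) (-2<α₂ : -[1+ 1 ] / 1 < α₂) (α₂<0 : α₂ < 0ℚ) where
    private
      W = Weights α₁ α₂ α₃
      z = proj₁ (dual {q} α₂<0)
      zα≡q = proj₁ (proj₂ (dual {q} α₂<0))
      α[x-1]≡q = proj₂ (proj₂ (dual {q} α₂<0))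

      0<-α₂ : 0ℚ < - α₂
      0<-α₂ = ℚₚ.neg-antimono-< α₂<0

    -- Here q / α₂ is positive, so x > 1 and s = 1. The reserve edge has weight `α₁`, and one
    -- further edge of this weight makes the starting value the positive square `(1 + α₁)²`.
    approximate-q<0 : q < 0ℚ → ∀ T →
      ∃[ C ] (∀ n τ → 1ℚ ≤ τ → τ ≤ T → Approximates q W 1ℚ C n τ)
    approximate-q<0 q<0 T = approximate 0<P₀ start T
      where
      0<z : 0ℚ < z
      0<z = ℚₚ.*-cancelʳ-<-nonNeg (- α₂) {{nonNegative (ℚₚ.<⇒≤ 0<-α₂)}}
        (subst₂ _<_ (sym (ℚₚ.*-zeroˡ (- α₂))) (trans (cong -_ (sym zα≡q)) (ℚₚ.neg-distribʳ-* z α₂)) (ℚₚ.neg-antimono-< q<0))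

      open Approximation {q} {α₂} {α₁} {α₁} {1ℚ} {1ℚ + z} {W} (inj₂ (inj₁ refl)) (inj₁ refl) (inj₁ refl)
        refl (≤-of 2ℚ (ℚₚ.nonNegative⁻¹ 2ℚ) refl) ℚₚ.≤-refl
        (subst (0ℚ <_) (cong -_ (sym (ℚₚ.*-identityˡ q))) (ℚₚ.neg-antimono-< q<0)) α[x-1]≡q
        (<-of z 0<z (ℚₚ.*-identityˡ (1ℚ + z))) (1<[1+α]² α₁ α₁∉)

      0<P₀ : 0ℚ < (1ℚ + α₁) * (1ℚ + α₁)
      0<P₀ = ℚₚ.<-trans 0<1 (1<[1+α]² α₁ α₁∉)

      start : M 3 ((1ℚ + α₁) * (1ℚ + α₁))
      start = edge-M {2} {1ℚ + α₁} (1ℚ , net-empty q q≢0 , refl)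

    -- Now -α₂ < 2 and q > 4 give q / α₂ < -2, so x < -1 and s = -1. The reserve edge has weight
    -- `α₃`: as 1 + α₃ is negative, it supplies the sign.
    approximate-q>5 : α₃ < -[1+ 0 ] / 1 → + 5 / 1 < q → ∀ T →
      ∃[ C ] (∀ n τ → 1ℚ ≤ τ → τ ≤ T → Approximates q W (- 1ℚ) C n τ)
    approximate-q>5 α₃<-1 5<q T = approximate 0<P₀ start T
      where
      1<-x : 1ℚ < - 1ℚ * (1ℚ + z)
      1<-x = <-of (- z - 2ℚ) (0<- 2<-z) (solve 1 (λ z → con (- 1ℚ) :* (con 1ℚ :+ z) := con 1ℚ :+ ((:- z) :- con 2ℚ)) refl z)
        where
        open ℚₚ.≤-Reasoning
        2<-z : 2ℚ < - z
        2<-z = ℚₚ.*-cancelʳ-<-nonNeg (- α₂) {{nonNegative (ℚₚ.<⇒≤ 0<-α₂)}} (begin-strict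
          2ℚ * - α₂      <⟨ ℚₚ.*-monoʳ-<-pos 2ℚ (ℚₚ.neg-antimono-< -2<α₂) ⟩
          + 4 / 1        <⟨ <-of 1ℚ 0<1 refl ⟩
          + 5 / 1        <⟨ 5<q ⟩
          q              ≡⟨ zα≡q ⟨
          z * α₂         ≡⟨ solve 2 (λ z a → z :* a := (:- z) :* (:- a)) refl z α₂ ⟩
          - z * - α₂ ∎)

      open Approximation {q} {α₂} {α₁} {α₃} { - 1ℚ} {1ℚ + z} {W} (inj₂ (inj₁ refl)) (inj₁ refl) (inj₂ (inj₂ refl))
        refl ℚₚ.≤-refl (≤-of 2ℚ (ℚₚ.nonNegative⁻¹ 2ℚ) refl)
        (subst (0ℚ <_) (solve 1 (λ q → q := :- (con (- 1ℚ) :* q)) refl q) (ℚₚ.<-trans (ℚₚ.positive⁻¹ (+ 5 / 1)) 5<q)) α[x-1]≡q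
        1<-x (1<[1+α]² α₁ α₁∉)

      0<P₀ : 0ℚ < - (1ℚ + α₃)
      0<P₀ = subst (0ℚ <_) (solve 1 (λ a → con (-[1+ 0 ] / 1) :- a := :- (con 1ℚ :+ a)) refl α₃) (0<- α₃<-1)

      start : M 2 (- (1ℚ + α₃))
      start = 1ℚ , net-empty q q≢0 , solve 1 (λ b → con 1ℚ :* b := con (- 1ℚ) :* (:- b)) refl (1ℚ + α₃)

  -- Written with the trailing factors 1 to which the terms of `f a` and of `a ^ 2 + nat 3 * a`
  -- unfold, so that facts about them apply to Cauchy sequences termwise. `cℚ` leaves out the
  -- summand q of c.
  fℚ cℚ : ℚ → ℚ
  fℚ a = a * (a * (a * 1ℚ)) + + 3 / 1 * (a * (a * 1ℚ))
  cℚ a = a * (a * 1ℚ) + + 3 / 1 * a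

  private
    3ℚ = + 3 / 1

  0≤² : ∀ p → 0ℚ ≤ p * p
  0≤² p with ℚₚ.≤-total 0ℚ p
  ... | inj₁ 0≤p = 0≤* 0≤p 0≤p
  ... | inj₂ p≤0 = subst (0ℚ ≤_) (solve 1 (λ p → (:- p) :* (:- p) := p :* p) refl p) (0≤* (ℚₚ.neg-antimono-≤ p≤0) (ℚₚ.neg-antimono-≤ p≤0))

  -- f a = a² (a + 3)
  f<0⇒a<-3 : ∀ a → fℚ a < 0ℚ → a + 3ℚ < 0ℚ
  f<0⇒a<-3 a fa<0 with 0ℚ ℚₚ.≤? a + 3ℚ
  ... | no ¬0≤ = ℚₚ.≰⇒> ¬0≤
  ... | yes 0≤ = contradiction (ℚₚ.<-≤-trans fa<0 (subst (0ℚ ≤_)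
    (solve 1 (λ a → a :* a :* (a :+ con 3ℚ) := a :* (a :* (a :* con 1ℚ)) :+ con 3ℚ :* (a :* (a :* con 1ℚ))) refl a)
    (0≤* (0≤² a) 0≤))) (ℚₚ.<-irrefl refl)

  -- With a = -(3 + y) and y ≥ 0, the quantity a² + 3a is (3 + y)y, and -q ≥ -f(a) = (3 + y)²y = 3(3
  -- + y)y + (3 + y)y².
  c-bounds-q<0 : ∀ {q} a → fℚ a < 0ℚ → q ≤ fℚ a → 0ℚ ≤ cℚ a × 3ℚ * cℚ a ≤ - q
  c-bounds-q<0 {q} a fa<0 q≤fa =
      subst (0ℚ ≤_) (solve 1 (λ a → (con 3ℚ :+ (:- (a :+ con 3ℚ))) :* (:- (a :+ con 3ℚ)) := a :* (a :* con 1ℚ) :+ con 3ℚ :* a) refl a)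
        (0≤* (0≤+ (ℚₚ.nonNegative⁻¹ 3ℚ) 0≤y) 0≤y)
    , ≤-of ((fℚ a - q) + (3ℚ + y) * (y * y)) (0≤+ (0≤- q≤fa) (0≤* (0≤+ (ℚₚ.nonNegative⁻¹ 3ℚ) 0≤y) (0≤² y)))
        (solve 2 (λ a q → :- q := con 3ℚ :* (a :* (a :* con 1ℚ) :+ con 3ℚ :* a) :+
           ((a :* (a :* (a :* con 1ℚ)) :+ con 3ℚ :* (a :* (a :* con 1ℚ)) :- q)
            :+ (con 3ℚ :+ (:- (a :+ con 3ℚ))) :* ((:- (a :+ con 3ℚ)) :* (:- (a :+ con 3ℚ))))) refl a q)
    where
    y = - (a + 3ℚ)
    0≤y : 0ℚ ≤ y
    0≤y = ℚₚ.neg-antimono-≤ (ℚₚ.<⇒≤ (f<0⇒a<-3 a fa<0))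

  -- f a - 4 = (a + 2)² (a - 1)
  4<f⇒1≤a : ∀ a → + 4 / 1 < fℚ a → 1ℚ ≤ a
  4<f⇒1≤a a 4<fa with 1ℚ ℚₚ.≤? a
  ... | yes 1≤a = 1≤a
  ... | no 1≰a = contradiction (ℚₚ.<-≤-trans 4<fa (≤-of ((a + 2ℚ) * (a + 2ℚ) * (1ℚ - a))
    (0≤* (0≤² (a + 2ℚ)) (0≤- (ℚₚ.<⇒≤ (ℚₚ.≰⇒> 1≰a))))
    (solve 1 (λ a → con (+ 4 / 1) := (a :* (a :* (a :* con 1ℚ)) :+ con 3ℚ :* (a :* (a :* con 1ℚ)))
      :+ (a :+ con 2ℚ) :* (a :+ con 2ℚ) :* (con 1ℚ :- a)) refl a))) (ℚₚ.<-irrefl refl)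

  c-bounds-q>5 : ∀ {b} a → + 4 / 1 < fℚ a → a ≤ b → + 4 / 1 ≤ cℚ a × cℚ a ≤ b * b + 3ℚ * b
  c-bounds-q>5 {b} a 4<fa a≤b =
      ≤-of ((a - 1ℚ) * (a - 1ℚ) + + 5 / 1 * (a - 1ℚ)) (0≤+ (0≤² (a - 1ℚ)) (0≤* (ℚₚ.nonNegative⁻¹ (+ 5 / 1)) (0≤- 1≤a)))
        (solve 1 (λ a → a :* (a :* con 1ℚ) :+ con 3ℚ :* a := con (+ 4 / 1) :+
           ((a :- con 1ℚ) :* (a :- con 1ℚ) :+ con (+ 5 / 1) :* (a :- con 1ℚ))) refl a)
    , ℚₚ.+-mono-≤ (subst (_≤ b * b) (cong (a *_) (sym (ℚₚ.*-identityʳ a))) (*-mono 0≤a a≤b 0≤a a≤b)) (*-monoˡ 3ℚ (ℚₚ.nonNegative⁻¹ 3ℚ) a≤b)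
    where
    1≤a = 4<f⇒1≤a a 4<fa
    0≤a = ℚₚ.≤-trans (ℚₚ.<⇒≤ 0<1) 1≤a

-- From rational estimates to Cauchy reals.

open import Defs
open Rationals
open Approximations
open Cases

Eventually : (ℕ → Set) → Set
Eventually P = ∃[ N ] (∀ n → N ℕ.≤ n → P n)

_⊓ᵉ_ : ∀ {P Q : ℕ → Set} → Eventually P → Eventually Q → Eventually (λ n → P n × Q n)
(M , p) ⊓ᵉ (N , q) = M ℕ.⊔ N , λ n M⊔N≤n →
  p n (ℕₚ.m⊔n≤o⇒m≤o M N M⊔N≤n) , q n (ℕₚ.m⊔n≤o⇒n≤o M N M⊔N≤n)

mapᵉ : ∀ {P Q : ℕ → Set} → (∀ n → P n → Q n) → Eventually P → Eventually Q
mapᵉ f (N , p) = N , λ n N≤n → f n (p n N≤n)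

≤-eventually : ∀ x y → Eventually (λ n → seq x n ℚ.≤ seq y n) → x ≤ y
≤-eventually x y (N , p) ε 0<ε = N , λ n N≤n → ℚₚ.≤-trans (p n N≤n) (≤-of ε (ℚₚ.<⇒≤ 0<ε) refl)

<-eventually : ∀ x y → x < y → Eventually (λ n → seq x n ℚ.≤ seq y n)
<-eventually x y (ε , 0<ε , N , p) = N , λ n N≤n → ℚₚ.≤-trans (≤-of ε (ℚₚ.<⇒≤ 0<ε) refl) (p n N≤n)

x≤∣x∣ : ∀ x → x ℚ.≤ ℚ.∣ x ∣
x≤∣x∣ x with ℚₚ.≤-total 0ℚ x
... | inj₁ 0≤x = ℚₚ.≤-reflexive (sym (ℚₚ.0≤p⇒∣p∣≡p 0≤x))
... | inj₂ x≤0 = ℚₚ.≤-trans x≤0 (ℚₚ.0≤∣p∣ x)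

∣x∣≤⇒x≤ : ∀ {x y} → ℚ.∣ x ∣ ℚ.≤ y → x ℚ.≤ y
∣x∣≤⇒x≤ {x} = ℚₚ.≤-trans (x≤∣x∣ x)

∣x∣≤⇒-y≤x : ∀ {x y} → ℚ.∣ x ∣ ℚ.≤ y → ℚ.- y ℚ.≤ x
∣x∣≤⇒-y≤x {x} {y} ∣x∣≤y = subst (ℚ.- y ℚ.≤_) (solve 1 (λ x → :- (:- x) := x) refl x)
  (ℚₚ.neg-antimono-≤ (∣x∣≤⇒x≤ {ℚ.- x} (subst (ℚ._≤ y) (sym (ℚₚ.∣-p∣≡∣p∣ x)) ∣x∣≤y)))

dyadic : ∀ N {r} → ½ ↑ N ℚ.≤ r → r ℚ.≤ 1ℚ → ∃[ k ] (½ ↑ suc k ℚ.≤ r × r ℚ.≤ ½ ↑ k)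
dyadic zero    {r} 1≤r r≤1 = 0 , ℚₚ.≤-trans {½ ↑ 1} {1ℚ} (≤-of ½ (ℚₚ.nonNegative⁻¹ ½) refl) 1≤r , r≤1
dyadic (suc N) {r} ½^≤r r≤1 = decide (½ ↑ N ℚₚ.≤? r)
  where
  decide : Dec (½ ↑ N ℚ.≤ r) → ∃[ k ] (½ ↑ suc k ℚ.≤ r × r ℚ.≤ ½ ↑ k)
  decide (yes ½^N≤r) = dyadic N ½^N≤r r≤1
  decide (no ½^N≰r)  = N , ½^≤r , ℚₚ.<⇒≤ (ℚₚ.≰⇒> ½^N≰r)

½^-small : ∀ {r} → 0ℚ ℚ.< r → ∃[ N ] ½ ↑ N ℚ.≤ r
½^-small {r} 0<r = N , subst₂ ℚ._≤_ (ℚₚ.*-identityˡ (½ ↑ N))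
  (trans (ℚₚ.*-assoc r (2ℚ ↑ N) (½ ↑ N)) (trans (cong (r ℚ.*_) (2↑*½↑ N)) (ℚₚ.*-identityʳ r)))
  (*-monoʳ (½ ↑ N) (ℚₚ.<⇒≤ (0<½↑ N)) (proj₂ unbounded))
  where
  unbounded = power-unbounded {2ℚ} {r} 1ℚ (<-of 1ℚ 0<1 refl) 0<r
  N = proj₁ unbounded

-- Comparing the real `ρ` itself with powers of two is not decidable, so a single late term `c` is
-- compared instead: all later terms lie between c/2 and r = 3c/2, and k is found with r between
-- `½ ↑ suc k` and `½ ↑ k`. The condition `ρ < ½` ensures r ≤ 1, where the search starts.
dyadic-window : ∀ ρ → nat 0 < ρ → ρ < ⟦ ½ ⟧ →
  ∃[ k ] Eventually (λ n → ½ ↑ (3 ℕ.+ k) ℚ.≤ seq ρ n × seq ρ n ℚ.≤ ½ ↑ k)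
dyadic-window ρ (ε , 0<ε , N₁ , ε≤) (ε′ , 0<ε′ , N₂ , ≤½) = window (cauchy ρ (½ ℚ.* ε) (0<* (ℚₚ.positive⁻¹ ½) 0<ε))
  where
  0≤½ = ℚₚ.nonNegative⁻¹ ½
  window : ∃[ N ] (∀ m n → N ℕ.≤ m → N ℕ.≤ n → ℚ.∣ seq ρ m ℚ.- seq ρ n ∣ ℚ.≤ ½ ℚ.* ε) →
    ∃[ k ] Eventually (λ n → ½ ↑ (3 ℕ.+ k) ℚ.≤ seq ρ n × seq ρ n ℚ.≤ ½ ↑ k)
  window (N₃ , near) = k , N , λ n N≤n →
    let ∣∣≤ = ℚₚ.≤-trans (near n N (≤₃ N≤n) (≤₃ ℕₚ.≤-refl)) (*-monoˡ ½ 0≤½ ε≤c) in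
      ℚₚ.≤-trans lower (lower′ (seq ρ n) ∣∣≤)
    , ℚₚ.≤-trans (upper′ (seq ρ n) ∣∣≤) r≤½^k
    where
    N = N₁ ℕ.⊔ N₂ ℕ.⊔ N₃
    ≤₁ : ∀ {n} → N ℕ.≤ n → N₁ ℕ.≤ n
    ≤₁ N≤n = ℕₚ.m⊔n≤o⇒m≤o N₁ N₂ (ℕₚ.m⊔n≤o⇒m≤o (N₁ ℕ.⊔ N₂) N₃ N≤n)
    ≤₂ : ∀ {n} → N ℕ.≤ n → N₂ ℕ.≤ n
    ≤₂ N≤n = ℕₚ.m⊔n≤o⇒n≤o N₁ N₂ (ℕₚ.m⊔n≤o⇒m≤o (N₁ ℕ.⊔ N₂) N₃ N≤n)
    ≤₃ : ∀ {n} → N ℕ.≤ n → N₃ ℕ.≤ n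
    ≤₃ N≤n = ℕₚ.m⊔n≤o⇒n≤o (N₁ ℕ.⊔ N₂) N₃ N≤n
    c = seq ρ N
    r = c ℚ.+ ½ ℚ.* c
    ε≤c : ε ℚ.≤ c
    ε≤c = subst (ℚ._≤ c) (ℚₚ.+-identityˡ ε) (ε≤ N (≤₁ ℕₚ.≤-refl))
    c≤½ : c ℚ.≤ ½
    c≤½ = ℚₚ.≤-trans (≤-of ε′ (ℚₚ.<⇒≤ 0<ε′) refl) (≤½ N (≤₂ ℕₚ.≤-refl))
    0<c : 0ℚ ℚ.< c
    0<c = ℚₚ.<-≤-trans 0<ε ε≤c
    0<r : 0ℚ ℚ.< r
    0<r = 0<+ 0<c (0≤* 0≤½ (ℚₚ.<⇒≤ 0<c))
    r≤1 : r ℚ.≤ 1ℚ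
    r≤1 = ℚₚ.≤-trans (ℚₚ.+-mono-≤ c≤½ (*-monoˡ ½ 0≤½ c≤½)) (≤-of (½ ℚ.* ½) (ℚₚ.nonNegative⁻¹ (½ ℚ.* ½)) refl)
    found = dyadic (proj₁ (½^-small 0<r)) (proj₂ (½^-small 0<r)) r≤1
    k = proj₁ found
    r≤½^k = proj₂ (proj₂ found)
    -- c/2 is r/3, hence at least r/4; this is where the 3 in the exponent comes from.
    lower : ½ ↑ (3 ℕ.+ k) ℚ.≤ ½ ℚ.* c
    lower = ℚₚ.≤-trans (*-monoˡ ½ 0≤½ (*-monoˡ ½ 0≤½ (proj₁ (proj₂ found))))
      (≤-of (+ 1 / 8 ℚ.* c) (0≤* (ℚₚ.nonNegative⁻¹ (+ 1 / 8)) (ℚₚ.<⇒≤ 0<c))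
        (solve 1 (λ c → con ½ :* c := con ½ :* (con ½ :* (c :+ con ½ :* c)) :+ con (+ 1 / 8) :* c) refl c))
    upper′ : ∀ x → ℚ.∣ x ℚ.- c ∣ ℚ.≤ ½ ℚ.* c → x ℚ.≤ r
    upper′ x h = subst (ℚ._≤ r) (solve 2 (λ c x → c :+ (x :- c) := x) refl c x) (ℚₚ.+-monoʳ-≤ c (∣x∣≤⇒x≤ h))
    lower′ : ∀ x → ℚ.∣ x ℚ.- c ∣ ℚ.≤ ½ ℚ.* c → ½ ℚ.* c ℚ.≤ x
    lower′ x h = subst₂ ℚ._≤_ (solve 1 (λ c → c :+ (:- (con ½ :* c)) := con ½ :* c) refl c)
      (solve 2 (λ c x → c :+ (x :- c) := x) refl c x) (ℚₚ.+-monoʳ-≤ c (∣x∣≤⇒-y≤x h))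

seq-2^ : ∀ k n → seq (nat 2 ^ k) n ≡ 2ℚ ↑ k
seq-2^ zero    n = refl
seq-2^ (suc k) n = cong (2ℚ ℚ.*_) (seq-2^ k n)

-- The cut of `L` at the integer k asks whether 2^k ρ ≤ 1. The resulting inequality of reals is
-- evaluated with tolerance 1, which explains the summand 1.
log-bound : ∀ {ρ L k} → IsLog₂Recip ρ L → Eventually (λ n → seq ρ n ℚ.≤ ½ ↑ k) →
  Eventually (λ n → ι k ℚ.≤ seq L n ℚ.+ 1ℚ)
log-bound {ρ} {L} {k} log ρ≤ = mapᵉ simplify (Equivalence.to (log k 0 1) 2^kρ≤1 1ℚ 0<1)
  where
  2^kρ≤1 : nat 2 ^ k * ρ ^ 1 ≤ nat 2 ^ 0
  2^kρ≤1 = ≤-eventually (nat 2 ^ k * ρ ^ 1) (nat 2 ^ 0) (mapᵉ (λ n ρₙ≤ →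
    subst₂ ℚ._≤_ (cong₂ ℚ._*_ (sym (seq-2^ k n)) (sym (ℚₚ.*-identityʳ (seq ρ n)))) (2↑*½↑ k)
      (*-monoˡ (2ℚ ↑ k) (0≤2^ k) ρₙ≤)) ρ≤)
    where
    0≤2^ : ∀ k → 0ℚ ℚ.≤ 2ℚ ↑ k
    0≤2^ zero    = ℚₚ.<⇒≤ 0<1
    0≤2^ (suc k) = 0≤* (ℚₚ.nonNegative⁻¹ 2ℚ) (0≤2^ k)
  simplify : ∀ n → (+ k / 1) ℚ.- 0ℚ ℚ.≤ 1ℚ ℚ.* seq L n ℚ.+ 1ℚ → ι k ℚ.≤ seq L n ℚ.+ 1ℚ
  simplify n = subst₂ ℚ._≤_ (trans (ℚₚ.+-identityʳ (+ k / 1)) (sym (ι≡/1 k))) (cong (ℚ._+ 1ℚ) (ℚₚ.*-identityˡ (seq L n)))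

-- C (L + 6)²
sizePoly : ℕ → List ℝ
sizePoly C = ⟦ ι C ℚ.* (+ 36 / 1) ⟧ ∷ ⟦ ι C ℚ.* (+ 12 / 1) ⟧ ∷ ⟦ ι C ⟧ ∷ []

size≤sizePoly : ∀ {C k N} L → N ℕ.≤ C ℕ.* (suc (4 ℕ.+ k) ℕ.* suc (4 ℕ.+ k)) →
  Eventually (λ n → ι k ℚ.≤ seq L n ℚ.+ 1ℚ) → nat N ≤ evalPoly (sizePoly C) L
size≤sizePoly {C} {k} {N} L N≤ k≤ = ≤-eventually (nat N) (evalPoly (sizePoly C) L) (mapᵉ bound k≤)
  where
  open ℚₚ.≤-Reasoning
  bound : ∀ n → ι k ℚ.≤ seq L n ℚ.+ 1ℚ → seq (nat N) n ℚ.≤ seq (evalPoly (sizePoly C) L) n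
  bound n k≤L+1 = begin
    + N / 1                               ≡⟨ ι≡/1 N ⟨
    ι N                                   ≤⟨ ι-mono N≤ ⟩
    ι (C ℕ.* (j ℕ.* j))                   ≡⟨ trans (ι-* C (j ℕ.* j)) (cong (ι C ℚ.*_) (ι-* j j)) ⟩
    ι C ℚ.* (ι j ℚ.* ι j)                 ≤⟨ *-monoˡ (ι C) (0≤ι C) (*-mono (0≤ι j) j≤ (0≤ι j) j≤) ⟩
    ι C ℚ.* ((l ℚ.+ + 6 / 1) ℚ.* (l ℚ.+ + 6 / 1))
      ≡⟨ solve 2 (λ c l → c :* ((l :+ con (+ 6 / 1)) :* (l :+ con (+ 6 / 1)))
           := c :* con (+ 36 / 1) :+ l :* (c :* con (+ 12 / 1) :+ l :* (c :+ l :* con 0ℚ))) refl (ι C) l ⟩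
    seq (evalPoly (sizePoly C) L) n ∎
    where
    l = seq L n
    j = suc (4 ℕ.+ k)
    -- 5 + k is at most 5 + (L + 1): the origin of the 6 in the size polynomial.
    j≤ : ι j ℚ.≤ l ℚ.+ + 6 / 1
    j≤ = subst₂ ℚ._≤_ (sym (ι-+ 5 k)) (solve 1 (λ l → con (+ 5 / 1) :+ (l :+ con 1ℚ) := l :+ con (+ 6 / 1)) refl l)
      (ℚₚ.+-monoʳ-≤ (+ 5 / 1) k≤L+1)

module Realise {q s T : ℚ} {W : ℚ → Set} {C : ℕ} (s≡±1 : s ≡ 1ℚ ⊎ s ≡ ℚ.- 1ℚ)
  (approximation : ∀ n τ → 1ℚ ℚ.≤ τ → τ ℚ.≤ T → Approximates q W s C n τ) (a : ℝ) where

  c : ℝ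
  c = a ^ 2 + nat 3 * a + ⟦ q ⟧

  τ : ℕ → ℚ
  τ n = s ℚ.* (1ℚ ℚ.- seq c n)

  -- The bounds for the absolute value of b depend on the sign of q. They are derived later from the
  -- recorded index `n`, at which `R` holds, and from the distance between `P` and `τ n`.
  Realised : (ℕ → Set) → ℝ → Set
  Realised R ρ̂ =
    Σ[ Υ ∈ PlanarNetwork ] Σ[ ŵ ∈ (Fin (PlanarNetwork.#E Υ) → ℚ) ] Σ[ b ∈ ℚ ]
    ((∀ e → W (ŵ e)) × Implements q Υ ŵ b ×
     (∃[ n ] ∃[ P ] (R n × b ≡ s ℚ.* P ℚ.- 1ℚ × τ n ℚ.≤ P × P ℚ.≤ τ n ℚ.+ 1ℚ)) ×
     - ρ̂ ≤ ⟦ b ⟧ + c × ⟦ b ⟧ + c ≤ ρ̂ ×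
     (∀ L → IsLog₂Recip ρ̂ L → nat (size (PlanarNetwork.graph Υ)) ≤ evalPoly (sizePoly C) L))

  private
    ½^≤1 : ∀ n → ½ ↑ n ℚ.≤ 1ℚ
    ½^≤1 zero    = ℚₚ.≤-refl
    ½^≤1 (suc n) = ℚₚ.≤-trans (*-monoˡ ½ (ℚₚ.nonNegative⁻¹ ½) (½^≤1 n)) (≤-of ½ (ℚₚ.nonNegative⁻¹ ½) refl)

    ±-bounds : ∀ {s} → s ≡ 1ℚ ⊎ s ≡ ℚ.- 1ℚ → ∀ {δ η} → 0ℚ ℚ.≤ δ → δ ℚ.≤ η →
      ℚ.- η ℚ.≤ s ℚ.* δ × s ℚ.* δ ℚ.≤ η
    ±-bounds (inj₁ refl) {δ} {η} 0≤δ δ≤η = subst (λ x → ℚ.- η ℚ.≤ x × x ℚ.≤ η) (sym (ℚₚ.*-identityˡ δ))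
      (ℚₚ.≤-trans (ℚₚ.neg-antimono-≤ (ℚₚ.≤-trans 0≤δ δ≤η)) 0≤δ , δ≤η)
    ±-bounds (inj₂ refl) {δ} {η} 0≤δ δ≤η = subst (λ x → ℚ.- η ℚ.≤ x × x ℚ.≤ η)
      (solve 1 (λ δ → :- δ := con (ℚ.- 1ℚ) :* δ) refl δ)
      (ℚₚ.neg-antimono-≤ δ≤η , ℚₚ.≤-trans (ℚₚ.neg-antimono-≤ 0≤δ) (ℚₚ.≤-trans 0≤δ δ≤η))

    ±-square : ∀ {s} → s ≡ 1ℚ ⊎ s ≡ ℚ.- 1ℚ → s ℚ.* s ≡ 1ℚ
    ±-square (inj₁ refl) = refl
    ±-square (inj₂ refl) = refl

    -- With y the term of c that defines the target and x a later one, b + x splits into the error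
    -- of the approximation and the oscillation of the sequence; s² = 1 removes the sign.
    split-error : ∀ P x y → s ℚ.* P ℚ.- 1ℚ ℚ.+ x ≡ s ℚ.* (P ℚ.- s ℚ.* (1ℚ ℚ.- y)) ℚ.+ (x ℚ.- y)
    split-error P x y = sym (begin
      s ℚ.* (P ℚ.- s ℚ.* (1ℚ ℚ.- y)) ℚ.+ (x ℚ.- y)
        ≡⟨ solve 4 (λ s P x y → s :* (P :- s :* (con 1ℚ :- y)) :+ (x :- y)
             := s :* P :- s :* s :* (con 1ℚ :- y) :+ (x :- y)) refl s P x y ⟩
      s ℚ.* P ℚ.- s ℚ.* s ℚ.* (1ℚ ℚ.- y) ℚ.+ (x ℚ.- y)
        ≡⟨ cong (λ t → s ℚ.* P ℚ.- t ℚ.* (1ℚ ℚ.- y) ℚ.+ (x ℚ.- y)) (±-square s≡±1) ⟩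
      s ℚ.* P ℚ.- 1ℚ ℚ.* (1ℚ ℚ.- y) ℚ.+ (x ℚ.- y)
        ≡⟨ solve 3 (λ p x y → p :- con 1ℚ :* (con 1ℚ :- y) :+ (x :- y) := p :- con 1ℚ :+ x) refl (s ℚ.* P) x y ⟩
      s ℚ.* P ℚ.- 1ℚ ℚ.+ x ∎)
      where open ≡-Reasoning

  realise : ∀ {R : ℕ → Set} → Eventually R →
    (∀ n → R n → 1ℚ ℚ.≤ τ n) → (∀ n → R n → τ n ℚ.≤ T) →
    ∀ ρ̂ → nat 0 < ρ̂ → ρ̂ < ⟦ ½ ⟧ → Realised R ρ̂
  realise {R} (N₁ , good) 1≤τ τ≤T ρ̂ 0<ρ̂ ρ̂<½ =
    from-window (dyadic-window ρ̂ 0<ρ̂ ρ̂<½)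
    where
    from-window : ∃[ k ] Eventually (λ n → ½ ↑ (3 ℕ.+ k) ℚ.≤ seq ρ̂ n × seq ρ̂ n ℚ.≤ ½ ↑ k) → Realised R ρ̂
    from-window (k , window) = from-cauchy (cauchy c (½ ↑ (4 ℕ.+ k)) (0<½↑ (4 ℕ.+ k)))
      where
      -- Both errors, that of the approximation and that of the Cauchy sequence, are kept below
      -- `η₁`; their sum stays below `η₂`, a lower bound for the late terms of ρ̂.
      η₁ = ½ ↑ (4 ℕ.+ k)
      η₂ = ½ ↑ (3 ℕ.+ k)
      η₁+η₁≡η₂ : η₁ ℚ.+ η₁ ≡ η₂
      η₁+η₁≡η₂ = solve 1 (λ x → con ½ :* x :+ con ½ :* x := x) refl η₂

      from-cauchy : ∃[ N ] (∀ m n → N ℕ.≤ m → N ℕ.≤ n → ℚ.∣ seq c m ℚ.- seq c n ∣ ℚ.≤ η₁) → Realised R ρ̂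
      from-cauchy (N₂ , near) = from-approximation (approximation (4 ℕ.+ k) (τ N) (1≤τ N goodN) (τ≤T N goodN))
        where
        N = N₁ ℕ.⊔ N₂
        goodN : R N
        goodN = good N (ℕₚ.m≤m⊔n N₁ N₂)

        from-approximation : Approximates q W s C (4 ℕ.+ k) (τ N) → Realised R ρ̂
        from-approximation (Υ , ŵ , P , ŵ∈W , implements , τ≤P , P≤τ+ , size≤) =
          Υ , ŵ , s ℚ.* P ℚ.- 1ℚ , ŵ∈W , implements
          , (N , P , goodN , refl , τ≤P , ℚₚ.≤-trans P≤τ+ (ℚₚ.+-monoʳ-≤ (τ N) (½^≤1 (4 ℕ.+ k))))
          , ≤-eventually (- ρ̂) (⟦ s ℚ.* P ℚ.- 1ℚ ⟧ + c)
              (mapᵉ (λ n h → ℚₚ.≤-trans (ℚₚ.neg-antimono-≤ (proj₁ (proj₁ h))) (proj₁ (proj₂ h))) both)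
          , ≤-eventually (⟦ s ℚ.* P ℚ.- 1ℚ ⟧ + c) ρ̂
              (mapᵉ (λ n h → ℚₚ.≤-trans (proj₂ (proj₂ h)) (proj₁ (proj₁ h))) both)
          , λ L log → size≤sizePoly {C} {k} L size≤ (log-bound {ρ̂} {L} {k} log (mapᵉ (λ n → proj₂) window))
          where
          Close : ℕ → Set
          Close n = ℚ.- η₂ ℚ.≤ s ℚ.* P ℚ.- 1ℚ ℚ.+ seq c n × s ℚ.* P ℚ.- 1ℚ ℚ.+ seq c n ℚ.≤ η₂

          δ-bounds : ℚ.- η₁ ℚ.≤ s ℚ.* (P ℚ.- τ N) × s ℚ.* (P ℚ.- τ N) ℚ.≤ η₁
          δ-bounds = ±-bounds s≡±1 (0≤- τ≤P) (subst (P ℚ.- τ N ℚ.≤_)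
            (solve 2 (λ t e → t :+ e :- t := e) refl (τ N) η₁) (ℚₚ.+-monoˡ-≤ (ℚ.- τ N) P≤τ+))

          close : ∀ n → N₂ ℕ.≤ n → Close n
          close n N₂≤n = subst (λ x → ℚ.- η₂ ℚ.≤ x × x ℚ.≤ η₂) (sym (split-error P (seq c n) (seq c N)))
            ( subst (ℚ._≤ s ℚ.* (P ℚ.- τ N) ℚ.+ (seq c n ℚ.- seq c N))
                (trans (sym (ℚₚ.neg-distrib-+ η₁ η₁)) (cong ℚ.-_ η₁+η₁≡η₂))
                (ℚₚ.+-mono-≤ (proj₁ δ-bounds) (∣x∣≤⇒-y≤x (near n N N₂≤n (ℕₚ.m≤n⊔m N₁ N₂))))
            , subst (s ℚ.* (P ℚ.- τ N) ℚ.+ (seq c n ℚ.- seq c N) ℚ.≤_) η₁+η₁≡η₂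
                (ℚₚ.+-mono-≤ (proj₂ δ-bounds) (∣x∣≤⇒x≤ (near n N N₂≤n (ℕₚ.m≤n⊔m N₁ N₂)))))

          both : Eventually (λ n → (½ ↑ (3 ℕ.+ k) ℚ.≤ seq ρ̂ n × seq ρ̂ n ℚ.≤ ½ ↑ k) × Close n)
          both = window ⊓ᵉ (N₂ , close)

-- The bounds for b, and the theorem for each sign of q.

Conclusion : (q α₁ α₂ α₃ : ℚ) → List ℝ → Constants q → ℝ → ℝ → Set
Conclusion q α₁ α₂ α₃ p k a ρ̂ =
  Σ[ Υ ∈ PlanarNetwork ] Σ[ ŵ ∈ (Fin (PlanarNetwork.#E Υ) → ℚ) ] Σ[ b ∈ ℚ ]
  ((∀ e → ŵ e ≡ α₁ ⊎ ŵ e ≡ α₂ ⊎ ŵ e ≡ α₃) ×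
   Implements q Υ ŵ b ×
   B⁻ k ≤ ∣ ⟦ b ⟧ ∣ × ∣ ⟦ b ⟧ ∣ ≤ B⁺ k ×
   - ρ̂ ≤ ⟦ b ⟧ + c × ⟦ b ⟧ + c ≤ ρ̂ ×
   (∀ L → IsLog₂Recip ρ̂ L → nat (size (PlanarNetwork.graph Υ)) ≤ evalPoly p L))
  where c = a ^ 2 + nat 3 * a + ⟦ q ⟧

Claim : (q α₁ α₂ α₃ : ℚ) → ℝ → ℝ → List ℝ → Constants q → Set
Claim q α₁ α₂ α₃ ρ₀ ρ̂₀ p k = (ρ a : ℝ) →
  nat 0 < ρ → ρ < ρ₀ →
  A⁻ k ≤ ∣ a ∣ → ∣ a ∣ ≤ A⁺ k →
  ⟦ q ⟧ + ρ < f a → f a ≤ ⟦ q ⟧ + nat 2 * ρ →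
  η k ≤ ∣ f a ∣ →
  (ρ̂ : ℝ) → nat 0 < ρ̂ → ρ̂ < ρ̂₀ → Conclusion q α₁ α₂ α₃ p k a ρ̂

module NegativeCase {q α₁ α₂ α₃ : ℚ} (q<0 : q ℚ.< 0ℚ)
  (α₁∉ : ¬ (-[1+ 1 ] / 1 ℚ.≤ α₁ × α₁ ℚ.≤ 0ℚ)) (-2<α₂ : -[1+ 1 ] / 1 ℚ.< α₂) (α₂<0 : α₂ ℚ.< 0ℚ) where

  approximation = approximate-q<0 {q} {α₁} {α₂} {α₃} α₁∉ -2<α₂ α₂<0 q<0 (1ℚ ℚ.- q)

  C : ℕ
  C = proj₁ approximation

  -- A quarter of |q| keeps `f a` negative termwise: 2ρ is at most -q/2, the tolerance in the real
  -- inequality is taken as -q/4, and q - q/2 - q/4 = q/4 < 0.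
  ρ₀ : ℝ
  ρ₀ = ⟦ + 1 / 4 ℚ.* ℚ.- q ⟧

  0<-q : 0ℚ ℚ.< ℚ.- q
  0<-q = ℚₚ.neg-antimono-< q<0

  0≤-q : 0ℚ ℚ.≤ ℚ.- q
  0≤-q = ℚₚ.<⇒≤ 0<-q

  0<-q/4 : 0ℚ ℚ.< + 1 / 4 ℚ.* ℚ.- q
  0<-q/4 = 0<* (ℚₚ.positive⁻¹ (+ 1 / 4)) 0<-q

  module Bounds (ρ a : ℝ) (0<ρ : nat 0 < ρ) (ρ<ρ₀ : ρ < ρ₀)
    (q+ρ<fa : ⟦ q ⟧ + ρ < f a) (fa≤q+2ρ : f a ≤ ⟦ q ⟧ + nat 2 * ρ) where

    open Realise {q} {1ℚ} {1ℚ ℚ.- q} {Weights α₁ α₂ α₃} {C} (inj₁ refl) (proj₂ approximation) a public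

    R : ℕ → Set
    R n = 0ℚ ℚ.≤ cℚ (seq a n) × (+ 3 / 1) ℚ.* cℚ (seq a n) ℚ.≤ ℚ.- q

    R-eventually : Eventually R
    R-eventually = mapᵉ bounds
      (((<-eventually (nat 0) ρ 0<ρ) ⊓ᵉ (<-eventually ρ ρ₀ ρ<ρ₀)) ⊓ᵉ
       ((<-eventually (⟦ q ⟧ + ρ) (f a) q+ρ<fa) ⊓ᵉ fa≤q+2ρ (+ 1 / 4 ℚ.* ℚ.- q) 0<-q/4))
      where
      bounds : ∀ n →
        (0ℚ ℚ.≤ seq ρ n × seq ρ n ℚ.≤ + 1 / 4 ℚ.* ℚ.- q) ×
        (q ℚ.+ seq ρ n ℚ.≤ fℚ (seq a n) × fℚ (seq a n) ℚ.≤ q ℚ.+ 2ℚ ℚ.* seq ρ n ℚ.+ + 1 / 4 ℚ.* ℚ.- q) → R n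
      bounds n ((0≤ρ , ρ≤) , (q+ρ≤f , f≤)) = c-bounds-q<0 (seq a n)
        (ℚₚ.≤-<-trans f≤ (ℚₚ.≤-<-trans
          (ℚₚ.+-monoˡ-≤ (+ 1 / 4 ℚ.* ℚ.- q) (ℚₚ.+-monoʳ-≤ q (*-monoˡ 2ℚ (ℚₚ.nonNegative⁻¹ 2ℚ) ρ≤)))
          (<-of (+ 1 / 4 ℚ.* ℚ.- q) 0<-q/4 (solve 1 (λ q → con 0ℚ :=
             q :+ con 2ℚ :* (con (+ 1 / 4) :* (:- q)) :+ con (+ 1 / 4) :* (:- q) :+ con (+ 1 / 4) :* (:- q)) refl q))))
        (ℚₚ.≤-trans (≤-of (seq ρ n) 0≤ρ refl) q+ρ≤f)

    3*-cancel : ∀ {x y} → (+ 3 / 1) ℚ.* x ℚ.≤ (+ 3 / 1) ℚ.* y → x ℚ.≤ y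
    3*-cancel = ℚₚ.*-cancelˡ-≤-pos (+ 3 / 1)

    1≤τ : ∀ n → R n → 1ℚ ℚ.≤ τ n
    1≤τ n (_ , 3c≤-q) = 3*-cancel (≤-of ((ℚ.- q ℚ.- (+ 3 / 1) ℚ.* x) ℚ.+ 2ℚ ℚ.* ℚ.- q)
      (0≤+ (0≤- 3c≤-q) (0≤* (ℚₚ.nonNegative⁻¹ 2ℚ) 0≤-q))
      (solve 2 (λ x q → con (+ 3 / 1) :* (con 1ℚ :* (con 1ℚ :- (x :+ q))) :=
         con (+ 3 / 1) :* con 1ℚ :+ (((:- q) :- con (+ 3 / 1) :* x) :+ con 2ℚ :* (:- q))) refl x q))
      where x = cℚ (seq a n)

    τ≤ : ∀ n → R n → τ n ℚ.≤ 1ℚ ℚ.- q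
    τ≤ n (0≤c , _) = ≤-of (cℚ (seq a n)) 0≤c (solve 2 (λ x q →
      con 1ℚ :- q := con 1ℚ :* (con 1ℚ :- (x :+ q)) :+ x) refl (cℚ (seq a n)) q)

    module _ {b : ℚ} (n : ℕ) (P : ℚ) (r : R n) (b≡ : b ≡ 1ℚ ℚ.* P ℚ.- 1ℚ) (τ≤P : τ n ℚ.≤ P) (P≤τ+1 : P ℚ.≤ τ n ℚ.+ 1ℚ) where
      private
        x = cℚ (seq a n)

        ∣q∣≡-q : ℚ.∣ q ∣ ≡ ℚ.- q
        ∣q∣≡-q = trans (sym (ℚₚ.∣-p∣≡∣p∣ q)) (ℚₚ.0≤p⇒∣p∣≡p 0≤-q)

        -- Since 3(a² + 3a) ≤ -q, one has b ≥ τ - 1 = -q - (a² + 3a) ≥ -2q/3.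
        -q/3≤b : + 1 / 3 ℚ.* ℚ.- q ℚ.≤ b
        -q/3≤b = 3*-cancel (≤-of ((+ 3 / 1) ℚ.* (P ℚ.- τ n) ℚ.+ ((ℚ.- q ℚ.- (+ 3 / 1) ℚ.* x) ℚ.+ ℚ.- q))
          (0≤+ (0≤* (ℚₚ.nonNegative⁻¹ (+ 3 / 1)) (0≤- τ≤P)) (0≤+ (0≤- (proj₂ r)) 0≤-q))
          (trans (cong ((+ 3 / 1) ℚ.*_) b≡) (solve 3 (λ P x q → con (+ 3 / 1) :* (con 1ℚ :* P :- con 1ℚ)
             := con (+ 3 / 1) :* (con (+ 1 / 3) :* (:- q)) :+ (con (+ 3 / 1) :* (P :- con 1ℚ :* (con 1ℚ :- (x :+ q)))
                :+ (((:- q) :- con (+ 3 / 1) :* x) :+ (:- q)))) refl P x q)))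

        b≤ : b ℚ.≤ + 4 / 3 ℚ.* ℚ.- q ℚ.+ 2ℚ
        b≤ = ≤-of ((τ n ℚ.+ 1ℚ ℚ.- P) ℚ.+ (x ℚ.+ (+ 1 / 3 ℚ.* ℚ.- q ℚ.+ 1ℚ)))
          (0≤+ (0≤- P≤τ+1) (0≤+ (proj₁ r) (0≤+ (0≤* (ℚₚ.nonNegative⁻¹ (+ 1 / 3)) 0≤-q) (ℚₚ.<⇒≤ 0<1))))
          (trans (solve 3 (λ P x q → con (+ 4 / 3) :* (:- q) :+ con 2ℚ := (con 1ℚ :* P :- con 1ℚ)
             :+ (((con 1ℚ :* (con 1ℚ :- (x :+ q))) :+ con 1ℚ :- P) :+ (x :+ (con (+ 1 / 3) :* (:- q) :+ con 1ℚ)))) refl P x q)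
            (cong (ℚ._+ ((τ n ℚ.+ 1ℚ ℚ.- P) ℚ.+ (x ℚ.+ (+ 1 / 3 ℚ.* ℚ.- q ℚ.+ 1ℚ)))) (sym b≡)))

      b-lower : ⟦ + 1 / 3 ⟧ * ∣ ⟦ q ⟧ ∣ ≤ ∣ ⟦ b ⟧ ∣
      b-lower = ≤-eventually (⟦ + 1 / 3 ⟧ * ∣ ⟦ q ⟧ ∣) ∣ ⟦ b ⟧ ∣ (0 , λ _ _ →
        ℚₚ.≤-trans (subst (λ p → + 1 / 3 ℚ.* p ℚ.≤ b) (sym ∣q∣≡-q) -q/3≤b) (x≤∣x∣ b))

      b-upper : ∣ ⟦ b ⟧ ∣ ≤ ⟦ + 4 / 3 ⟧ * ∣ ⟦ q ⟧ ∣ + nat 2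
      b-upper = ≤-eventually ∣ ⟦ b ⟧ ∣ (⟦ + 4 / 3 ⟧ * ∣ ⟦ q ⟧ ∣ + nat 2) (0 , λ _ _ →
        subst₂ (λ p r → p ℚ.≤ + 4 / 3 ℚ.* r ℚ.+ 2ℚ)
          (sym (ℚₚ.0≤p⇒∣p∣≡p (ℚₚ.≤-trans (0≤* (ℚₚ.nonNegative⁻¹ (+ 1 / 3)) 0≤-q) -q/3≤b))) (sym ∣q∣≡-q) b≤)

  claim : ∀ k → Claim q α₁ α₂ α₃ ρ₀ ⟦ ½ ⟧ (sizePoly C) k
  claim (above5 5<q) = contradiction (ℚₚ.<-trans 5<q q<0) (ℚₚ.<-asym (ℚₚ.positive⁻¹ (+ 5 / 1)))
  claim k@(below0 _ _ _ _ _ _ _) ρ a 0<ρ ρ<ρ₀ _ _ q+ρ<fa fa≤q+2ρ _ ρ̂ 0<ρ̂ ρ̂<½ =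
    conclude (realise R-eventually 1≤τ τ≤ ρ̂ 0<ρ̂ ρ̂<½)
    where
    open Bounds ρ a 0<ρ ρ<ρ₀ q+ρ<fa fa≤q+2ρ
    conclude : Realised R ρ̂ → Conclusion q α₁ α₂ α₃ (sizePoly C) k a ρ̂
    conclude (Υ , ŵ , b , ŵ∈W , implements , (n , P , r , b≡ , τ≤P , P≤τ+1) , rest) =
      Υ , ŵ , b , ŵ∈W , implements , b-lower n P r b≡ τ≤P P≤τ+1 , b-upper n P r b≡ τ≤P P≤τ+1 , rest

module LargeCase {q α₁ α₂ α₃ : ℚ} (5<q : + 5 / 1 ℚ.< q)
  (α₁∉ : ¬ (-[1+ 1 ] / 1 ℚ.≤ α₁ × α₁ ℚ.≤ 0ℚ)) (-2<α₂ : -[1+ 1 ] / 1 ℚ.< α₂) (α₂<0 : α₂ ℚ.< 0ℚ)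
  (α₃<-1 : α₃ ℚ.< -[1+ 0 ] / 1) where

  -- The real inequality |a| ≤ q bounds the terms of a only up to a tolerance, taken as 1; hence q +
  -- 1 is inserted in a² + 3a + q.
  T : ℚ
  T = (q ℚ.+ 1ℚ) ℚ.* (q ℚ.+ 1ℚ) ℚ.+ (+ 3 / 1) ℚ.* (q ℚ.+ 1ℚ) ℚ.+ q

  approximation = approximate-q>5 {q} {α₁} {α₂} {α₃} α₁∉ -2<α₂ α₂<0 α₃<-1 5<q T

  C : ℕ
  C = proj₁ approximation

  0≤q-5 : 0ℚ ℚ.≤ q ℚ.- + 5 / 1
  0≤q-5 = ℚₚ.<⇒≤ (0<- 5<q)

  module Bounds (ρ a : ℝ) (0<ρ : nat 0 < ρ) (∣a∣≤q : ∣ a ∣ ≤ ⟦ q ⟧) (q+ρ<fa : ⟦ q ⟧ + ρ < f a) where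

    open Realise {q} {ℚ.- 1ℚ} {T} {Weights α₁ α₂ α₃} {C} (inj₂ refl) (proj₂ approximation) a public

    R : ℕ → Set
    R n = + 4 / 1 ℚ.≤ cℚ (seq a n) × cℚ (seq a n) ℚ.≤ (q ℚ.+ 1ℚ) ℚ.* (q ℚ.+ 1ℚ) ℚ.+ (+ 3 / 1) ℚ.* (q ℚ.+ 1ℚ)

    R-eventually : Eventually R
    R-eventually = mapᵉ bounds
      ((<-eventually (nat 0) ρ 0<ρ ⊓ᵉ <-eventually (⟦ q ⟧ + ρ) (f a) q+ρ<fa) ⊓ᵉ ∣a∣≤q 1ℚ 0<1)
      where
      bounds : ∀ n → (0ℚ ℚ.≤ seq ρ n × q ℚ.+ seq ρ n ℚ.≤ fℚ (seq a n)) × ℚ.∣ seq a n ∣ ℚ.≤ q ℚ.+ 1ℚ → R n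
      bounds n ((0≤ρ , q+ρ≤f) , ∣a∣≤) = c-bounds-q>5 (seq a n)
        -- The terms of `f a` are eventually at least q, hence greater than 4, which forces those of
        -- a to be at least 1.
        (ℚₚ.<-≤-trans (ℚₚ.<-trans (<-of 1ℚ 0<1 refl) 5<q) (ℚₚ.≤-trans (≤-of (seq ρ n) 0≤ρ refl) q+ρ≤f))
        (∣x∣≤⇒x≤ ∣a∣≤)

    1≤τ : ∀ n → R n → 1ℚ ℚ.≤ τ n
    1≤τ n (4≤c , _) = ≤-of ((x ℚ.- + 4 / 1) ℚ.+ ((q ℚ.- + 5 / 1) ℚ.+ + 7 / 1))
      (0≤+ (0≤- 4≤c) (0≤+ 0≤q-5 (ℚₚ.nonNegative⁻¹ (+ 7 / 1))))
      (solve 2 (λ x q → con (ℚ.- 1ℚ) :* (con 1ℚ :- (x :+ q)) := con 1ℚ :+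
         ((x :- con (+ 4 / 1)) :+ ((q :- con (+ 5 / 1)) :+ con (+ 7 / 1)))) refl x q)
      where x = cℚ (seq a n)

    τ≤ : ∀ n → R n → τ n ℚ.≤ T
    τ≤ n (_ , c≤) = ≤-of ((B ℚ.- x) ℚ.+ 1ℚ) (0≤+ (0≤- c≤) (ℚₚ.<⇒≤ 0<1))
      (solve 3 (λ B x q → B :+ q := con (ℚ.- 1ℚ) :* (con 1ℚ :- (x :+ q)) :+ ((B :- x) :+ con 1ℚ)) refl B x q)
      where
      x = cℚ (seq a n)
      B = (q ℚ.+ 1ℚ) ℚ.* (q ℚ.+ 1ℚ) ℚ.+ (+ 3 / 1) ℚ.* (q ℚ.+ 1ℚ)

    module _ {b : ℚ} (n : ℕ) (P : ℚ) (r : R n) (b≡ : b ≡ ℚ.- 1ℚ ℚ.* P ℚ.- 1ℚ) (τ≤P : τ n ℚ.≤ P) (P≤τ+1 : P ℚ.≤ τ n ℚ.+ 1ℚ) where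
      private
        x = cℚ (seq a n)
        t = q ℚ.- + 5 / 1

        0≤P+1 : 0ℚ ℚ.≤ P ℚ.+ 1ℚ
        0≤P+1 = 0≤+ (ℚₚ.≤-trans (ℚₚ.<⇒≤ 0<1) (ℚₚ.≤-trans (1≤τ n r) τ≤P)) (ℚₚ.<⇒≤ 0<1)

        ∣b∣≡P+1 : ℚ.∣ b ∣ ≡ P ℚ.+ 1ℚ
        ∣b∣≡P+1 = begin
          ℚ.∣ b ∣               ≡⟨ ℚₚ.∣-p∣≡∣p∣ b ⟨
          ℚ.∣ ℚ.- b ∣           ≡⟨ cong (λ y → ℚ.∣ ℚ.- y ∣) b≡ ⟩
          ℚ.∣ ℚ.- (ℚ.- 1ℚ ℚ.* P ℚ.- 1ℚ) ∣
            ≡⟨ cong ℚ.∣_∣ (solve 1 (λ P → :- (con (ℚ.- 1ℚ) :* P :- con 1ℚ) := P :+ con 1ℚ) refl P) ⟩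
          ℚ.∣ P ℚ.+ 1ℚ ∣        ≡⟨ ℚₚ.0≤p⇒∣p∣≡p 0≤P+1 ⟩
          P ℚ.+ 1ℚ ∎
          where open ≡-Reasoning

        q≤P+1 : q ℚ.≤ P ℚ.+ 1ℚ
        q≤P+1 = ≤-of ((P ℚ.- τ n) ℚ.+ ((x ℚ.- + 4 / 1) ℚ.+ + 4 / 1))
          (0≤+ (0≤- τ≤P) (0≤+ (0≤- (proj₁ r)) (ℚₚ.nonNegative⁻¹ (+ 4 / 1))))
          (solve 3 (λ P x q → P :+ con 1ℚ := q :+ ((P :- con (ℚ.- 1ℚ) :* (con 1ℚ :- (x :+ q)))
             :+ ((x :- con (+ 4 / 1)) :+ con (+ 4 / 1)))) refl P x q)

        P+1≤T+2 : P ℚ.+ 1ℚ ℚ.≤ T ℚ.+ 2ℚ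
        P+1≤T+2 = ℚₚ.≤-trans (ℚₚ.+-monoˡ-≤ 1ℚ (ℚₚ.≤-trans P≤τ+1 (ℚₚ.+-monoˡ-≤ 1ℚ (τ≤ n r))))
          (ℚₚ.≤-reflexive (ℚₚ.+-assoc T 1ℚ 1ℚ))

        -- with q = 5 + t, the difference is 10 t³ + 149 t² + 734 t + 1189
        T+2≤10q³ : T ℚ.+ 2ℚ ℚ.≤ + 10 / 1 ℚ.* (q ℚ.* (q ℚ.* (q ℚ.* 1ℚ)))
        T+2≤10q³ = ≤-of (t ℚ.* (t ℚ.* (+ 10 / 1 ℚ.* t ℚ.+ + 149 / 1) ℚ.+ + 734 / 1) ℚ.+ + 1189 / 1)
          (0≤+ (0≤* 0≤q-5 (0≤+ (0≤* 0≤q-5 (0≤+ (0≤* (ℚₚ.nonNegative⁻¹ (+ 10 / 1)) 0≤q-5) (ℚₚ.nonNegative⁻¹ (+ 149 / 1))))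
            (ℚₚ.nonNegative⁻¹ (+ 734 / 1)))) (ℚₚ.nonNegative⁻¹ (+ 1189 / 1)))
          (solve 1 (λ q → con (+ 10 / 1) :* (q :* (q :* (q :* con 1ℚ)))
             := ((q :+ con 1ℚ) :* (q :+ con 1ℚ) :+ con (+ 3 / 1) :* (q :+ con 1ℚ) :+ q) :+ con 2ℚ
                :+ ((q :- con (+ 5 / 1)) :* ((q :- con (+ 5 / 1)) :* (con (+ 10 / 1) :* (q :- con (+ 5 / 1)) :+ con (+ 149 / 1))
                   :+ con (+ 734 / 1)) :+ con (+ 1189 / 1))) refl q)

      b-lower : ⟦ q ⟧ ≤ ∣ ⟦ b ⟧ ∣
      b-lower = ≤-eventually ⟦ q ⟧ ∣ ⟦ b ⟧ ∣ (0 , λ _ _ → subst (q ℚ.≤_) (sym ∣b∣≡P+1) q≤P+1)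

      b-upper : ∣ ⟦ b ⟧ ∣ ≤ nat 10 * ⟦ q ⟧ ^ 3
      b-upper = ≤-eventually ∣ ⟦ b ⟧ ∣ (nat 10 * ⟦ q ⟧ ^ 3) (0 , λ _ _ →
        subst (ℚ._≤ + 10 / 1 ℚ.* (q ℚ.* (q ℚ.* (q ℚ.* 1ℚ)))) (sym ∣b∣≡P+1) (ℚₚ.≤-trans P+1≤T+2 T+2≤10q³))

  claim : ∀ k → Claim q α₁ α₂ α₃ ⟦ 1ℚ ⟧ ⟦ ½ ⟧ (sizePoly C) k
  claim (below0 q<0 _ _ _ _ _ _) = contradiction (ℚₚ.<-trans 5<q q<0) (ℚₚ.<-asym (ℚₚ.positive⁻¹ (+ 5 / 1)))
  claim k@(above5 _) ρ a 0<ρ _ _ ∣a∣≤q q+ρ<fa _ _ ρ̂ 0<ρ̂ ρ̂<½ =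
    conclude (realise R-eventually 1≤τ τ≤ ρ̂ 0<ρ̂ ρ̂<½)
    where
    open Bounds ρ a 0<ρ ∣a∣≤q q+ρ<fa
    conclude : Realised R ρ̂ → Conclusion q α₁ α₂ α₃ (sizePoly C) k a ρ̂
    conclude (Υ , ŵ , b , ŵ∈W , implements , (n , P , r , b≡ , τ≤P , P≤τ+1) , rest) =
      Υ , ŵ , b , ŵ∈W , implements , b-lower n P r b≡ τ≤P P≤τ+1 , b-upper n P r b≡ τ≤P P≤τ+1 , rest

0<⟦_⟧ : ∀ p → 0ℚ ℚ.< p → nat 0 < ⟦ p ⟧
0<⟦ p ⟧ 0<p = p , 0<p , 0 , λ _ _ → ℚₚ.≤-reflexive (ℚₚ.+-identityˡ p)

lemma2 : (q α₁ α₂ α₃ : ℚ) →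
    ¬ (0ℚ ℚ.≤ q × q ℚ.≤ + 5 / 1) →
    ¬ (-[1+ 1 ] / 1 ℚ.≤ α₁ × α₁ ℚ.≤ 0ℚ) →
    (-[1+ 1 ] / 1 ℚ.< α₂ × α₂ ℚ.< 0ℚ) →
    α₃ ℚ.< -[1+ 0 ] / 1 →
    Σ[ ρ₀ ∈ ℝ ] Σ[ ρ̂₀ ∈ ℝ ] Σ[ p ∈ List ℝ ]
    (nat 0 < ρ₀ × nat 0 < ρ̂₀ ×
    ((k : Constants q) (ρ a : ℝ) →
    nat 0 < ρ → ρ < ρ₀ →
    A⁻ k ≤ ∣ a ∣ → ∣ a ∣ ≤ A⁺ k →
    ⟦ q ⟧ + ρ < f a → f a ≤ ⟦ q ⟧ + nat 2 * ρ →
    η k ≤ ∣ f a ∣ →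
    let c = a ^ 2 + nat 3 * a + ⟦ q ⟧ in
    (ρ̂ : ℝ) → nat 0 < ρ̂ → ρ̂ < ρ̂₀ →
    Σ[ Υ ∈ PlanarNetwork ] Σ[ ŵ ∈ (Fin (PlanarNetwork.#E Υ) → ℚ) ] Σ[ b ∈ ℚ ]
    ((∀ e → ŵ e ≡ α₁ ⊎ ŵ e ≡ α₂ ⊎ ŵ e ≡ α₃) ×
    Implements q Υ ŵ b ×
    B⁻ k ≤ ∣ ⟦ b ⟧ ∣ × ∣ ⟦ b ⟧ ∣ ≤ B⁺ k ×
    - ρ̂ ≤ ⟦ b ⟧ + c × ⟦ b ⟧ + c ≤ ρ̂ ×
    (∀ L → IsLog₂Recip ρ̂ L → nat (size (PlanarNetwork.graph Υ)) ≤ evalPoly p L))))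
lemma2 q α₁ α₂ α₃ q∉ α₁∉ (-2<α₂ , α₂<0) α₃<-1 = by-sign (q ℚₚ.<? 0ℚ)
  where
  by-sign : Dec (q ℚ.< 0ℚ) → Σ[ ρ₀ ∈ ℝ ] Σ[ ρ̂₀ ∈ ℝ ] Σ[ p ∈ List ℝ ]
    (nat 0 < ρ₀ × nat 0 < ρ̂₀ × (∀ k → Claim q α₁ α₂ α₃ ρ₀ ρ̂₀ p k))
  by-sign (yes q<0) = ρ₀ , ⟦ ½ ⟧ , sizePoly C , 0<⟦ _ ⟧ 0<-q/4 , 0<⟦ ½ ⟧ (ℚₚ.positive⁻¹ ½) , claim
    where open NegativeCase {q} {α₁} {α₂} {α₃} q<0 α₁∉ -2<α₂ α₂<0
  by-sign (no q≮0) = ⟦ 1ℚ ⟧ , ⟦ ½ ⟧ , sizePoly C , 0<⟦ 1ℚ ⟧ 0<1 , 0<⟦ ½ ⟧ (ℚₚ.positive⁻¹ ½) , claim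
    where
    5<q : + 5 / 1 ℚ.< q
    5<q = ℚₚ.≰⇒> λ q≤5 → q∉ (ℚₚ.≮⇒≥ q≮0 , q≤5)
    open LargeCase {q} {α₁} {α₂} {α₃} 5<q α₁∉ -2<α₂ α₂<0 α₃<-1
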